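{- Let $\mathbf{k}$ be a commutative ring and $H$ a commutative connected graded $\mathbf{k}$-Hopf algebra. Let $\beta_H:H\to H\otimes\mathrm{QSym}_{\mathbf{k}}$ be defined by $\beta_H(h)=\sum_{\alpha\in\mathrm{Comp}}\xi_\alpha(h)\otimes M_\alpha$. (a) $\beta_H$ is a $\mathbf{k}$-algebra homomorphism and a graded $(\mathbf{k},H)$-coalgebra homomorphism. (b) $(\mathrm{id}_H\otimes\varepsilon_P)\circ\beta_H=\mathrm{id}_H$ (identifying $H\otimes\mathbf{k}$ with $H$). (c) $(\beta_H\otimes\mathrm{id}_{\mathrm{QSym}_{\mathbf{k}}})\circ\beta_H=(\mathrm{id}_H\otimes\Delta'_P)\circ\beta_H$ as maps $H\to H\otimes\mathrm{QSym}_{\mathbf{k}}\otimes\mathrm{QSym}_{\mathbf{k}}$. (d) If the $\mathbf{k}$-coalgebra $H$ is cocommutative, then $\beta_H(H)\subseteq H\otimes\Lambda_{\mathbf{k}}$, where $\Lambda_{\mathbf{k}}\subseteq\mathrm{QSym}_{\mathbf{k}}$ is the algebra of symmetric functions.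
   Context: Unadorned tensor products are over $\mathbf{k}$; graded means $\mathbb{N}$-graded, connected means $H_0\cong\mathbf{k}$ via the counit. A composition is a finite sequence of positive integers; $\mathrm{Comp}$ the set of compositions. $\mathrm{QSym}_{\mathbf{k}}\subseteq\mathbf{k}[[x_1,x_2,\ldots]]$ is the Hopf algebra of quasisymmetric functions with monomial basis $M_\alpha=\sum_{1\le i_1<\cdots<i_\ell}x_{i_1}^{\alpha_1}\cdots x_{i_\ell}^{\alpha_\ell}$ (for $\alpha=(\alpha_1,\ldots,\alpha_\ell)$, degree $\alpha_1+\cdots+\alpha_\ell$), with $\Delta(M_{(b_1,\ldots,b_\ell)})=\sum_{i=0}^\ell M_{(b_1,\ldots,b_i)}\otimes M_{(b_{i+1},\ldots,b_\ell)}$; $\varepsilon_P:\mathrm{QSym}_{\mathbf{k}}\to\mathbf{k}$, $f\mapsto f(1,0,0,\ldots)$. For $\alpha=(a_1,\ldots,a_k)$, $\xi_\alpha=m^{(k-1)}\circ\pi_\alpha\circ\Delta^{(k-1)}:H\to H$, where $\Delta^{(k-1)}:H\to H^{\otimes k}$ is the iterated comultiplication ($\Delta^{(-1)}=\varepsilon$, $\Delta^{(0)}=\mathrm{id}$, $\Delta^{(k)}=(\mathrm{id}\otimes\Delta^{(k-1)})\circ\Delta$), $m^{(k-1)}:H^{\otimes k}\to H$ is $h_1\otimes\cdots\otimes h_k\mapsto h_1\cdots h_k$ ($m^{(-1)}$ the unit), and $\pi_\alpha=\pi_{a_1}\otimes\cdots\otimes\pi_{a_k}$ with $\pi_n:H\to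 H$ the projection onto $H_n$. The sum defining $\beta_H(h)$ is finite. Second comultiplication: for $A=(a_{i,j})\in\mathbb{N}^{u\times v}$, $\mathrm{column}\,A$ is the $v$-tuple of column sums, $\mathrm{row}\,A$ the $u$-tuple of row sums, $\mathrm{read}\,A=(a_{1,1},\ldots,a_{1,v},\ldots,a_{u,1},\ldots,a_{u,v})$; $A$ is reduced if no row and no column is zero; $\mathbb{N}^{\bullet,\bullet}_{\mathrm{red}}$ is the set of all reduced matrices of all sizes; $w^{\mathrm{red}}$ is $w$ with zero entries removed. $\Delta_P$ is the $\mathbf{k}$-linear map $M_\gamma\mapsto\sum_{A\in\mathbb{N}^{\bullet,\bullet}_{\mathrm{red}},(\mathrm{read}\,A)^{\mathrm{red}}=\gamma}M_{\mathrm{row}\,A}\otimes M_{\mathrm{column}\,A}$, and $\Delta'_P=\tau\circ\Delta_P$ with $\tau$ the twist $x\otimes y\mapsto y\otimes x$. Extension of scalars: $H\otimes\mathrm{QSym}_{\mathbf{k}}$ is regarded as an $H$-module via $a(b\otimes q)=ab\otimes q$, an $H$-algebra, and an $H$-coalgebra with comultiplication $\mathrm{id}_H\otimes\Delta$ (identifying $H\otimes(Q\otimes Q)\cong(H\otimes Q)\otimes_H(H\otimes Q)$) and counit $\mathrm{id}_H\otimes\varepsilon$, graded by $(H\otimes\mathrm{QSym}_{\mathbf{k}})_n=H\otimes(\mathrm{QSym}_{\mathbf{k}})_n$ (the grading and coalgebra structure of the left factor $H$ are ignored). Also $H\otimes H$ (scalars extended to the left factor) is an $H$-coalgebra in the same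 way. A $\mathbf{k}$-linear $f:H\to G$ into an $H$-coalgebra $G$ is a $(\mathbf{k},H)$-coalgebra homomorphism if $f^\sharp:H\otimes H\to G$, $a\otimes h\mapsto af(h)$, is an $H$-coalgebra homomorphism; graded means $\beta_H(H_n)\subseteq H\otimes(\mathrm{QSym}_{\mathbf{k}})_n$. -}

module Defs where

open import Level as Level using (Level)
open import Algebra.Bundles using (CommutativeMonoid; CommutativeRing)
open import Algebra.Core using (Op₁; Op₂)
open import Algebra.Module.Bundles using (Module)
open import Algebra.Module.Core using (Opₗ)
open import Algebra.Module.Structures using (IsLeftModule; IsModule)
open import Algebra.Module.Structures.Biased using (IsModuleFromLeft)
open import Algebra.Module.Morphism.Structures using (IsModuleHomomorphism)
open import Algebra.Morphism.Structures using (IsRingHomomorphism)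
import Algebra.Module.Construct.TensorUnit as TensorUnit
import Algebra.Module.Morphism.Construct.Composition as Composition
import Algebra.Module.Morphism.Construct.Identity as Identity
import Algebra.Properties.AbelianGroup as AbelianGroupProperties
import Algebra.Properties.CommutativeSemigroup as CommutativeSemigroupProperties
open import Data.Bool using (if_then_else_)
open import Data.Empty using (⊥-elim)
open import Data.List as List using (List; []; _∷_; _++_; length; map; concatMap; cartesianProduct; cartesianProductWith; filter; upTo)
open import Data.List.Properties using (≡-dec)
open import Data.List.Relation.Binary.Permutation.Propositional using (_↭_)
open import Data.List.Relation.Unary.All as All using (All; []; _∷_)
import Data.List.Relation.Unary.All.Properties as All
open import Data.Nat as ℕ using (ℕ; zero; _≤_; _<_; _⊔_; _∸_)
open import Data.Nat.ListAction using (sum)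
import Data.Nat.Properties as ℕ
open import Data.Product using (Σ; ∃; ∃₂; _×_; _,_; proj₁; proj₂; map₁)
open import Data.Vec as Vec using (Vec; []; _∷_)
import Data.Vec.Relation.Unary.All as VecAll
open import Function using (_∘_; flip; Bijective)
open import Relation.Binary.PropositionalEquality as ≡ using (_≡_; _≢_)
open import Relation.Nullary using (Dec; yes; no; does; ¬_; ¬?; _×-dec_)
open import Relation.Nullary.Decidable using (map′)
import Relation.Binary.Reasoning.Setoid as ≈-Reasoning

private
  variable
    ℓ : Level

∣_∣ : {R : CommutativeRing ℓ ℓ} → Module R ℓ ℓ → Set ℓ
∣ M ∣ = Module.Carrierᴹ M

infixr 1 _→ₗ_

record _→ₗ_ {R : CommutativeRing ℓ ℓ} (M N : Module R ℓ ℓ) : Set ℓ where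
  constructor linear
  field
    ⟦_⟧ : ∣ M ∣ → ∣ N ∣
    isModuleHomomorphism :
      IsModuleHomomorphism (Module.rawModule M) (Module.rawModule N) ⟦_⟧

  open IsModuleHomomorphism isModuleHomomorphism public
    using (⟦⟧-cong; +ᴹ-homo; 0ᴹ-homo; -ᴹ-homo; *ₗ-homo)

open _→ₗ_ public using (⟦_⟧)

module _ {R : CommutativeRing ℓ ℓ} where

  open CommutativeRing R using () renaming (Carrier to K)

  isModuleFromLeft : {A : Set ℓ} {_≈_ : A → A → Set ℓ} {_+_ : Op₂ A} {0# : A} { -_ : Op₁ A}
    {_*ₗ_ : Opₗ K A} →
    IsLeftModule (CommutativeRing.ring R) _≈_ _+_ 0# -_ _*ₗ_ →
    IsModule R _≈_ _+_ 0# -_ _*ₗ_ (flip _*ₗ_)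
  isModuleFromLeft isLeftModule = IsModuleFromLeft.isModule {commutativeRing = R}
      (record { isLeftModule = isLeftModule })

  𝟙 : Module R ℓ ℓ
  𝟙 = TensorUnit.⟨module⟩

  *ₗ-negate : (M : Module R ℓ ℓ) (x : ∣ M ∣) →
    Module._≈ᴹ_ M (Module._*ₗ_ M (CommutativeRing.-_ R (CommutativeRing.1# R)) x) (Module.-ᴹ_ M x)
  *ₗ-negate M x = AbelianGroupProperties.inverseʳ-unique +ᴹ-abelianGroup _ _ (begin
      x +ᴹ (- 1#) *ₗ x         ≈⟨ +ᴹ-congʳ (≈ᴹ-sym (*ₗ-identityˡ x)) ⟩
      1# *ₗ x +ᴹ (- 1#) *ₗ x   ≈⟨ ≈ᴹ-sym (*ₗ-distribʳ x 1# (- 1#)) ⟩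
      (1# + (- 1#)) *ₗ x       ≈⟨ *ₗ-congʳ (-‿inverseʳ 1#) ⟩
      0# *ₗ x                  ≈⟨ *ₗ-zeroˡ x ⟩
      0ᴹ                       ∎)
    where
    open Module M
    open CommutativeRing R using (1#; 0#; -_; _+_; -‿inverseʳ)
    open ≈-Reasoning ≈ᴹ-setoid

  module _ {M N : Module R ℓ ℓ} where
    private
      module M = Module M
      module N = Module N

    -- The laws of modules and of linear maps are opaque because unfolding them is slow.
    opaque
      isModuleHomomorphismFromLeft : (f : ∣ M ∣ → ∣ N ∣) →
        (∀ {x y} → x M.≈ᴹ y → f x N.≈ᴹ f y) →
        (∀ x y → f (x M.+ᴹ y) N.≈ᴹ (f x N.+ᴹ f y)) →
        (∀ r x → f (r M.*ₗ x) N.≈ᴹ (r N.*ₗ f x)) →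
        IsModuleHomomorphism M.rawModule N.rawModule f
      isModuleHomomorphismFromLeft f f-cong f-+ f-* = record
        { isBimoduleHomomorphism = record
          { +ᴹ-isGroupHomomorphism = record
            { isMonoidHomomorphism = record
              { isMagmaHomomorphism = record
                { isRelHomomorphism = record { cong = f-cong }
                ; homo = f-+
                }
              ; ε-homo = f-0
              }
            ; ⁻¹-homo = λ x → N.≈ᴹ-trans (f-cong (M.≈ᴹ-sym (*ₗ-negate M x)))
                (N.≈ᴹ-trans (f-* _ x) (*ₗ-negate N (f x)))
            }
          ; *ₗ-homo = f-*
          ; *ᵣ-homo = λ r x → N.≈ᴹ-trans (f-cong (M.≈ᴹ-sym (M.*ₗ-*ᵣ-coincident r x)))
              (N.≈ᴹ-trans (f-* r x) (N.*ₗ-*ᵣ-coincident r (f x)))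
          }
        }
        where
        open CommutativeRing R using (0#)
        f-0 : f M.0ᴹ N.≈ᴹ N.0ᴹ
        f-0 = N.≈ᴹ-trans (f-cong (M.≈ᴹ-sym (M.*ₗ-zeroˡ M.0ᴹ)))
                (N.≈ᴹ-trans (f-* 0# M.0ᴹ) (N.*ₗ-zeroˡ _))

    mkLinear : (f : ∣ M ∣ → ∣ N ∣) →
      (∀ {x y} → x M.≈ᴹ y → f x N.≈ᴹ f y) →
      (∀ x y → f (x M.+ᴹ y) N.≈ᴹ (f x N.+ᴹ f y)) →
      (∀ r x → f (r M.*ₗ x) N.≈ᴹ (r N.*ₗ f x)) →
      M →ₗ N
    mkLinear f f-cong f-+ f-* = linear f (isModuleHomomorphismFromLeft f f-cong f-+ f-*)

  idₗ : {M : Module R ℓ ℓ} → M →ₗ M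
  idₗ {M} = linear (λ x → x)
    (Identity.isModuleHomomorphism (Module.rawModule M) (Module.≈ᴹ-refl M))

  infixr 9 _∘ₗ_

  _∘ₗ_ : {L M N : Module R ℓ ℓ} → M →ₗ N → L →ₗ M → L →ₗ N
  _∘ₗ_ {N = N} g f = linear (⟦ g ⟧ ∘ ⟦ f ⟧)
    (Composition.isModuleHomomorphism (Module.≈ᴹ-trans N)
      (_→ₗ_.isModuleHomomorphism f) (_→ₗ_.isModuleHomomorphism g))

module _ {R : CommutativeRing ℓ ℓ} (M : Module R ℓ ℓ) where
  open Module M

  ∑ : ∀ {a} {A : Set a} → List A → (A → ∣ M ∣) → ∣ M ∣
  ∑ []       f = 0ᴹ
  ∑ (x ∷ xs) f = f x +ᴹ ∑ xs f

  -- the sum of f 0, …, f (n - 1)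
  ∑< : ℕ → (ℕ → ∣ M ∣) → ∣ M ∣
  ∑< zero   f = 0ᴹ
  ∑< (ℕ.suc n) f = ∑< n f +ᴹ f n

module Sums {R : CommutativeRing ℓ ℓ} (M : Module R ℓ ℓ) where
  open Module M
  open ≈-Reasoning ≈ᴹ-setoid
  open CommutativeSemigroupProperties (CommutativeMonoid.commutativeSemigroup +ᴹ-commutativeMonoid)
    using () renaming (interchange to +ᴹ-interchange)

  ∑-cong : ∀ {a} {A : Set a} (xs : List A) {f g : A → ∣ M ∣} →
    (∀ x → f x ≈ᴹ g x) → ∑ M xs f ≈ᴹ ∑ M xs g
  ∑-cong []       f≈g = ≈ᴹ-refl
  ∑-cong (x ∷ xs) f≈g = +ᴹ-cong (f≈g x) (∑-cong xs f≈g)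

  ∑-zero : ∀ {a} {A : Set a} {xs : List A} {f : A → ∣ M ∣} →
    All (λ x → f x ≈ᴹ 0ᴹ) xs → ∑ M xs f ≈ᴹ 0ᴹ
  ∑-zero []         = ≈ᴹ-refl
  ∑-zero (eq ∷ eqs) = ≈ᴹ-trans (+ᴹ-cong eq (∑-zero eqs)) (+ᴹ-identityˡ 0ᴹ)

  ∑-+ : ∀ {a} {A : Set a} (xs : List A) (f g : A → ∣ M ∣) →
    ∑ M xs (λ x → f x +ᴹ g x) ≈ᴹ (∑ M xs f +ᴹ ∑ M xs g)
  ∑-+ []       f g = ≈ᴹ-sym (+ᴹ-identityˡ 0ᴹ)
  ∑-+ (x ∷ xs) f g = begin
    (f x +ᴹ g x) +ᴹ ∑ M xs (λ x → f x +ᴹ g x)    ≈⟨ +ᴹ-congˡ (∑-+ xs f g) ⟩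
    (f x +ᴹ g x) +ᴹ (∑ M xs f +ᴹ ∑ M xs g)       ≈⟨ +ᴹ-interchange _ _ _ _ ⟩
    (f x +ᴹ ∑ M xs f) +ᴹ (g x +ᴹ ∑ M xs g)       ∎

  ∑-* : ∀ {a} {A : Set a} (xs : List A) r (f : A → ∣ M ∣) →
    ∑ M xs (λ x → r *ₗ f x) ≈ᴹ (r *ₗ ∑ M xs f)
  ∑-* []       r f = ≈ᴹ-sym (*ₗ-zeroʳ r)
  ∑-* (x ∷ xs) r f = ≈ᴹ-trans (+ᴹ-congˡ (∑-* xs r f)) (≈ᴹ-sym (*ₗ-distribˡ r (f x) (∑ M xs f)))

  ∑-++ : ∀ {a} {A : Set a} (xs ys : List A) (f : A → ∣ M ∣) →
    ∑ M (xs ++ ys) f ≈ᴹ (∑ M xs f +ᴹ ∑ M ys f)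
  ∑-++ []       ys f = ≈ᴹ-sym (+ᴹ-identityˡ _)
  ∑-++ (x ∷ xs) ys f = ≈ᴹ-trans (+ᴹ-congˡ (∑-++ xs ys f)) (≈ᴹ-sym (+ᴹ-assoc _ _ _))

  ∑-map : ∀ {a b} {A : Set a} {B : Set b} (h : A → B) (xs : List A) (f : B → ∣ M ∣) →
    ∑ M (map h xs) f ≈ᴹ ∑ M xs (f ∘ h)
  ∑-map h []       f = ≈ᴹ-refl
  ∑-map h (x ∷ xs) f = +ᴹ-congˡ (∑-map h xs f)

  ∑-cartesianProductWith : ∀ {a b c} {A : Set a} {B : Set b} {C : Set c}
    (h : A → B → C) (xs : List A) (ys : List B) (f : C → ∣ M ∣) →
    ∑ M (cartesianProductWith h xs ys) f ≈ᴹ ∑ M xs (λ x → ∑ M ys (λ y → f (h x y)))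
  ∑-cartesianProductWith h []       ys f = ≈ᴹ-refl
  ∑-cartesianProductWith h (x ∷ xs) ys f = begin
    ∑ M (map (h x) ys ++ cartesianProductWith h xs ys) f              ≈⟨ ∑-++ (map (h x) ys) _ f ⟩
    ∑ M (map (h x) ys) f +ᴹ ∑ M (cartesianProductWith h xs ys) f
      ≈⟨ +ᴹ-cong (∑-map (h x) ys f) (∑-cartesianProductWith h xs ys f) ⟩
    ∑ M ys (λ y → f (h x y)) +ᴹ ∑ M xs (λ x → ∑ M ys (λ y → f (h x y)))  ∎

  ∑<-cong : ∀ n {f g : ℕ → ∣ M ∣} → (∀ i → f i ≈ᴹ g i) → ∑< M n f ≈ᴹ ∑< M n g
  ∑<-cong zero   f≈g = ≈ᴹ-refl
  ∑<-cong (ℕ.suc n) f≈g = +ᴹ-cong (∑<-cong n f≈g) (f≈g n)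

  ∑<-+ : ∀ n (f g : ℕ → ∣ M ∣) → ∑< M n (λ i → f i +ᴹ g i) ≈ᴹ (∑< M n f +ᴹ ∑< M n g)
  ∑<-+ zero   f g = ≈ᴹ-sym (+ᴹ-identityˡ 0ᴹ)
  ∑<-+ (ℕ.suc n) f g = ≈ᴹ-trans (+ᴹ-congʳ (∑<-+ n f g)) (+ᴹ-interchange _ _ _ _)

  ∑<-* : ∀ n r (f : ℕ → ∣ M ∣) → ∑< M n (λ i → r *ₗ f i) ≈ᴹ (r *ₗ ∑< M n f)
  ∑<-* zero   r f = ≈ᴹ-sym (*ₗ-zeroʳ r)
  ∑<-* (ℕ.suc n) r f = ≈ᴹ-trans (+ᴹ-congʳ (∑<-* n r f)) (≈ᴹ-sym (*ₗ-distribˡ r _ _))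

  Vanishes≥ : ℕ → (ℕ → ∣ M ∣) → Set ℓ
  Vanishes≥ N f = ∀ n → N ≤ n → f n ≈ᴹ 0ᴹ

  private
    ∑<-extend : ∀ {N} d {f : ℕ → ∣ M ∣} → Vanishes≥ N f → ∑< M (d ℕ.+ N) f ≈ᴹ ∑< M N f
    ∑<-extend         zero   f≈0 = ≈ᴹ-refl
    ∑<-extend {N} (ℕ.suc d) f≈0 = ≈ᴹ-trans
      (+ᴹ-cong (∑<-extend d f≈0) (f≈0 (d ℕ.+ N) (ℕ.m≤n+m N d))) (+ᴹ-identityʳ _)

  ∑<-stable : ∀ {N N′} {f : ℕ → ∣ M ∣} → Vanishes≥ N f → N ≤ N′ → ∑< M N′ f ≈ᴹ ∑< M N f
  ∑<-stable {N} {N′} {f} f≈0 N≤N′ =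
    ≡.subst (λ n → ∑< M n f ≈ᴹ ∑< M N f) (ℕ.m∸n+n≡m N≤N′) (∑<-extend (N′ ∸ N) f≈0)

  ∑<-bound : ∀ {N N′} {f g : ℕ → ∣ M ∣} → Vanishes≥ N f → Vanishes≥ N′ g →
    (∀ i → f i ≈ᴹ g i) → ∑< M N f ≈ᴹ ∑< M N′ g
  ∑<-bound {N} {N′} {f} {g} f≈0 g≈0 f≈g = begin
    ∑< M N f          ≈⟨ ∑<-stable f≈0 (ℕ.m≤m⊔n N N′) ⟨
    ∑< M (N ⊔ N′) f   ≈⟨ ∑<-cong (N ⊔ N′) f≈g ⟩
    ∑< M (N ⊔ N′) g   ≈⟨ ∑<-stable g≈0 (ℕ.m≤n⊔m N N′) ⟩
    ∑< M N′ g         ∎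

  vanishes-⊔ˡ : ∀ {N} N′ {f : ℕ → ∣ M ∣} → Vanishes≥ N f → Vanishes≥ (N ⊔ N′) f
  vanishes-⊔ˡ {N} N′ f≈0 n p = f≈0 n (ℕ.≤-trans (ℕ.m≤m⊔n N N′) p)

  vanishes-⊔ʳ : ∀ N {N′} {f : ℕ → ∣ M ∣} → Vanishes≥ N′ f → Vanishes≥ (N ⊔ N′) f
  vanishes-⊔ʳ N {N′} f≈0 n p = f≈0 n (ℕ.≤-trans (ℕ.m≤n⊔m N N′) p)

  vanishes-+ : ∀ {N} {f g : ℕ → ∣ M ∣} → Vanishes≥ N f → Vanishes≥ N g →
    Vanishes≥ N (λ i → f i +ᴹ g i)
  vanishes-+ f≈0 g≈0 n p = ≈ᴹ-trans (+ᴹ-cong (f≈0 n p) (g≈0 n p)) (+ᴹ-identityˡ 0ᴹ)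

  vanishes-* : ∀ {N} r {f : ℕ → ∣ M ∣} → Vanishes≥ N f → Vanishes≥ N (λ i → r *ₗ f i)
  vanishes-* r f≈0 n p = ≈ᴹ-trans (*ₗ-congˡ (f≈0 n p)) (*ₗ-zeroʳ r)

  -- additivity of ∑< when each of the three sums uses its own bound
  ∑<-bound-+ : ∀ {N N₁ N₂} {f g h : ℕ → ∣ M ∣} →
    Vanishes≥ N h → Vanishes≥ N₁ f → Vanishes≥ N₂ g → (∀ i → h i ≈ᴹ (f i +ᴹ g i)) →
    ∑< M N h ≈ᴹ (∑< M N₁ f +ᴹ ∑< M N₂ g)
  ∑<-bound-+ {N} {N₁} {N₂} {f} {g} {h} h≈0 f≈0 g≈0 eq = begin
    ∑< M N h                                   ≈⟨ ∑<-bound h≈0 (vanishes-+ (vanishes-⊔ˡ N₂ f≈0) (vanishes-⊔ʳ N₁ g≈0)) eq ⟩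
    ∑< M (N₁ ⊔ N₂) (λ i → f i +ᴹ g i)          ≈⟨ ∑<-+ (N₁ ⊔ N₂) f g ⟩
    ∑< M (N₁ ⊔ N₂) f +ᴹ ∑< M (N₁ ⊔ N₂) g
      ≈⟨ +ᴹ-cong (∑<-stable f≈0 (ℕ.m≤m⊔n N₁ N₂)) (∑<-stable g≈0 (ℕ.m≤n⊔m N₁ N₂)) ⟩
    ∑< M N₁ f +ᴹ ∑< M N₂ g                     ∎

  ∑<-bound-* : ∀ {N N₁} r {f h : ℕ → ∣ M ∣} →
    Vanishes≥ N h → Vanishes≥ N₁ f → (∀ i → h i ≈ᴹ (r *ₗ f i)) →
    ∑< M N h ≈ᴹ (r *ₗ ∑< M N₁ f)
  ∑<-bound-* {N₁ = N₁} r {f} h≈0 f≈0 eq =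
    ≈ᴹ-trans (∑<-bound h≈0 (vanishes-* r f≈0) eq) (∑<-* N₁ r f)

module _ {R : CommutativeRing ℓ ℓ} {M N : Module R ℓ ℓ} (f : M →ₗ N) where
  private
    module f = _→ₗ_ f
    module N = Module N

  ∑<-homo : ∀ n (g : ℕ → ∣ M ∣) → ⟦ f ⟧ (∑< M n g) N.≈ᴹ ∑< N n (⟦ f ⟧ ∘ g)
  ∑<-homo zero   g = f.0ᴹ-homo
  ∑<-homo (ℕ.suc n) g = N.≈ᴹ-trans (f.+ᴹ-homo _ _) (N.+ᴹ-congʳ (∑<-homo n g))

infixr 7 _⊗_
infixl 6 _+ₜ_
infix  4 _≈ₜ_

-- Finite sums of pure tensors. Formal negatives are not needed, because ⊗-zeroˡ below
-- makes (- x) ⊗ y the negative of x ⊗ y.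
data Tensor {R : CommutativeRing ℓ ℓ} (M N : Module R ℓ ℓ) : Set ℓ where
  0ₜ   : Tensor M N
  _⊗_  : ∣ M ∣ → ∣ N ∣ → Tensor M N
  _+ₜ_ : Tensor M N → Tensor M N → Tensor M N

data _≈ₜ_ {R : CommutativeRing ℓ ℓ} {M N : Module R ℓ ℓ} : Tensor M N → Tensor M N → Set ℓ where
  reflₜ       : ∀ {s} → s ≈ₜ s
  symₜ        : ∀ {s t} → s ≈ₜ t → t ≈ₜ s
  transₜ      : ∀ {s t u} → s ≈ₜ t → t ≈ₜ u → s ≈ₜ u
  +ₜ-cong     : ∀ {s s′ t t′} → s ≈ₜ s′ → t ≈ₜ t′ → s +ₜ t ≈ₜ s′ +ₜ t′
  +ₜ-assoc    : ∀ s t u → (s +ₜ t) +ₜ u ≈ₜ s +ₜ (t +ₜ u)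
  +ₜ-comm     : ∀ s t → s +ₜ t ≈ₜ t +ₜ s
  +ₜ-identity : ∀ s → 0ₜ +ₜ s ≈ₜ s
  ⊗-cong      : ∀ {x x′ y y′} → Module._≈ᴹ_ M x x′ → Module._≈ᴹ_ N y y′ → x ⊗ y ≈ₜ x′ ⊗ y′
  ⊗-zeroˡ     : ∀ y → Module.0ᴹ M ⊗ y ≈ₜ 0ₜ
  ⊗-+ˡ        : ∀ x x′ y → Module._+ᴹ_ M x x′ ⊗ y ≈ₜ x ⊗ y +ₜ x′ ⊗ y
  ⊗-+ʳ        : ∀ x y y′ → x ⊗ Module._+ᴹ_ N y y′ ≈ₜ x ⊗ y +ₜ x ⊗ y′
  ⊗-balanced  : ∀ r x y → Module._*ₗ_ M r x ⊗ y ≈ₜ x ⊗ Module._*ₗ_ N r y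

module _ {R : CommutativeRing ℓ ℓ} {M N : Module R ℓ ℓ} where

  mapˡ : (∣ M ∣ → ∣ M ∣) → Tensor M N → Tensor M N
  mapˡ f 0ₜ       = 0ₜ
  mapˡ f (x ⊗ y)  = f x ⊗ y
  mapˡ f (s +ₜ t) = mapˡ f s +ₜ mapˡ f t

  private
    module M = Module M
    module N = Module N
    0ᴿ = CommutativeRing.0# R

  ⊗-congʳ : ∀ {x x′ y} → x M.≈ᴹ x′ → _≈ₜ_ {M = M} {N = N} (x ⊗ y) (x′ ⊗ y)
  ⊗-congʳ eq = ⊗-cong eq N.≈ᴹ-refl

  ⊗-congˡ : ∀ {x y y′} → y N.≈ᴹ y′ → _≈ₜ_ {M = M} {N = N} (x ⊗ y) (x ⊗ y′)
  ⊗-congˡ eq = ⊗-cong M.≈ᴹ-refl eq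

  ⊗-zeroʳ : ∀ x → _≈ₜ_ {M = M} {N = N} (x ⊗ N.0ᴹ) 0ₜ
  ⊗-zeroʳ x = transₜ (⊗-congˡ (N.≈ᴹ-sym (N.*ₗ-zeroˡ N.0ᴹ)))
    (transₜ (symₜ (⊗-balanced 0ᴿ x N.0ᴹ)) (transₜ (⊗-congʳ (M.*ₗ-zeroˡ x)) (⊗-zeroˡ _)))

  +ₜ-interchange : ∀ (s t u v : Tensor M N) → (s +ₜ t) +ₜ (u +ₜ v) ≈ₜ (s +ₜ u) +ₜ (t +ₜ v)
  +ₜ-interchange s t u v = transₜ (+ₜ-assoc s t _) (transₜ (+ₜ-cong reflₜ
    (transₜ (symₜ (+ₜ-assoc t u v)) (transₜ (+ₜ-cong (+ₜ-comm t u) reflₜ) (+ₜ-assoc u t v))))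
    (symₜ (+ₜ-assoc s u _)))

  -- For an action r ∙ x of some ring on M commuting with that of R, the operation
  -- r ∙ (x ⊗ y) = (r ∙ x) ⊗ y is an action on the tensor product.
  module LeftAction {S : CommutativeRing ℓ ℓ}
    (_∙_ : CommutativeRing.Carrier S → ∣ M ∣ → ∣ M ∣)
    (∙-cong : ∀ {r s x y} → CommutativeRing._≈_ S r s → x M.≈ᴹ y → (r ∙ x) M.≈ᴹ (s ∙ y))
    (∙-+ˡ : ∀ r s x → (CommutativeRing._+_ S r s ∙ x) M.≈ᴹ ((r ∙ x) M.+ᴹ (s ∙ x)))
    (∙-+ʳ : ∀ r x y → (r ∙ (x M.+ᴹ y)) M.≈ᴹ ((r ∙ x) M.+ᴹ (r ∙ y)))
    (∙-assoc : ∀ r s x → (CommutativeRing._*_ S r s ∙ x) M.≈ᴹ (r ∙ (s ∙ x)))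
    (∙-identity : ∀ x → (CommutativeRing.1# S ∙ x) M.≈ᴹ x)
    (∙-zero : ∀ x → (CommutativeRing.0# S ∙ x) M.≈ᴹ M.0ᴹ)
    (∙-*ₗ : ∀ r q x → (r ∙ (q M.*ₗ x)) M.≈ᴹ (q M.*ₗ (r ∙ x))) where

    open CommutativeRing S using (_≈_; _+_; _*_; -_; 0#; 1#; refl; -‿inverseˡ) renaming (Carrier to C)

    private
      infixr 8 _∙ₜ_
      _∙ₜ_ : C → Tensor M N → Tensor M N
      r ∙ₜ t = mapˡ (r ∙_) t

      ∙-0 : ∀ r → (r ∙ M.0ᴹ) M.≈ᴹ M.0ᴹ
      ∙-0 r = M.≈ᴹ-trans (∙-cong refl (M.≈ᴹ-sym (M.*ₗ-zeroˡ M.0ᴹ)))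
                (M.≈ᴹ-trans (∙-*ₗ r _ M.0ᴹ) (M.*ₗ-zeroˡ _))

      ∙ₜ-congˡ : ∀ r {s t} → s ≈ₜ t → r ∙ₜ s ≈ₜ r ∙ₜ t
      ∙ₜ-congˡ r reflₜ               = reflₜ
      ∙ₜ-congˡ r (symₜ eq)           = symₜ (∙ₜ-congˡ r eq)
      ∙ₜ-congˡ r (transₜ eq eq′)     = transₜ (∙ₜ-congˡ r eq) (∙ₜ-congˡ r eq′)
      ∙ₜ-congˡ r (+ₜ-cong eq eq′)    = +ₜ-cong (∙ₜ-congˡ r eq) (∙ₜ-congˡ r eq′)
      ∙ₜ-congˡ r (+ₜ-assoc s t u)    = +ₜ-assoc _ _ _
      ∙ₜ-congˡ r (+ₜ-comm s t)       = +ₜ-comm _ _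
      ∙ₜ-congˡ r (+ₜ-identity s)     = +ₜ-identity _
      ∙ₜ-congˡ r (⊗-cong eq eq′)     = ⊗-cong (∙-cong refl eq) eq′
      ∙ₜ-congˡ r (⊗-zeroˡ y)         = transₜ (⊗-congʳ (∙-0 r)) (⊗-zeroˡ y)
      ∙ₜ-congˡ r (⊗-+ˡ x x′ y)       = transₜ (⊗-congʳ (∙-+ʳ r x x′)) (⊗-+ˡ _ _ y)
      ∙ₜ-congˡ r (⊗-+ʳ x y y′)       = ⊗-+ʳ _ y y′
      ∙ₜ-congˡ r (⊗-balanced q x y)  = transₜ (⊗-congʳ (∙-*ₗ r q x)) (⊗-balanced q _ y)

      ∙ₜ-congʳ : ∀ {r s} → r ≈ s → ∀ t → r ∙ₜ t ≈ₜ s ∙ₜ t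
      ∙ₜ-congʳ eq 0ₜ       = reflₜ
      ∙ₜ-congʳ eq (x ⊗ y)  = ⊗-congʳ (∙-cong eq M.≈ᴹ-refl)
      ∙ₜ-congʳ eq (s +ₜ t) = +ₜ-cong (∙ₜ-congʳ eq s) (∙ₜ-congʳ eq t)

      ∙ₜ-zero : ∀ t → 0# ∙ₜ t ≈ₜ 0ₜ
      ∙ₜ-zero 0ₜ       = reflₜ
      ∙ₜ-zero (x ⊗ y)  = transₜ (⊗-congʳ (∙-zero x)) (⊗-zeroˡ y)
      ∙ₜ-zero (s +ₜ t) = transₜ (+ₜ-cong (∙ₜ-zero s) (∙ₜ-zero t)) (+ₜ-identity 0ₜ)

      ∙ₜ-+ : ∀ r s t → (r + s) ∙ₜ t ≈ₜ r ∙ₜ t +ₜ s ∙ₜ t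
      ∙ₜ-+ r s 0ₜ       = symₜ (+ₜ-identity 0ₜ)
      ∙ₜ-+ r s (x ⊗ y)  = transₜ (⊗-congʳ (∙-+ˡ r s x)) (⊗-+ˡ _ _ y)
      ∙ₜ-+ r s (t +ₜ u) = transₜ (+ₜ-cong (∙ₜ-+ r s t) (∙ₜ-+ r s u)) (+ₜ-interchange _ _ _ _)

      ∙ₜ-assoc : ∀ r s t → (r * s) ∙ₜ t ≈ₜ r ∙ₜ s ∙ₜ t
      ∙ₜ-assoc r s 0ₜ       = reflₜ
      ∙ₜ-assoc r s (x ⊗ y)  = ⊗-congʳ (∙-assoc r s x)
      ∙ₜ-assoc r s (t +ₜ u) = +ₜ-cong (∙ₜ-assoc r s t) (∙ₜ-assoc r s u)

      ∙ₜ-identity : ∀ t → 1# ∙ₜ t ≈ₜ t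
      ∙ₜ-identity 0ₜ       = reflₜ
      ∙ₜ-identity (x ⊗ y)  = ⊗-congʳ (∙-identity x)
      ∙ₜ-identity (s +ₜ t) = +ₜ-cong (∙ₜ-identity s) (∙ₜ-identity t)

      inverseˡ : ∀ t → (- 1#) ∙ₜ t +ₜ t ≈ₜ 0ₜ
      inverseˡ t = transₜ (+ₜ-cong reflₜ (symₜ (∙ₜ-identity t)))
        (transₜ (symₜ (∙ₜ-+ (- 1#) 1# t)) (transₜ (∙ₜ-congʳ (-‿inverseˡ 1#) t) (∙ₜ-zero t)))

    opaque
      isLeftModule : IsLeftModule (CommutativeRing.ring S) _≈ₜ_ _+ₜ_ 0ₜ ((- 1#) ∙ₜ_) _∙ₜ_
      isLeftModule = record
        { isLeftSemimodule = record
          { +ᴹ-isCommutativeMonoid = record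
            { isMonoid = record
              { isSemigroup = record
                { isMagma = record
                  { isEquivalence = record { refl = reflₜ ; sym = symₜ ; trans = transₜ }
                  ; ∙-cong = +ₜ-cong
                  }
                ; assoc = +ₜ-assoc
                }
              ; identity = +ₜ-identity , λ t → transₜ (+ₜ-comm t 0ₜ) (+ₜ-identity t)
              }
            ; comm = +ₜ-comm
            }
          ; isPreleftSemimodule = record
            { *ₗ-cong = λ {r} {s} {t} eq eq′ → transₜ (∙ₜ-congʳ eq t) (∙ₜ-congˡ s eq′)
            ; *ₗ-zeroˡ = ∙ₜ-zero
            ; *ₗ-distribʳ = λ t r s → ∙ₜ-+ r s t
            ; *ₗ-identityˡ = ∙ₜ-identity
            ; *ₗ-assoc = ∙ₜ-assoc
            ; *ₗ-zeroʳ = λ _ → reflₜ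
            ; *ₗ-distribˡ = λ _ _ _ → reflₜ
            }
          }
        ; -ᴹ‿cong = ∙ₜ-congˡ (- 1#)
        ; -ᴹ‿inverse = inverseˡ , λ t → transₜ (+ₜ-comm t _) (inverseˡ t)
        }

    tensorModule : Module S ℓ ℓ
    tensorModule = record { isModule = isModuleFromLeft isLeftModule }

module _ {R : CommutativeRing ℓ ℓ} (M N : Module R ℓ ℓ) where
  open Module M using (*ₗ-cong; *ₗ-distribʳ; *ₗ-distribˡ; *ₗ-assoc; *ₗ-identityˡ; *ₗ-zeroˡ; *ₗ-comm)
  private
    module R = CommutativeRing R
    infixr 8 _*ₜ_
    _*ₜ_ : R.Carrier → Tensor M N → Tensor M N
    r *ₜ t = mapˡ (Module._*ₗ_ M r) t

  opaque
    ⊗ᴹ-isModule : IsModule R (_≈ₜ_ {M = M} {N = N}) _+ₜ_ 0ₜ ((R.- R.1#) *ₜ_) _*ₜ_ (flip _*ₜ_)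
    ⊗ᴹ-isModule = Module.isModule (LeftAction.tensorModule {M = M} {N = N} {S = R} (Module._*ₗ_ M)
      *ₗ-cong (λ r s x → *ₗ-distribʳ x r s) *ₗ-distribˡ *ₗ-assoc *ₗ-identityˡ *ₗ-zeroˡ *ₗ-comm)

  infixr 7 _⊗ᴹ_

  _⊗ᴹ_ : Module R ℓ ℓ
  _⊗ᴹ_ = record { isModule = ⊗ᴹ-isModule }

record Bilinear {R : CommutativeRing ℓ ℓ} (M N P : Module R ℓ ℓ) : Set ℓ where
  private
    module M = Module M
    module N = Module N
    module P = Module P
  field
    op    : ∣ M ∣ → ∣ N ∣ → ∣ P ∣
    cong  : ∀ {x x′ y y′} → x M.≈ᴹ x′ → y N.≈ᴹ y′ → op x y P.≈ᴹ op x′ y′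
    +-homoˡ : ∀ x x′ y → op (x M.+ᴹ x′) y P.≈ᴹ (op x y P.+ᴹ op x′ y)
    +-homoʳ : ∀ x y y′ → op x (y N.+ᴹ y′) P.≈ᴹ (op x y P.+ᴹ op x y′)
    *-homoˡ : ∀ r x y → op (r M.*ₗ x) y P.≈ᴹ (r P.*ₗ op x y)
    *-homoʳ : ∀ r x y → op x (r N.*ₗ y) P.≈ᴹ (r P.*ₗ op x y)

module _ {R : CommutativeRing ℓ ℓ} {M N P : Module R ℓ ℓ} (b : Bilinear M N P) where
  private
    module M = Module M
    module N = Module N
    module P = Module P
    module b = Bilinear b

    liftₜ : Tensor M N → ∣ P ∣
    liftₜ 0ₜ       = P.0ᴹ
    liftₜ (x ⊗ y)  = b.op x y
    liftₜ (s +ₜ t) = liftₜ s P.+ᴹ liftₜ t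

    lift-cong : ∀ {s t} → s ≈ₜ t → liftₜ s P.≈ᴹ liftₜ t
    lift-cong reflₜ              = P.≈ᴹ-refl
    lift-cong (symₜ eq)          = P.≈ᴹ-sym (lift-cong eq)
    lift-cong (transₜ eq eq′)    = P.≈ᴹ-trans (lift-cong eq) (lift-cong eq′)
    lift-cong (+ₜ-cong eq eq′)   = P.+ᴹ-cong (lift-cong eq) (lift-cong eq′)
    lift-cong (+ₜ-assoc s t u)   = P.+ᴹ-assoc _ _ _
    lift-cong (+ₜ-comm s t)      = P.+ᴹ-comm _ _
    lift-cong (+ₜ-identity s)    = P.+ᴹ-identityˡ _
    lift-cong (⊗-cong eq eq′)    = b.cong eq eq′
    lift-cong (⊗-zeroˡ y)        = P.≈ᴹ-trans (b.cong (M.≈ᴹ-sym (M.*ₗ-zeroˡ M.0ᴹ)) N.≈ᴹ-refl)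
                                     (P.≈ᴹ-trans (b.*-homoˡ _ _ y) (P.*ₗ-zeroˡ _))
    lift-cong (⊗-+ˡ x x′ y)      = b.+-homoˡ x x′ y
    lift-cong (⊗-+ʳ x y y′)      = b.+-homoʳ x y y′
    lift-cong (⊗-balanced r x y) = P.≈ᴹ-trans (b.*-homoˡ r x y) (P.≈ᴹ-sym (b.*-homoʳ r x y))

    lift-* : ∀ r t → liftₜ (Module._*ₗ_ (M ⊗ᴹ N) r t) P.≈ᴹ (r P.*ₗ liftₜ t)
    lift-* r 0ₜ       = P.≈ᴹ-sym (P.*ₗ-zeroʳ r)
    lift-* r (x ⊗ y)  = b.*-homoˡ r x y
    lift-* r (s +ₜ t) = P.≈ᴹ-trans (P.+ᴹ-cong (lift-* r s) (lift-* r t)) (P.≈ᴹ-sym (P.*ₗ-distribˡ r _ _))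

  lift : M ⊗ᴹ N →ₗ P
  lift = mkLinear {M = M ⊗ᴹ N} {N = P} liftₜ lift-cong (λ _ _ → P.≈ᴹ-refl) lift-*

module _ {R : CommutativeRing ℓ ℓ} {M N : Module R ℓ ℓ} where
  swap : M ⊗ᴹ N →ₗ N ⊗ᴹ M
  swap = lift record
    { op = λ x y → y ⊗ x ; cong = λ eq eq′ → ⊗-cong eq′ eq
    ; +-homoˡ = λ x x′ y → ⊗-+ʳ y x x′ ; +-homoʳ = λ x y y′ → ⊗-+ˡ y y′ x
    ; *-homoˡ = λ r x y → symₜ (⊗-balanced r y x) ; *-homoʳ = λ _ _ _ → reflₜ }

  _⊗- : ∣ M ∣ → N →ₗ M ⊗ᴹ N
  x ⊗- = mkLinear {M = N} {N = M ⊗ᴹ N} (x ⊗_) ⊗-congˡ (⊗-+ʳ x) (λ r y → symₜ (⊗-balanced r x y))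

  -⊗_ : ∣ N ∣ → M →ₗ M ⊗ᴹ N
  -⊗ y = mkLinear {M = M} {N = M ⊗ᴹ N} (_⊗ y) ⊗-congʳ (λ x x′ → ⊗-+ˡ x x′ y) (λ _ _ → reflₜ)

module _ {R : CommutativeRing ℓ ℓ} {M N M′ N′ : Module R ℓ ℓ} where

  infixr 7 _⊗₁_

  _⊗₁_ : M →ₗ M′ → N →ₗ N′ → M ⊗ᴹ N →ₗ M′ ⊗ᴹ N′
  f ⊗₁ g = lift record
    { op = λ x y → ⟦ f ⟧ x ⊗ ⟦ g ⟧ y
    ; cong = λ eq eq′ → ⊗-cong (f.⟦⟧-cong eq) (g.⟦⟧-cong eq′)
    ; +-homoˡ = λ x x′ y → transₜ (⊗-congʳ (f.+ᴹ-homo x x′)) (⊗-+ˡ _ _ _)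
    ; +-homoʳ = λ x y y′ → transₜ (⊗-congˡ (g.+ᴹ-homo y y′)) (⊗-+ʳ _ _ _)
    ; *-homoˡ = λ r x y → ⊗-congʳ (f.*ₗ-homo r x)
    ; *-homoʳ = λ r x y → transₜ (⊗-congˡ (g.*ₗ-homo r y)) (symₜ (⊗-balanced r _ _)) }
    where
    module f = _→ₗ_ f
    module g = _→ₗ_ g

module _ {R : CommutativeRing ℓ ℓ} {M N P : Module R ℓ ℓ} where

  private
    module Assoc where
      to : ∣ P ∣ → M ⊗ᴹ N →ₗ M ⊗ᴹ (N ⊗ᴹ P)
      to z = idₗ {M = M} ⊗₁ (-⊗_ {M = N} {N = P} z)

      cong : ∀ s {z z′} → Module._≈ᴹ_ P z z′ → ⟦ to z ⟧ s ≈ₜ ⟦ to z′ ⟧ s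
      cong 0ₜ       eq = reflₜ
      cong (x ⊗ y)  eq = ⊗-congˡ (⊗-congˡ eq)
      cong (s +ₜ t) eq = +ₜ-cong (cong s eq) (cong t eq)

      +-homo : ∀ s z z′ → ⟦ to (Module._+ᴹ_ P z z′) ⟧ s ≈ₜ ⟦ to z ⟧ s +ₜ ⟦ to z′ ⟧ s
      +-homo 0ₜ       z z′ = symₜ (+ₜ-identity 0ₜ)
      +-homo (x ⊗ y)  z z′ = transₜ (⊗-congˡ (⊗-+ʳ y z z′)) (⊗-+ʳ x _ _)
      +-homo (s +ₜ t) z z′ = transₜ (+ₜ-cong (+-homo s z z′) (+-homo t z z′)) (+ₜ-interchange _ _ _ _)

      *-homo : ∀ r s z → ⟦ to (Module._*ₗ_ P r z) ⟧ s ≈ₜ Module._*ₗ_ (M ⊗ᴹ (N ⊗ᴹ P)) r (⟦ to z ⟧ s)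
      *-homo r 0ₜ       z = reflₜ
      *-homo r (x ⊗ y)  z = transₜ (⊗-congˡ (symₜ (⊗-balanced r y z))) (symₜ (⊗-balanced r x _))
      *-homo r (s +ₜ t) z = +ₜ-cong (*-homo r s z) (*-homo r t z)

    module Assoc⁻¹ where
      to : ∣ M ∣ → N ⊗ᴹ P →ₗ (M ⊗ᴹ N) ⊗ᴹ P
      to x = _⊗-  {M = M} {N = N} x ⊗₁ idₗ {M = P}

      cong : ∀ t {x x′} → Module._≈ᴹ_ M x x′ → ⟦ to x ⟧ t ≈ₜ ⟦ to x′ ⟧ t
      cong 0ₜ       eq = reflₜ
      cong (y ⊗ z)  eq = ⊗-congʳ (⊗-congʳ eq)
      cong (s +ₜ t) eq = +ₜ-cong (cong s eq) (cong t eq)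

      +-homo : ∀ t x x′ → ⟦ to (Module._+ᴹ_ M x x′) ⟧ t ≈ₜ ⟦ to x ⟧ t +ₜ ⟦ to x′ ⟧ t
      +-homo 0ₜ       x x′ = symₜ (+ₜ-identity 0ₜ)
      +-homo (y ⊗ z)  x x′ = transₜ (⊗-congʳ (⊗-+ˡ x x′ y)) (⊗-+ˡ _ _ z)
      +-homo (s +ₜ t) x x′ = transₜ (+ₜ-cong (+-homo s x x′) (+-homo t x x′)) (+ₜ-interchange _ _ _ _)

      *-homo : ∀ r t x → ⟦ to (Module._*ₗ_ M r x) ⟧ t ≈ₜ Module._*ₗ_ ((M ⊗ᴹ N) ⊗ᴹ P) r (⟦ to x ⟧ t)
      *-homo r 0ₜ       x = reflₜ
      *-homo r (y ⊗ z)  x = reflₜ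
      *-homo r (s +ₜ t) x = +ₜ-cong (*-homo r s x) (*-homo r t x)

  assoc : (M ⊗ᴹ N) ⊗ᴹ P →ₗ M ⊗ᴹ (N ⊗ᴹ P)
  assoc = lift {M = M ⊗ᴹ N} {N = P} {P = M ⊗ᴹ (N ⊗ᴹ P)} record
    { op = λ s z → ⟦ Assoc.to z ⟧ s
    ; cong = λ {s} {s′} {z} {z′} eq eq′ → transₜ (_→ₗ_.⟦⟧-cong (Assoc.to z) eq) (Assoc.cong s′ eq′)
    ; +-homoˡ = λ _ _ _ → reflₜ
    ; +-homoʳ = Assoc.+-homo
    ; *-homoˡ = λ r s z → _→ₗ_.*ₗ-homo (Assoc.to z) r s
    ; *-homoʳ = Assoc.*-homo }

  assoc⁻¹ : M ⊗ᴹ (N ⊗ᴹ P) →ₗ (M ⊗ᴹ N) ⊗ᴹ P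
  assoc⁻¹ = lift {M = M} {N = N ⊗ᴹ P} {P = (M ⊗ᴹ N) ⊗ᴹ P} record
    { op = λ x t → ⟦ Assoc⁻¹.to x ⟧ t
    ; cong = λ {x} {x′} {t} {t′} eq eq′ → transₜ (_→ₗ_.⟦⟧-cong (Assoc⁻¹.to x) eq′) (Assoc⁻¹.cong t′ eq)
    ; +-homoˡ = λ x x′ t → Assoc⁻¹.+-homo t x x′
    ; +-homoʳ = λ _ _ _ → reflₜ
    ; *-homoˡ = λ r x t → Assoc⁻¹.*-homo r t x
    ; *-homoʳ = λ r x t → _→ₗ_.*ₗ-homo (Assoc⁻¹.to x) r t }

module _ {R : CommutativeRing ℓ ℓ} {M : Module R ℓ ℓ} where
  open Module M

  unitorˡ : 𝟙 ⊗ᴹ M →ₗ M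
  unitorˡ = lift {M = 𝟙} {N = M} {P = M} record
    { op = _*ₗ_ ; cong = *ₗ-cong
    ; +-homoˡ = λ r s x → *ₗ-distribʳ x r s ; +-homoʳ = *ₗ-distribˡ
    ; *-homoˡ = *ₗ-assoc ; *-homoʳ = λ r s x → *ₗ-comm s r x }

  unitorʳ : M ⊗ᴹ 𝟙 →ₗ M
  unitorʳ = unitorˡ ∘ₗ swap {M = M} {N = 𝟙}

module _ {R : CommutativeRing ℓ ℓ} {M N P Q : Module R ℓ ℓ} where
  private
    inner : N ⊗ᴹ (P ⊗ᴹ Q) →ₗ P ⊗ᴹ (N ⊗ᴹ Q)
    inner = assoc {M = P} {N = N} {P = Q}
      ∘ₗ (swap {M = N} {N = P} ⊗₁ idₗ {M = Q})
      ∘ₗ assoc⁻¹ {M = N} {N = P} {P = Q}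

  -- (w ⊗ x) ⊗ (y ⊗ z) ↦ (w ⊗ y) ⊗ (x ⊗ z)
  interchange : (M ⊗ᴹ N) ⊗ᴹ (P ⊗ᴹ Q) →ₗ (M ⊗ᴹ P) ⊗ᴹ (N ⊗ᴹ Q)
  interchange = assoc⁻¹ {M = M} {N = P} {P = N ⊗ᴹ Q}
    ∘ₗ (idₗ {M = M} ⊗₁ inner)
    ∘ₗ assoc {M = M} {N = N} {P = P ⊗ᴹ Q}

-- As with the raw bundles of the standard library, these records carry the data
-- needed to speak about homomorphisms but not the laws.

record RawAlgebra (R : CommutativeRing ℓ ℓ) : Set (Level.suc ℓ) where
  field
    ⟨_⟩ : Module R ℓ ℓ
    mul : ⟨_⟩ ⊗ᴹ ⟨_⟩ →ₗ ⟨_⟩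
    one : ∣ ⟨_⟩ ∣

record RawCoalgebra (R : CommutativeRing ℓ ℓ) : Set (Level.suc ℓ) where
  field
    ⟨_⟩ : Module R ℓ ℓ
    Δ   : ⟨_⟩ →ₗ ⟨_⟩ ⊗ᴹ ⟨_⟩
    ε   : ⟨_⟩ →ₗ 𝟙

module _ {R : CommutativeRing ℓ ℓ} where
  open RawAlgebra using () renaming (⟨_⟩ to ⟨_⟩ᴬ)
  open RawCoalgebra using () renaming (⟨_⟩ to ⟨_⟩ᶜ)

  record IsAlgebraHomomorphism (A B : RawAlgebra R) (f : ⟨ A ⟩ᴬ →ₗ ⟨ B ⟩ᴬ) : Set ℓ where
    private
      module A = RawAlgebra A
      module B = RawAlgebra B
    open Module B.⟨_⟩ using (_≈ᴹ_)
    field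
      mul-homo : ∀ x y → ⟦ f ⟧ (⟦ A.mul ⟧ (x ⊗ y)) ≈ᴹ ⟦ B.mul ⟧ (⟦ f ⟧ x ⊗ ⟦ f ⟧ y)
      one-homo : ⟦ f ⟧ A.one ≈ᴹ B.one

  record IsCoalgebraHomomorphism (C D : RawCoalgebra R) (f : ⟨ C ⟩ᶜ →ₗ ⟨ D ⟩ᶜ) : Set ℓ where
    private
      module C = RawCoalgebra C
      module D = RawCoalgebra D
    field
      Δ-homo : ∀ x → ⟦ D.Δ ⟧ (⟦ f ⟧ x) ≈ₜ ⟦ f ⊗₁ f ⟧ (⟦ C.Δ ⟧ x)
      ε-homo : ∀ x → CommutativeRing._≈_ R (⟦ D.ε ⟧ (⟦ f ⟧ x)) (⟦ C.ε ⟧ x)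

  record IsCoalgebra (C : RawCoalgebra R) : Set ℓ where
    open RawCoalgebra C
    open Module ⟨_⟩ using (_≈ᴹ_)
    field
      coassoc   : ∀ x → ⟦ assoc {M = ⟨_⟩} {N = ⟨_⟩} {P = ⟨_⟩} ⟧ (⟦ Δ ⊗₁ idₗ {M = ⟨_⟩} ⟧ (⟦ Δ ⟧ x))
                        ≈ₜ ⟦ idₗ {M = ⟨_⟩} ⊗₁ Δ ⟧ (⟦ Δ ⟧ x)
      counitˡ   : ∀ x → ⟦ unitorˡ {M = ⟨_⟩} ⟧ (⟦ ε ⊗₁ idₗ {M = ⟨_⟩} ⟧ (⟦ Δ ⟧ x)) ≈ᴹ x
      counitʳ   : ∀ x → ⟦ unitorʳ {M = ⟨_⟩} ⟧ (⟦ idₗ {M = ⟨_⟩} ⊗₁ ε ⟧ (⟦ Δ ⟧ x)) ≈ᴹ x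

  Cocommutative : RawCoalgebra R → Set ℓ
  Cocommutative C = ∀ x → ⟦ swap {M = ⟨_⟩} {N = ⟨_⟩} ⟧ (⟦ Δ ⟧ x) ≈ₜ ⟦ Δ ⟧ x
    where open RawCoalgebra C

  scalarAlgebra : RawAlgebra R
  scalarAlgebra = record { ⟨_⟩ = 𝟙 ; mul = unitorˡ {M = 𝟙} ; one = CommutativeRing.1# R }

  infixr 7 _⊗ᴬ_

  -- (a ⊗ b)(a′ ⊗ b′) = aa′ ⊗ bb′
  _⊗ᴬ_ : RawAlgebra R → RawAlgebra R → RawAlgebra R
  A ⊗ᴬ B = record
    { ⟨_⟩ = A.⟨_⟩ ⊗ᴹ B.⟨_⟩
    ; mul = (A.mul ⊗₁ B.mul) ∘ₗ interchange {M = A.⟨_⟩} {N = B.⟨_⟩} {P = A.⟨_⟩} {Q = B.⟨_⟩}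
    ; one = A.one ⊗ B.one
    }
    where
    module A = RawAlgebra A
    module B = RawAlgebra B

record CommutativeAlgebra (R : CommutativeRing ℓ ℓ) : Set (Level.suc ℓ) where
  private module R = CommutativeRing R
  field
    commutativeRing : CommutativeRing ℓ ℓ

  open CommutativeRing commutativeRing public

  field
    unit               : R.Carrier → Carrier
    isRingHomomorphism : IsRingHomomorphism R.rawRing rawRing unit

  open IsRingHomomorphism isRingHomomorphism public
    using (⟦⟧-cong; +-homo; *-homo; 0#-homo; 1#-homo)

  opaque
    isLeftModule : IsLeftModule R.ring _≈_ _+_ 0# -_ (λ r x → unit r * x)
    isLeftModule = record
      { isLeftSemimodule = record
        { +ᴹ-isCommutativeMonoid = +-isCommutativeMonoid
        ; isPreleftSemimodule = record
          { *ₗ-cong = λ eq eq′ → *-cong (⟦⟧-cong eq) eq′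
          ; *ₗ-zeroˡ = λ x → trans (*-congʳ 0#-homo) (zeroˡ x)
          ; *ₗ-distribʳ = λ x r s → trans (*-congʳ (+-homo r s)) (distribʳ x _ _)
          ; *ₗ-identityˡ = λ x → trans (*-congʳ 1#-homo) (*-identityˡ x)
          ; *ₗ-assoc = λ r s x → trans (*-congʳ (*-homo r s)) (*-assoc _ _ x)
          ; *ₗ-zeroʳ = λ r → zeroʳ _
          ; *ₗ-distribˡ = λ r x y → distribˡ _ x y
          }
        }
      ; -ᴹ‿cong = -‿cong
      ; -ᴹ‿inverse = -‿inverse
      }

    isModule : IsModule R _≈_ _+_ 0# -_ (λ r x → unit r * x) (λ x r → unit r * x)
    isModule = isModuleFromLeft isLeftModule

  ⟨_⟩ : Module R ℓ ℓ
  ⟨_⟩ = record { isModule = isModule }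

  opaque
    *-comm-scalar : ∀ r x y → x * (r * y) ≈ r * (x * y)
    *-comm-scalar r x y = trans (sym (*-assoc x r y)) (trans (*-congʳ (*-comm x r)) (*-assoc r x y))

  mul : ⟨_⟩ ⊗ᴹ ⟨_⟩ →ₗ ⟨_⟩
  mul = lift {M = ⟨_⟩} {N = ⟨_⟩} {P = ⟨_⟩} record
    { op = _*_ ; cong = *-cong
    ; +-homoˡ = λ x x′ y → distribʳ y x x′ ; +-homoʳ = distribˡ
    ; *-homoˡ = λ r x y → *-assoc (unit r) x y ; *-homoʳ = λ r x y → *-comm-scalar (unit r) x y }

  unitₗ : 𝟙 →ₗ ⟨_⟩
  unitₗ = mkLinear {M = 𝟙} {N = ⟨_⟩} unit ⟦⟧-cong +-homo *-homo

  rawAlgebra : RawAlgebra R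
  rawAlgebra = record { ⟨_⟩ = ⟨_⟩ ; mul = mul ; one = 1# }

module _ {R : CommutativeRing ℓ ℓ} (A : CommutativeAlgebra R) where
  private
    module R = CommutativeRing R
    module A = CommutativeAlgebra A

    Modᴬ : Set (Level.suc ℓ)
    Modᴬ = Module A.commutativeRing ℓ ℓ

  module _ (G : Modᴬ) where
    private
      module G = Module G

      opaque
        isLeftModule : IsLeftModule R.ring G._≈ᴹ_ G._+ᴹ_ G.0ᴹ G.-ᴹ_ (λ r x → A.unit r G.*ₗ x)
        isLeftModule = record
          { isLeftSemimodule = record
            { +ᴹ-isCommutativeMonoid = G.+ᴹ-isCommutativeMonoid
            ; isPreleftSemimodule = record
              { *ₗ-cong = λ eq eq′ → G.*ₗ-cong (A.⟦⟧-cong eq) eq′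
              ; *ₗ-zeroˡ = λ x → G.≈ᴹ-trans (G.*ₗ-congʳ A.0#-homo) (G.*ₗ-zeroˡ x)
              ; *ₗ-distribʳ = λ x r s → G.≈ᴹ-trans (G.*ₗ-congʳ (A.+-homo r s)) (G.*ₗ-distribʳ x _ _)
              ; *ₗ-identityˡ = λ x → G.≈ᴹ-trans (G.*ₗ-congʳ A.1#-homo) (G.*ₗ-identityˡ x)
              ; *ₗ-assoc = λ r s x → G.≈ᴹ-trans (G.*ₗ-congʳ (A.*-homo r s)) (G.*ₗ-assoc _ _ x)
              ; *ₗ-zeroʳ = λ r → G.*ₗ-zeroʳ _
              ; *ₗ-distribˡ = λ r x y → G.*ₗ-distribˡ _ x y
              }
            }
          ; -ᴹ‿cong = G.-ᴹ‿cong
          ; -ᴹ‿inverse = G.-ᴹ‿inverse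
          }

        isModule : IsModule R G._≈ᴹ_ G._+ᴹ_ G.0ᴹ G.-ᴹ_ (λ r x → A.unit r G.*ₗ x) (λ x r → A.unit r G.*ₗ x)
        isModule = isModuleFromLeft isLeftModule

    restrict : Module R ℓ ℓ
    restrict = record { isModule = isModule }

  module _ (C : Module R ℓ ℓ) where
    private
      infixr 8 _*ₜ_
      _*ₜ_ : A.Carrier → Tensor A.⟨_⟩ C → Tensor A.⟨_⟩ C
      a *ₜ t = mapˡ (a A.*_) t

    opaque
      extend-isModule : IsModule A.commutativeRing (_≈ₜ_ {M = A.⟨_⟩} {N = C})
        _+ₜ_ 0ₜ ((A.- A.1#) *ₜ_) _*ₜ_ (flip _*ₜ_)
      extend-isModule = Module.isModule (LeftAction.tensorModule {M = A.⟨_⟩} {N = C} {S = A.commutativeRing}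
        A._*_ A.*-cong (λ r s x → A.distribʳ x r s) A.distribˡ A.*-assoc A.*-identityˡ A.zeroˡ
        (λ a r x → A.*-comm-scalar (A.unit r) a x))

    -- The R-module A ⊗ C with the action a (b ⊗ c) = ab ⊗ c of A
    extend : Modᴬ
    extend = record { isModule = extend-isModule }

  -- A ⊗ C, first as an R-module and then as an A-module, has the same additive group.
  ⊗⇒extend : (C : Module R ℓ ℓ) → A.⟨_⟩ ⊗ᴹ C →ₗ restrict (extend C)
  ⊗⇒extend C = mkLinear {M = A.⟨_⟩ ⊗ᴹ C} {N = restrict (extend C)}
    (λ t → t) (λ eq → eq) (λ _ _ → reflₜ) (λ _ _ → reflₜ)

  module _ {C D : Module R ℓ ℓ} where

    extend₁ : C →ₗ D → extend C →ₗ extend D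
    extend₁ f = mkLinear {M = extend C} {N = extend D} ⟦ id⊗f ⟧ id⊗f.⟦⟧-cong id⊗f.+ᴹ-homo homo
      where
      id⊗f : A.⟨_⟩ ⊗ᴹ C →ₗ A.⟨_⟩ ⊗ᴹ D
      id⊗f = idₗ {M = A.⟨_⟩} ⊗₁ f
      module id⊗f = _→ₗ_ id⊗f
      homo : ∀ a t → ⟦ id⊗f ⟧ (Module._*ₗ_ (extend C) a t) ≈ₜ Module._*ₗ_ (extend D) a (⟦ id⊗f ⟧ t)
      homo a 0ₜ       = reflₜ
      homo a (b ⊗ c)  = reflₜ
      homo a (s +ₜ t) = +ₜ-cong (homo a s) (homo a t)

  module _ {C : Module R ℓ ℓ} {G : Modᴬ} where
    private
      module C = Module C
      module G = Module G

    infix 10 _♯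

    -- f♯ (a ⊗ c) = a f(c)
    _♯ : C →ₗ restrict G → extend C →ₗ G
    f ♯ = mkLinear {M = extend C} {N = G} ⟦ f♯ ⟧ f♯.⟦⟧-cong f♯.+ᴹ-homo homo
      where
      module f = _→ₗ_ f
      f♯ : A.⟨_⟩ ⊗ᴹ C →ₗ restrict G
      f♯ = lift {M = A.⟨_⟩} {N = C} {P = restrict G} record
        { op = λ a c → a G.*ₗ ⟦ f ⟧ c
        ; cong = λ eq eq′ → G.*ₗ-cong eq (f.⟦⟧-cong eq′)
        ; +-homoˡ = λ a b c → G.*ₗ-distribʳ (⟦ f ⟧ c) a b
        ; +-homoʳ = λ a c d → G.≈ᴹ-trans (G.*ₗ-congˡ (f.+ᴹ-homo c d)) (G.*ₗ-distribˡ a _ _)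
        ; *-homoˡ = λ r a c → G.*ₗ-assoc (A.unit r) a (⟦ f ⟧ c)
        ; *-homoʳ = λ r a c → G.≈ᴹ-trans (G.*ₗ-congˡ (f.*ₗ-homo r c)) (G.*ₗ-comm a (A.unit r) _) }
      module f♯ = _→ₗ_ f♯
      homo : ∀ a t → ⟦ f♯ ⟧ (Module._*ₗ_ (extend C) a t) G.≈ᴹ (a G.*ₗ ⟦ f♯ ⟧ t)
      homo a 0ₜ       = G.≈ᴹ-sym (G.*ₗ-zeroʳ a)
      homo a (b ⊗ c)  = G.*ₗ-assoc a b (⟦ f ⟧ c)
      homo a (s +ₜ t) = G.≈ᴹ-trans (G.+ᴹ-cong (homo a s) (homo a t)) (G.≈ᴹ-sym (G.*ₗ-distribˡ a _ _))

  module _ (C D : Module R ℓ ℓ) where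
    private
      P : Modᴬ
      P = extend C ⊗ᴹ extend D

      _·ᶜ_ : A.Carrier → Tensor A.⟨_⟩ C → Tensor A.⟨_⟩ C
      _·ᶜ_ = Module._*ₗ_ (extend C)
      _·ᵈ_ : A.Carrier → Tensor A.⟨_⟩ D → Tensor A.⟨_⟩ D
      _·ᵈ_ = Module._*ₗ_ (extend D)

      inc : ∀ {N : Module R ℓ ℓ} → ∣ N ∣ → Tensor A.⟨_⟩ N
      inc x = A.1# ⊗ x

      inc-* : ∀ {N : Module R ℓ ℓ} r (x : ∣ N ∣) →
        inc {N} (Module._*ₗ_ N r x) ≈ₜ Module._*ₗ_ (extend N) (A.unit r) (inc x)
      inc-* r x = symₜ (⊗-balanced r A.1# x)

      1⊗1⊗ : C ⊗ᴹ D →ₗ restrict P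
      1⊗1⊗ = lift {M = C} {N = D} {P = restrict P} record
        { op = λ c d → inc c ⊗ inc d
        ; cong = λ eq eq′ → ⊗-cong (⊗-congˡ eq) (⊗-congˡ eq′)
        ; +-homoˡ = λ c c′ d → transₜ (⊗-congʳ (⊗-+ʳ A.1# c c′)) (⊗-+ˡ (inc c) (inc c′) (inc d))
        ; +-homoʳ = λ c d d′ → transₜ (⊗-congˡ (⊗-+ʳ A.1# d d′)) (⊗-+ʳ (inc c) (inc d) (inc d′))
        ; *-homoˡ = λ r c d → ⊗-congʳ (inc-* r c)
        ; *-homoʳ = λ r c d → transₜ (⊗-congˡ (inc-* r d)) (symₜ (⊗-balanced (A.unit r) (inc c) (inc d))) }

    -- the canonical isomorphism A ⊗ (C ⊗ D) ≅ (A ⊗ C) ⊗_A (A ⊗ D), which sends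
    -- a ⊗ (c ⊗ d) to a ((1 ⊗ c) ⊗ (1 ⊗ d))
    extend-⊗ : extend (C ⊗ᴹ D) →ₗ extend C ⊗ᴹ extend D
    extend-⊗ = _♯ {C = C ⊗ᴹ D} {G = P} 1⊗1⊗

  -- A ⊗ R ≅ A
  extend-𝟙 : extend 𝟙 →ₗ 𝟙
  extend-𝟙 = _♯ {C = 𝟙} {G = 𝟙} (mkLinear {M = 𝟙} {N = restrict 𝟙} A.unit A.⟦⟧-cong A.+-homo A.*-homo)

  extendCoalgebra : RawCoalgebra R → RawCoalgebra A.commutativeRing
  extendCoalgebra C = record
    { ⟨_⟩ = extend C.⟨_⟩
    ; Δ   = extend-⊗ C.⟨_⟩ C.⟨_⟩ ∘ₗ extend₁ {C = C.⟨_⟩} {D = C.⟨_⟩ ⊗ᴹ C.⟨_⟩} C.Δ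
    ; ε   = extend-𝟙 ∘ₗ extend₁ {C = C.⟨_⟩} {D = 𝟙} C.ε
    }
    where module C = RawCoalgebra C

  -- (R, A)-coalgebra homomorphisms C → G
  IsRelativeCoalgebraHomomorphism : (C : RawCoalgebra R) (G : RawCoalgebra A.commutativeRing) →
    RawCoalgebra.⟨_⟩ C →ₗ restrict (RawCoalgebra.⟨_⟩ G) → Set ℓ
  IsRelativeCoalgebraHomomorphism C G f =
    IsCoalgebraHomomorphism (extendCoalgebra C) G (_♯ {C = RawCoalgebra.⟨_⟩ C} {G = RawCoalgebra.⟨_⟩ G} f)

record Submodule {R : CommutativeRing ℓ ℓ} (M : Module R ℓ ℓ) : Set (Level.suc ℓ) where
  open Module M
  field
    Contains : ∣ M ∣ → Set ℓ
    resp     : ∀ {x y} → x ≈ᴹ y → Contains x → Contains y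
    +-closed : ∀ {x y} → Contains x → Contains y → Contains (x +ᴹ y)
    0-closed : Contains 0ᴹ
    *-closed : ∀ r {x} → Contains x → Contains (r *ₗ x)

infix 4 _∈_

_∈_ : {R : CommutativeRing ℓ ℓ} {M : Module R ℓ ℓ} → ∣ M ∣ → Submodule M → Set ℓ
x ∈ S = Submodule.Contains S x

module _ {R : CommutativeRing ℓ ℓ} {M : Module R ℓ ℓ} (S : Submodule M) where
  private
    module M = Module M
    module S = Submodule S
    module R = CommutativeRing R

    C : Set _
    C = Σ ∣ M ∣ S.Contains

    infix  4 _≈ₛ_
    infixl 6 _+ₛ_
    infixr 7 _*ₛ_

    _≈ₛ_ : C → C → Set _
    x ≈ₛ y = proj₁ x M.≈ᴹ proj₁ y

    _+ₛ_ : C → C → C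
    x +ₛ y = proj₁ x M.+ᴹ proj₁ y , S.+-closed (proj₂ x) (proj₂ y)

    0ₛ : C
    0ₛ = M.0ᴹ , S.0-closed

    _*ₛ_ : R.Carrier → C → C
    r *ₛ x = r M.*ₗ proj₁ x , S.*-closed r (proj₂ x)

    opaque
      isLeftModule : IsLeftModule R.ring _≈ₛ_ _+ₛ_ 0ₛ ((R.- R.1#) *ₛ_) _*ₛ_
      isLeftModule = record
        { isLeftSemimodule = record
          { +ᴹ-isCommutativeMonoid = record
            { isMonoid = record
              { isSemigroup = record
                { isMagma = record
                  { isEquivalence = record { refl = M.≈ᴹ-refl ; sym = M.≈ᴹ-sym ; trans = M.≈ᴹ-trans }
                  ; ∙-cong = M.+ᴹ-cong
                  }
                ; assoc = λ _ _ _ → M.+ᴹ-assoc _ _ _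
                }
              ; identity = (λ _ → M.+ᴹ-identityˡ _) , (λ _ → M.+ᴹ-identityʳ _)
              }
            ; comm = λ _ _ → M.+ᴹ-comm _ _
            }
          ; isPreleftSemimodule = record
            { *ₗ-cong = M.*ₗ-cong
            ; *ₗ-zeroˡ = λ _ → M.*ₗ-zeroˡ _
            ; *ₗ-distribʳ = λ _ _ _ → M.*ₗ-distribʳ _ _ _
            ; *ₗ-identityˡ = λ _ → M.*ₗ-identityˡ _
            ; *ₗ-assoc = λ _ _ _ → M.*ₗ-assoc _ _ _
            ; *ₗ-zeroʳ = λ _ → M.*ₗ-zeroʳ _
            ; *ₗ-distribˡ = λ _ _ _ → M.*ₗ-distribˡ _ _ _
            }
          }
        ; -ᴹ‿cong = M.*ₗ-congˡ
        ; -ᴹ‿inverse =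
            (λ x → M.≈ᴹ-trans (M.+ᴹ-congʳ (*ₗ-negate M (proj₁ x))) (M.-ᴹ‿inverseˡ (proj₁ x))) ,
            (λ x → M.≈ᴹ-trans (M.+ᴹ-congˡ (*ₗ-negate M (proj₁ x))) (M.-ᴹ‿inverseʳ (proj₁ x)))
        }

      isModule : IsModule R _≈ₛ_ _+ₛ_ 0ₛ ((R.- R.1#) *ₛ_) _*ₛ_ (flip _*ₛ_)
      isModule = isModuleFromLeft isLeftModule

  submodule : Module R _ _
  submodule = record { isModule = isModule }

  inclusion : submodule →ₗ M
  inclusion = mkLinear {M = submodule} {N = M} proj₁ (λ eq → eq) (λ _ _ → M.≈ᴹ-refl) (λ _ _ → M.≈ᴹ-refl)

module _ {R : CommutativeRing ℓ ℓ} {M N : Module R ℓ ℓ} where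

  -- M ⊗ S as a subset of M ⊗ N, that is, the image of the map id ⊗ inclusion
  _∈id⊗_ : ∣ M ⊗ᴹ N ∣ → Submodule N → Set ℓ
  t ∈id⊗ S = ∃ λ (s : Tensor M (submodule S)) → ⟦ idₗ {M = M} ⊗₁ inclusion S ⟧ s ≈ₜ t

-- M is the direct sum of its submodules piece 0, piece 1, …: every x is a finite sum of
-- elements part n x ∈ piece n, and these elements are unique.
record Grading {R : CommutativeRing ℓ ℓ} (M : Module R ℓ ℓ) : Set (Level.suc ℓ) where
  open Module M
  open Sums M
  field
    piece : ℕ → Submodule M

    part          : ℕ → ∣ M ∣ → ∣ M ∣
    bound         : ∣ M ∣ → ℕ
    part-∈        : ∀ n x → part n x ∈ piece n
    part-vanishes : ∀ x → Vanishes≥ (bound x) (λ n → part n x)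
    part-sum      : ∀ x → ∑< M (bound x) (λ n → part n x) ≈ᴹ x

    unique : ∀ N {f g : ℕ → ∣ M ∣} → (∀ n → f n ∈ piece n) → (∀ n → g n ∈ piece n) →
             ∑< M N f ≈ᴹ ∑< M N g → ∀ n → n < N → f n ≈ᴹ g n

  private
    module piece n = Submodule (piece n)

  opaque
    parts-unique : ∀ {N N′} {f g : ℕ → ∣ M ∣} → (∀ n → f n ∈ piece n) → (∀ n → g n ∈ piece n) →
      Vanishes≥ N f → Vanishes≥ N′ g → ∑< M N f ≈ᴹ ∑< M N′ g → ∀ n → f n ≈ᴹ g n
    parts-unique {N} {N′} {f} {g} f∈ g∈ f≈0 g≈0 eq n =
      unique K f∈ g∈ (≈ᴹ-trans (∑<-stable f≈0 N≤K) (≈ᴹ-trans eq (≈ᴹ-sym (∑<-stable g≈0 N′≤K)))) n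
        (ℕ.m≤n⊔m (N ⊔ N′) (ℕ.suc n))
      where
      K : ℕ
      K = (N ⊔ N′) ⊔ ℕ.suc n
      N≤K : N ≤ K
      N≤K = ℕ.≤-trans (ℕ.m≤m⊔n N N′) (ℕ.m≤m⊔n (N ⊔ N′) (ℕ.suc n))
      N′≤K : N′ ≤ K
      N′≤K = ℕ.≤-trans (ℕ.m≤n⊔m N N′) (ℕ.m≤m⊔n (N ⊔ N′) (ℕ.suc n))

  π : ℕ → M →ₗ M
  π n = mkLinear {M = M} {N = M} (part n)
    (λ {x} {y} x≈y → parts-unique (λ n → part-∈ n x) (λ n → part-∈ n y) (part-vanishes x) (part-vanishes y)
      (≈ᴹ-trans (part-sum x) (≈ᴹ-trans x≈y (≈ᴹ-sym (part-sum y)))) n)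
    (λ x y → parts-unique (λ n → part-∈ n (x +ᴹ y)) (λ n → piece.+-closed n (part-∈ n x) (part-∈ n y))
      (part-vanishes (x +ᴹ y))
      (vanishes-+ (vanishes-⊔ˡ (bound y) (part-vanishes x)) (vanishes-⊔ʳ (bound x) (part-vanishes y)))
      (≈ᴹ-trans (part-sum (x +ᴹ y)) (≈ᴹ-sym (sum-+ x y))) n)
    (λ r x → parts-unique (λ n → part-∈ n (r *ₗ x)) (λ n → piece.*-closed n r (part-∈ n x))
      (part-vanishes (r *ₗ x)) (vanishes-* r (part-vanishes x))
      (≈ᴹ-trans (part-sum (r *ₗ x))
        (≈ᴹ-sym (≈ᴹ-trans (∑<-* (bound x) r _) (*ₗ-congˡ (part-sum x))))) n)
    where
    sum-+ : ∀ x y → ∑< M (bound x ⊔ bound y) (λ n → part n x +ᴹ part n y) ≈ᴹ (x +ᴹ y)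
    sum-+ x y = ≈ᴹ-trans (∑<-+ (bound x ⊔ bound y) _ _) (+ᴹ-cong
      (≈ᴹ-trans (∑<-stable (part-vanishes x) (ℕ.m≤m⊔n (bound x) (bound y))) (part-sum x))
      (≈ᴹ-trans (∑<-stable (part-vanishes y) (ℕ.m≤n⊔m (bound x) (bound y))) (part-sum y)))

  opaque
    π-other : ∀ {m n x} → x ∈ piece n → m ≢ n → ⟦ π m ⟧ x ≈ᴹ 0ᴹ
    π-other {m} {n} {x} x∈ m≢n = ≈ᴹ-trans
      (parts-unique {f = λ i → part i x} {g = g} (λ i → part-∈ i x) g∈ (part-vanishes x) g≈0
        (≈ᴹ-trans (part-sum x) (≈ᴹ-sym g-sum)) m)
      g-m
      where
      g : ℕ → ∣ M ∣
      g i with i ℕ.≟ n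
      ... | yes _ = x
      ... | no  _ = 0ᴹ
      g∈ : ∀ i → g i ∈ piece i
      g∈ i with i ℕ.≟ n
      ... | yes ≡.refl = x∈
      ... | no  _      = piece.0-closed i
      g≈0′ : ∀ i → i ≢ n → g i ≈ᴹ 0ᴹ
      g≈0′ i i≢n with i ℕ.≟ n
      ... | yes i≡n = ⊥-elim (i≢n i≡n)
      ... | no  _   = ≈ᴹ-refl
      g-n : g n ≈ᴹ x
      g-n with n ℕ.≟ n
      ... | yes _   = ≈ᴹ-refl
      ... | no  n≢n = ⊥-elim (n≢n ≡.refl)
      g-m : g m ≈ᴹ 0ᴹ
      g-m = g≈0′ m m≢n
      g≈0 : Vanishes≥ (ℕ.suc n) g
      g≈0 i n<i = g≈0′ i (λ i≡n → ℕ.<-irrefl (≡.sym i≡n) n<i)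
      below : ∀ k → k ≤ n → ∑< M k g ≈ᴹ 0ᴹ
      below zero   _   = ≈ᴹ-refl
      below (ℕ.suc k) k<n = ≈ᴹ-trans
        (+ᴹ-cong (below k (ℕ.<⇒≤ k<n)) (g≈0′ k (λ k≡n → ℕ.<-irrefl k≡n k<n))) (+ᴹ-identityˡ 0ᴹ)
      g-sum : ∑< M (ℕ.suc n) g ≈ᴹ x
      g-sum = ≈ᴹ-trans (+ᴹ-cong (below n ℕ.≤-refl) g-n) (+ᴹ-identityˡ x)

module _ {R : CommutativeRing ℓ ℓ} {M N : Module R ℓ ℓ} where

  -- the degree n part of M ⊗ N, that is, the sum of the images of Mᵢ ⊗ Nₙ₋ᵢ
  TensorPiece : Grading M → Grading N → ℕ → ∣ M ⊗ᴹ N ∣ → Set ℓ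
  TensorPiece 𝓜 𝓝 n t =
    Σ (∀ i → Tensor (submodule (𝓜.piece i)) (submodule (𝓝.piece (n ∸ i)))) λ s →
      ∑< (M ⊗ᴹ N) (ℕ.suc n) (λ i → ⟦ inclusion (𝓜.piece i) ⊗₁ inclusion (𝓝.piece (n ∸ i)) ⟧ (s i)) ≈ₜ t
    where
    module 𝓜 = Grading 𝓜
    module 𝓝 = Grading 𝓝

record CommutativeHopfAlgebra (R : CommutativeRing ℓ ℓ) : Set (Level.suc ℓ) where
  field
    algebra : CommutativeAlgebra R

  open CommutativeAlgebra algebra public

  field
    Δ           : ⟨_⟩ →ₗ ⟨_⟩ ⊗ᴹ ⟨_⟩
    ε           : ⟨_⟩ →ₗ 𝟙

  rawCoalgebra : RawCoalgebra R
  rawCoalgebra = record { ⟨_⟩ = ⟨_⟩ ; Δ = Δ ; ε = ε }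

  field
    isCoalgebra : IsCoalgebra rawCoalgebra
    Δ-algebra   : IsAlgebraHomomorphism rawAlgebra (rawAlgebra ⊗ᴬ rawAlgebra) Δ
    ε-algebra   : IsAlgebraHomomorphism rawAlgebra scalarAlgebra ε
    antipode    : ⟨_⟩ →ₗ ⟨_⟩
    antipodeˡ   : ∀ x → ⟦ mul ⟧ (⟦ antipode ⊗₁ idₗ {M = ⟨_⟩} ⟧ (⟦ Δ ⟧ x)) ≈ unit (⟦ ε ⟧ x)
    antipodeʳ   : ∀ x → ⟦ mul ⟧ (⟦ idₗ {M = ⟨_⟩} ⊗₁ antipode ⟧ (⟦ Δ ⟧ x)) ≈ unit (⟦ ε ⟧ x)

-- The antipode of a graded bialgebra is automatically graded.
record CommutativeGradedHopfAlgebra (R : CommutativeRing ℓ ℓ) : Set (Level.suc ℓ) where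
  field
    hopfAlgebra : CommutativeHopfAlgebra R

  open CommutativeHopfAlgebra hopfAlgebra public

  field
    grading : Grading ⟨_⟩

  open Grading grading public

  field
    *-graded : ∀ {i j x y} → x ∈ piece i → y ∈ piece j → (x * y) ∈ piece (i ℕ.+ j)
    1-graded : 1# ∈ piece 0
    Δ-graded : ∀ {n x} → x ∈ piece n → TensorPiece grading grading n (⟦ Δ ⟧ x)
    ε-graded : ∀ {n x} → x ∈ piece n → n ≢ 0 → CommutativeRing._≈_ R (⟦ ε ⟧ x) (CommutativeRing.0# R)

  Connected : Set ℓ
  Connected = Bijective (Module._≈ᴹ_ (submodule (piece 0))) (CommutativeRing._≈_ R)
                (⟦ ε ⟧ ∘ ⟦ inclusion (piece 0) ⟧)

record ℕ⁺ : Set where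
  constructor 1+_
  field pred : ℕ

toℕ : ℕ⁺ → ℕ
toℕ (1+ n) = ℕ.suc n

infix 4 _≟⁺_ _≟ᶜ_

_≟⁺_ : (m n : ℕ⁺) → Dec (m ≡ n)
(1+ m) ≟⁺ (1+ n) = map′ (≡.cong 1+_) (≡.cong ℕ⁺.pred) (m ℕ.≟ n)

Comp : Set
Comp = List ℕ⁺

_≟ᶜ_ : (α β : Comp) → Dec (α ≡ β)
_≟ᶜ_ = ≡-dec _≟⁺_

parts : Comp → List ℕ
parts = map toℕ

size : Comp → ℕ
size α = sum (parts α)

infix 20 _ʳᵉᵈ

_ʳᵉᵈ : List ℕ → Comp
[]            ʳᵉᵈ = []
(zero ∷ w)    ʳᵉᵈ = w ʳᵉᵈ
(ℕ.suc n ∷ w) ʳᵉᵈ = (1+ n) ∷ w ʳᵉᵈ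

-- A composition of n + 1 arises from exactly one composition of n, by either prepending 1
-- or (if n > 0) incrementing the first part.
grow : Comp → List Comp
grow []           = (1+ 0 ∷ []) ∷ []
grow ((1+ a) ∷ α) = (1+ 0 ∷ 1+ a ∷ α) ∷ (1+ ℕ.suc a ∷ α) ∷ []

compositions : ℕ → List Comp
compositions zero      = [] ∷ []
compositions (ℕ.suc n) = concatMap grow (compositions n)

compositions-size : ∀ n → All (λ α → size α ≡ n) (compositions n)
compositions-size zero      = ≡.refl ∷ []
compositions-size (ℕ.suc n) = All.concat⁺ (All.map⁺ (All.map grow-size (compositions-size n)))
  where
  grow-size : ∀ {α} → size α ≡ n → All (λ β → size β ≡ ℕ.suc n) (grow α)
  grow-size {[]}         ≡.refl = ≡.refl ∷ []
  grow-size {(1+ a) ∷ α} ≡.refl = ≡.refl ∷ ≡.refl ∷ []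

sum-ʳᵉᵈ : ∀ w → size (w ʳᵉᵈ) ≡ sum w
sum-ʳᵉᵈ []            = ≡.refl
sum-ʳᵉᵈ (zero ∷ w)    = sum-ʳᵉᵈ w
sum-ʳᵉᵈ (ℕ.suc n ∷ w) = ≡.cong (ℕ.suc n ℕ.+_) (sum-ʳᵉᵈ w)

-- all (β, γ) whose concatenation is α
deconcatenations : Comp → List (Comp × Comp)
deconcatenations []      = ([] , []) ∷ []
deconcatenations (a ∷ α) = ([] , a ∷ α) ∷ map (map₁ (a ∷_)) (deconcatenations α)

-- all (i, j) with i + j = n
antidiagonal : ℕ → List (ℕ × ℕ)
antidiagonal zero      = (0 , 0) ∷ []
antidiagonal (ℕ.suc n) = (0 , ℕ.suc n) ∷ map (map₁ ℕ.suc) (antidiagonal n)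

-- all (u, v) of the same length as w whose entrywise sum is w
splittings : List ℕ → List (List ℕ × List ℕ)
splittings []      = ([] , []) ∷ []
splittings (n ∷ w) = cartesianProductWith (λ (i , j) (u , v) → i ∷ u , j ∷ v) (antidiagonal n) (splittings w)

antidiagonal-sum : ∀ n → All (λ (i , j) → i ℕ.+ j ≡ n) (antidiagonal n)
antidiagonal-sum zero      = ≡.refl ∷ []
antidiagonal-sum (ℕ.suc n) = ≡.refl ∷ All.map⁺ (All.map (≡.cong ℕ.suc) (antidiagonal-sum n))

Matrix : ℕ → ℕ → Set
Matrix u v = Vec (Vec ℕ v) u

row : ∀ {u v} → Matrix u v → List ℕ
row A = Vec.toList (Vec.map Vec.sum A)

column : ∀ {u v} → Matrix u v → List ℕ
column A = row (Vec.transpose A)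

readMatrix : ∀ {u v} → Matrix u v → List ℕ
readMatrix A = Vec.toList (Vec.concat A)

NonzeroRows : ∀ {u v} → Matrix u v → Set
NonzeroRows = VecAll.All (λ r → ¬ VecAll.All (_≡ 0) r)

Reduced : ∀ {u v} → Matrix u v → Set
Reduced A = NonzeroRows A × NonzeroRows (Vec.transpose A)

reduced? : ∀ {u v} (A : Matrix u v) → Dec (Reduced A)
reduced? A = nonzeroRows? A ×-dec nonzeroRows? (Vec.transpose A)
  where
  nonzeroRows? : ∀ {u v} (A : Matrix u v) → Dec (NonzeroRows A)
  nonzeroRows? = VecAll.all? (λ r → ¬? (VecAll.all? (ℕ._≟ 0) r))

SizedMatrix : Set
SizedMatrix = ∃₂ Matrix

vectors : ∀ {a} {A : Set a} → List A → (n : ℕ) → List (Vec A n)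
vectors xs zero      = [] ∷ []
vectors xs (ℕ.suc n) = cartesianProductWith _∷_ xs (vectors xs n)

-- all matrices with at most n rows, at most n columns and entries at most n
matrices≤ : ℕ → List SizedMatrix
matrices≤ n = concatMap (λ (u , v) → map (λ A → u , v , A) (vectors (vectors [0⋯n] v) u))
                        (cartesianProduct [0⋯n] [0⋯n])
  where
  [0⋯n] : List ℕ
  [0⋯n] = upTo (ℕ.suc n)

-- All reduced matrices A with (read A)ʳᵉᵈ = γ. The entries of such a matrix add up to the
-- size of γ, and so neither they nor the numbers of rows and columns exceed it.
matricesReading : Comp → List SizedMatrix
matricesReading γ = filter (λ (u , v , A) → reduced? A ×-dec (readMatrix A ʳᵉᵈ ≟ᶜ γ)) (matrices≤ (size γ))

ℕ+-interchange : ∀ a b c d → (a ℕ.+ b) ℕ.+ (c ℕ.+ d) ≡ (a ℕ.+ c) ℕ.+ (b ℕ.+ d)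
ℕ+-interchange = CommutativeSemigroupProperties.interchange ℕ.+-commutativeSemigroup

module QuasisymmetricFunctions (R : CommutativeRing ℓ ℓ) where

  open CommutativeRing R hiding (zero) renaming (Carrier to K)

  𝟙ᴿ : Module R ℓ ℓ
  𝟙ᴿ = 𝟙

  -- The monomial x₁^a₁ x₂^a₂ ⋯ xₙ^aₙ is represented by any list (a₁, …, aₙ, 0, …, 0), and a
  -- power series in x₁, x₂, … by its coefficients. Since ʳᵉᵈ also discards trailing zeros,
  -- quasisymmetry implies that coeff does not depend on the choice of the list.
  record QuasisymmetricFunction : Set ℓ where
    field
      coeff          : List ℕ → K
      quasisymmetric : ∀ u v → u ʳᵉᵈ ≡ v ʳᵉᵈ → coeff u ≈ coeff v
      degreeBound    : ℕ
      bounded        : ∀ w → degreeBound ≤ sum w → coeff w ≈ 0#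

  open QuasisymmetricFunction public

  private
    QSet : Set ℓ
    QSet = QuasisymmetricFunction

    ≤-⊔ˡ : ∀ m n {k} → m ⊔ n ≤ k → m ≤ k
    ≤-⊔ˡ m n = ℕ.≤-trans (ℕ.m≤m⊔n m n)

    ≤-⊔ʳ : ∀ m n {k} → m ⊔ n ≤ k → n ≤ k
    ≤-⊔ʳ m n = ℕ.≤-trans (ℕ.m≤n⊔m m n)

  infix 4 _≈Q_

  _≈Q_ : QSet → QSet → Set ℓ
  f ≈Q g = ∀ w → coeff f w ≈ coeff g w

  infixl 6 _+Q_

  _+Q_ : QSet → QSet → QSet
  f +Q g = record
    { coeff = λ w → coeff f w + coeff g w
    ; quasisymmetric = λ u v eq → +-cong (quasisymmetric f u v eq) (quasisymmetric g u v eq)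
    ; degreeBound = degreeBound f ⊔ degreeBound g
    ; bounded = λ w p → trans (+-cong (bounded f w (≤-⊔ˡ (degreeBound f) (degreeBound g) p))
                                      (bounded g w (≤-⊔ʳ (degreeBound f) (degreeBound g) p)))
                              (+-identityˡ 0#)
    }

  0Q : QSet
  0Q = record { coeff = λ _ → 0# ; quasisymmetric = λ _ _ _ → refl ; degreeBound = 0 ; bounded = λ _ _ → refl }

  _*Q_ : K → QSet → QSet
  r *Q f = record
    { coeff = λ w → r * coeff f w
    ; quasisymmetric = λ u v eq → *-congˡ (quasisymmetric f u v eq)
    ; degreeBound = degreeBound f
    ; bounded = λ w p → trans (*-congˡ (bounded f w p)) (zeroʳ r)
    }

  private
    opaque
      isLeftModule : IsLeftModule ring _≈Q_ _+Q_ 0Q ((- 1#) *Q_) _*Q_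
      isLeftModule = record
        { isLeftSemimodule = record
          { +ᴹ-isCommutativeMonoid = record
            { isMonoid = record
              { isSemigroup = record
                { isMagma = record
                  { isEquivalence = record
                    { refl = λ _ → refl ; sym = λ eq w → sym (eq w) ; trans = λ eq eq′ w → trans (eq w) (eq′ w) }
                  ; ∙-cong = λ eq eq′ w → +-cong (eq w) (eq′ w)
                  }
                ; assoc = λ _ _ _ _ → +-assoc _ _ _
                }
              ; identity = (λ _ _ → +-identityˡ _) , (λ _ _ → +-identityʳ _)
              }
            ; comm = λ _ _ _ → +-comm _ _
            }
          ; isPreleftSemimodule = record
            { *ₗ-cong = λ eq eq′ w → *-cong eq (eq′ w)
            ; *ₗ-zeroˡ = λ _ _ → zeroˡ _
            ; *ₗ-distribʳ = λ _ _ _ _ → distribʳ _ _ _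
            ; *ₗ-identityˡ = λ _ _ → *-identityˡ _
            ; *ₗ-assoc = λ _ _ _ _ → *-assoc _ _ _
            ; *ₗ-zeroʳ = λ _ _ → zeroʳ _
            ; *ₗ-distribˡ = λ _ _ _ _ → distribˡ _ _ _
            }
          }
        ; -ᴹ‿cong = λ eq w → *-congˡ (eq w)
        ; -ᴹ‿inverse =
            (λ f w → trans (+-congʳ (*ₗ-negate 𝟙ᴿ (coeff f w))) (-‿inverseˡ _)) ,
            (λ f w → trans (+-congˡ (*ₗ-negate 𝟙ᴿ (coeff f w))) (-‿inverseʳ _))
        }

      isModule : IsModule R _≈Q_ _+Q_ 0Q ((- 1#) *Q_) _*Q_ (flip _*Q_)
      isModule = isModuleFromLeft isLeftModule

  QSym : Module R ℓ ℓ
  QSym = record { isModule = isModule }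

  -- the monomial quasisymmetric function: the sum of all monomials whose sequence of
  -- nonzero exponents is α
  M : Comp → QSet
  M α = record
    { coeff = M-coeff
    ; quasisymmetric = λ u v eq → reflexive (≡.cong (λ β → if does (β ≟ᶜ α) then 1# else 0#) eq)
    ; degreeBound = ℕ.suc (size α)
    ; bounded = M-bounded
    }
    where
    M-coeff : List ℕ → K
    M-coeff w = if does (w ʳᵉᵈ ≟ᶜ α) then 1# else 0#
    M-bounded : ∀ w → ℕ.suc (size α) ≤ sum w → M-coeff w ≈ 0#
    M-bounded w p with w ʳᵉᵈ ≟ᶜ α
    ... | yes eq = ⊥-elim (ℕ.<-irrefl (≡.trans (≡.sym (≡.cong size eq)) (sum-ʳᵉᵈ w)) p)
    ... | no  _  = refl

  cauchyProduct : (List ℕ → K) → (List ℕ → K) → List ℕ → K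
  cauchyProduct f g w = ∑ 𝟙ᴿ (splittings w) (λ (u , v) → f u * g v)

  open Sums 𝟙ᴿ
  open ≈-Reasoning setoid

  -- the power series expanded in powers of x₁
  cauchyProduct-∷ : ∀ f g n w → cauchyProduct f g (n ∷ w) ≈
    ∑ 𝟙ᴿ (antidiagonal n) (λ (i , j) → cauchyProduct (λ u → f (i ∷ u)) (λ v → g (j ∷ v)) w)
  cauchyProduct-∷ f g n w =
    ∑-cartesianProductWith (λ (i , j) (u , v) → i ∷ u , j ∷ v) (antidiagonal n) (splittings w) (λ (u , v) → f u * g v)

  cauchyProduct-cong : ∀ w {f f′ g g′} → (∀ u → f u ≈ f′ u) → (∀ u → g u ≈ g′ u) →
    cauchyProduct f g w ≈ cauchyProduct f′ g′ w
  cauchyProduct-cong w eq eq′ = ∑-cong (splittings w) (λ (u , v) → *-cong (eq u) (eq′ v))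

  Quasi : (List ℕ → K) → Set ℓ
  Quasi f = ∀ u v → u ʳᵉᵈ ≡ v ʳᵉᵈ → f u ≈ f v

  quasi-∷ : ∀ {f} i → Quasi f → Quasi (λ u → f (i ∷ u))
  quasi-∷ zero      qf u v eq = qf (zero ∷ u) (zero ∷ v) eq
  quasi-∷ (ℕ.suc i) qf u v eq = qf (ℕ.suc i ∷ u) (ℕ.suc i ∷ v) (≡.cong ((1+ i) ∷_) eq)

  cauchyProduct-0∷ : ∀ {f g} w → Quasi f → Quasi g → cauchyProduct f g (0 ∷ w) ≈ cauchyProduct f g w
  cauchyProduct-0∷ {f} {g} w qf qg = trans (cauchyProduct-∷ f g 0 w) (trans (+-identityʳ _)
    (cauchyProduct-cong w (λ u → qf (0 ∷ u) u ≡.refl) (λ v → qg (0 ∷ v) v ≡.refl)))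

  cauchyProduct-ʳᵉᵈ : ∀ {f g} w → Quasi f → Quasi g →
    cauchyProduct f g w ≈ cauchyProduct f g (parts (w ʳᵉᵈ))
  cauchyProduct-ʳᵉᵈ []                    qf qg = refl
  cauchyProduct-ʳᵉᵈ (zero ∷ w)            qf qg = trans (cauchyProduct-0∷ w qf qg) (cauchyProduct-ʳᵉᵈ w qf qg)
  cauchyProduct-ʳᵉᵈ {f} {g} (ℕ.suc n ∷ w) qf qg = begin
    cauchyProduct f g (ℕ.suc n ∷ w)                ≈⟨ cauchyProduct-∷ f g (ℕ.suc n) w ⟩
    ∑ 𝟙ᴿ (antidiagonal (ℕ.suc n)) (λ (i , j) → cauchyProduct (λ u → f (i ∷ u)) (λ v → g (j ∷ v)) w)
      ≈⟨ ∑-cong (antidiagonal (ℕ.suc n)) (λ (i , j) → cauchyProduct-ʳᵉᵈ w (quasi-∷ i qf) (quasi-∷ j qg)) ⟩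
    ∑ 𝟙ᴿ (antidiagonal (ℕ.suc n)) (λ (i , j) → cauchyProduct (λ u → f (i ∷ u)) (λ v → g (j ∷ v)) (parts (w ʳᵉᵈ)))
      ≈⟨ cauchyProduct-∷ f g (ℕ.suc n) (parts (w ʳᵉᵈ)) ⟨
    cauchyProduct f g (ℕ.suc n ∷ parts (w ʳᵉᵈ))    ∎

  cauchyProduct-bounded : ∀ {m n f g} w →
    (∀ u → m ≤ sum u → f u ≈ 0#) → (∀ v → n ≤ sum v → g v ≈ 0#) →
    m ℕ.+ n ≤ sum w → cauchyProduct f g w ≈ 0#
  cauchyProduct-bounded {m} {n} {f} {g} w f≈0 g≈0 p = ∑-zero (All.map vanishes (splittings-sum w))
    where
    splittings-sum : ∀ w → All (λ (u , v) → sum u ℕ.+ sum v ≡ sum w) (splittings w)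
    splittings-sum []      = ≡.refl ∷ []
    splittings-sum (k ∷ w) = product (antidiagonal-sum k)
      where
      product : ∀ {ijs} → All (λ (i , j) → i ℕ.+ j ≡ k) ijs →
        All (λ (u , v) → sum u ℕ.+ sum v ≡ k ℕ.+ sum w)
          (cartesianProductWith (λ (i , j) (u , v) → i ∷ u , j ∷ v) ijs (splittings w))
      product []                 = []
      product {(i , j) ∷ _} (eq ∷ eqs) = All.++⁺
        (All.map⁺ (All.map (λ {(u , v)} eq′ → ≡.trans (ℕ+-interchange i (sum u) j (sum v)) (≡.cong₂ ℕ._+_ eq eq′))
          (splittings-sum w)))
        (product eqs)
    vanishes : ∀ {(u , v) : List ℕ × List ℕ} → sum u ℕ.+ sum v ≡ sum w → f u * g v ≈ 0#
    vanishes {u , v} eq with m ℕ.≤? sum u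
    ... | yes m≤u = trans (*-congʳ (f≈0 u m≤u)) (zeroˡ _)
    ... | no  m≰u = trans (*-congˡ (g≈0 v (ℕ.≮⇒≥ λ v<n →
      ℕ.<-irrefl eq (ℕ.<-≤-trans (ℕ.+-mono-< (ℕ.≰⇒> m≰u) v<n) p)))) (zeroʳ _)

  infixl 7 _·Q_

  _·Q_ : QSet → QSet → QSet
  f ·Q g = record
    { coeff = cauchyProduct (coeff f) (coeff g)
    ; quasisymmetric = λ u v eq → begin
        cauchyProduct (coeff f) (coeff g) u                ≈⟨ cauchyProduct-ʳᵉᵈ u (quasisymmetric f) (quasisymmetric g) ⟩
        cauchyProduct (coeff f) (coeff g) (parts (u ʳᵉᵈ))  ≈⟨ reflexive (≡.cong (λ α → cauchyProduct (coeff f) (coeff g) (parts α)) eq) ⟩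
        cauchyProduct (coeff f) (coeff g) (parts (v ʳᵉᵈ))  ≈⟨ cauchyProduct-ʳᵉᵈ v (quasisymmetric f) (quasisymmetric g) ⟨
        cauchyProduct (coeff f) (coeff g) v                ∎
    ; degreeBound = degreeBound f ℕ.+ degreeBound g
    ; bounded = λ w → cauchyProduct-bounded w (bounded f) (bounded g)
    }

  QSym-rawAlgebra : RawAlgebra R
  QSym-rawAlgebra = record
    { ⟨_⟩ = QSym
    ; mul = lift {M = QSym} {N = QSym} {P = QSym} record
      { op = _·Q_
      ; cong = λ eq eq′ w → cauchyProduct-cong w eq eq′
      ; +-homoˡ = λ f f′ g w → trans (∑-cong (splittings w) (λ (u , v) → distribʳ (coeff g v) _ _)) (∑-+ (splittings w) _ _)
      ; +-homoʳ = λ f g g′ w → trans (∑-cong (splittings w) (λ (u , v) → distribˡ (coeff f u) _ _)) (∑-+ (splittings w) _ _)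
      ; *-homoˡ = λ r f g w → trans (∑-cong (splittings w) (λ (u , v) → *-assoc r _ _)) (∑-* (splittings w) r _)
      ; *-homoʳ = λ r f g w → trans (∑-cong (splittings w) (λ (u , v) → Module.*ₗ-comm 𝟙ᴿ (coeff f u) r (coeff g v)))
          (∑-* (splittings w) r _)
      }
    ; one = M []
    }

  -- the linear map that sends M α to φ α, since f is the sum of all coeff f α M α
  linearExtension : (P : Module R ℓ ℓ) → (Comp → ∣ P ∣) → QSym →ₗ P
  linearExtension P φ = mkLinear {M = QSym} {N = P}
    (λ f → ∑< P (degreeBound f) (term f))
    (λ {f} {g} f≈g → S.∑<-bound (term-vanishes f) (term-vanishes g) (λ n →
      S.∑-cong (compositions n) (λ α → P.*ₗ-congʳ (f≈g (parts α)))))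
    (λ f g → S.∑<-bound-+ (term-vanishes (f +Q g)) (term-vanishes f) (term-vanishes g) (λ n →
      P.≈ᴹ-trans (S.∑-cong (compositions n) (λ α → P.*ₗ-distribʳ (φ α) _ _)) (S.∑-+ (compositions n) _ _)))
    (λ r f → S.∑<-bound-* r (term-vanishes (r *Q f)) (term-vanishes f) (λ n →
      P.≈ᴹ-trans (S.∑-cong (compositions n) (λ α → P.*ₗ-assoc r _ (φ α))) (S.∑-* (compositions n) r _)))
    where
    module P = Module P
    module S = Sums P
    term : QSet → ℕ → ∣ P ∣
    term f n = ∑ P (compositions n) (λ α → coeff f (parts α) P.*ₗ φ α)
    term-vanishes : ∀ f → S.Vanishes≥ (degreeBound f) (term f)
    term-vanishes f n p = S.∑-zero (All.map
      (λ {α} eq → P.≈ᴹ-trans (P.*ₗ-congʳ (bounded f (parts α) (ℕ.≤-trans p (ℕ.≤-reflexive (≡.sym eq))))) (P.*ₗ-zeroˡ (φ α)))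
      (compositions-size n))

  QSym-rawCoalgebra : RawCoalgebra R
  QSym-rawCoalgebra = record
    { ⟨_⟩ = QSym
    ; Δ   = linearExtension (QSym ⊗ᴹ QSym) (λ α →
              ∑ (QSym ⊗ᴹ QSym) (deconcatenations α) (λ (β , γ) → M β ⊗ M γ))
    ; ε   = mkLinear {M = QSym} {N = 𝟙ᴿ} (λ f → coeff f []) (λ eq → eq []) (λ _ _ → refl) (λ _ _ → refl)
    }

  -- Among the monomials, only the powers of x₁ contribute to f (1, 0, 0, …).
  εP : QSym →ₗ 𝟙ᴿ
  εP = mkLinear {M = QSym} {N = 𝟙ᴿ}
    (λ f → ∑< 𝟙ᴿ (degreeBound f) (term f))
    (λ {f} {g} f≈g → ∑<-bound (vanishes f) (vanishes g) (λ n → f≈g (n ∷ [])))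
    (λ f g → ∑<-bound-+ (vanishes (f +Q g)) (vanishes f) (vanishes g) (λ n → refl))
    (λ r f → ∑<-bound-* r (vanishes (r *Q f)) (vanishes f) (λ n → refl))
    where
    term : QSet → ℕ → K
    term f n = coeff f (n ∷ [])
    vanishes : ∀ f → Vanishes≥ (degreeBound f) (term f)
    vanishes f n p = bounded f (n ∷ []) (ℕ.≤-trans p (ℕ.≤-reflexive (≡.sym (ℕ.+-identityʳ n))))

  QSymPiece : ℕ → Submodule QSym
  QSymPiece n = record
    { Contains = λ f → ∀ w → sum w ≢ n → coeff f w ≈ 0#
    ; resp = λ f≈g f∈ w p → trans (sym (f≈g w)) (f∈ w p)
    ; +-closed = λ f∈ g∈ w p → trans (+-cong (f∈ w p) (g∈ w p)) (+-identityˡ 0#)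
    ; 0-closed = λ _ _ → refl
    ; *-closed = λ r f∈ w p → trans (*-congˡ (f∈ w p)) (zeroʳ r)
    }

  -- the quasisymmetric functions invariant under all permutations of the variables
  Λ : Submodule QSym
  Λ = record
    { Contains = λ f → ∀ u v → u ↭ v → coeff f u ≈ coeff f v
    ; resp = λ f≈g f∈ u v p → trans (sym (f≈g u)) (trans (f∈ u v p) (f≈g v))
    ; +-closed = λ f∈ g∈ u v p → +-cong (f∈ u v p) (g∈ u v p)
    ; 0-closed = λ _ _ _ → refl
    ; *-closed = λ r f∈ u v p → *-congˡ (f∈ u v p)
    }

  -- For a reduced matrix A, the sequences row A and column A have no zeros, so that ʳᵉᵈ only
  -- turns them into compositions.
  ΔP : QSym →ₗ QSym ⊗ᴹ QSym
  ΔP = linearExtension (QSym ⊗ᴹ QSym) (λ γ →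
    ∑ (QSym ⊗ᴹ QSym) (matricesReading γ) (λ (u , v , A) → M (row A ʳᵉᵈ) ⊗ M (column A ʳᵉᵈ)))

  ΔP′ : QSym →ₗ QSym ⊗ᴹ QSym
  ΔP′ = swap {M = QSym} {N = QSym} ∘ₗ ΔP

module Bernstein {R : CommutativeRing ℓ ℓ} (H : CommutativeGradedHopfAlgebra R) where
  open QuasisymmetricFunctions R public
  module H = CommutativeGradedHopfAlgebra H

  ⟨H⟩ : Module R ℓ ℓ
  ⟨H⟩ = H.⟨_⟩

  H^⊗ : ℕ → Module R ℓ ℓ
  H^⊗ 0                 = 𝟙
  H^⊗ 1                 = ⟨H⟩
  H^⊗ (ℕ.suc (ℕ.suc k)) = ⟨H⟩ ⊗ᴹ H^⊗ (ℕ.suc k)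

  -- The index k below counts tensor factors: these are Δ⁽ᵏ⁻¹⁾ and m⁽ᵏ⁻¹⁾.

  Δ^ : ∀ k → ⟨H⟩ →ₗ H^⊗ k
  Δ^ 0                 = H.ε
  Δ^ 1                 = idₗ {M = ⟨H⟩}
  Δ^ (ℕ.suc (ℕ.suc k)) = (idₗ {M = ⟨H⟩} ⊗₁ Δ^ (ℕ.suc k)) ∘ₗ H.Δ

  m^ : ∀ k → H^⊗ k →ₗ ⟨H⟩
  m^ 0                 = H.unitₗ
  m^ 1                 = idₗ {M = ⟨H⟩}
  m^ (ℕ.suc (ℕ.suc k)) = H.mul ∘ₗ (idₗ {M = ⟨H⟩} ⊗₁ m^ (ℕ.suc k))

  π^ : ∀ α → H^⊗ (length α) →ₗ H^⊗ (length α)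
  π^ []          = idₗ {M = 𝟙}
  π^ (a ∷ [])    = H.π (toℕ a)
  π^ (a ∷ b ∷ α) = H.π (toℕ a) ⊗₁ π^ (b ∷ α)

  ξ : Comp → ⟨H⟩ →ₗ ⟨H⟩
  ξ α = m^ (length α) ∘ₗ π^ α ∘ₗ Δ^ (length α)

  killed-⊗ : ∀ {M N M′ N′ : Module R ℓ ℓ} (f : M →ₗ M′) (g : N →ₗ N′) {S : Submodule M} {T : Submodule N} →
    (∀ x y → x ∈ S → y ∈ T → _≈ₜ_ {M = M′} {N = N′} (⟦ f ⟧ x ⊗ ⟦ g ⟧ y) 0ₜ) →
    ∀ (t : Tensor (submodule S) (submodule T)) →
    _≈ₜ_ {M = M′} {N = N′} (⟦ f ⊗₁ g ⟧ (⟦ inclusion S ⊗₁ inclusion T ⟧ t)) 0ₜ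
  killed-⊗ f g eq 0ₜ                    = reflₜ
  killed-⊗ f g eq ((x , x∈) ⊗ (y , y∈)) = eq x y x∈ y∈
  killed-⊗ f g eq (s +ₜ t)              =
    transₜ (+ₜ-cong (killed-⊗ f g eq s) (killed-⊗ f g eq t)) (+ₜ-identity 0ₜ)

  ∑<-zero : ∀ (M : Module R ℓ ℓ) n {f : ℕ → ∣ M ∣} →
    (∀ i → i < n → Module._≈ᴹ_ M (f i) (Module.0ᴹ M)) → Module._≈ᴹ_ M (∑< M n f) (Module.0ᴹ M)
  ∑<-zero M zero      eq = Module.≈ᴹ-refl M
  ∑<-zero M (ℕ.suc n) eq = Module.≈ᴹ-trans M
    (Module.+ᴹ-cong M (∑<-zero M n (λ i i<n → eq i (ℕ.m<n⇒m<1+n i<n))) (eq n (ℕ.n<1+n n)))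
    (Module.+ᴹ-identityˡ M _)

  Kills : Comp → Set ℓ
  Kills α = ∀ {n h} → h ∈ H.piece n → size α ≢ n →
    Module._≈ᴹ_ (H^⊗ (length α)) (⟦ π^ α ⟧ (⟦ Δ^ (length α) ⟧ h)) (Module.0ᴹ (H^⊗ (length α)))

  kills-∷ : ∀ a b α → Kills (b ∷ α) → Kills (a ∷ b ∷ α)
  kills-∷ a b α kills {n} {h} h∈ p = begin
    ⟦ πa ⊗₁ π^ (b ∷ α) ⟧ (⟦ idₗ {M = ⟨H⟩} ⊗₁ Δ^ k ⟧ (⟦ H.Δ ⟧ h))
      ≈⟨ fusion (⟦ H.Δ ⟧ h) ⟩
    ⟦ F ⟧ (⟦ H.Δ ⟧ h)
      ≈⟨ F.⟦⟧-cong (proj₂ (H.Δ-graded h∈)) ⟨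
    ⟦ F ⟧ (∑< (⟨H⟩ ⊗ᴹ ⟨H⟩) (ℕ.suc n) summand)
      ≈⟨ ∑<-homo F (ℕ.suc n) summand ⟩
    ∑< T (ℕ.suc n) (λ i → ⟦ F ⟧ (summand i))
      ≈⟨ ∑<-zero T (ℕ.suc n) (λ i i<n → killed-⊗ πa rest {S = H.piece i} {T = H.piece (n ∸ i)}
           (killed i (ℕ.≤-pred i<n)) (s i)) ⟩
    0ₜ ∎
    where
    k : ℕ
    k = ℕ.suc (length α)
    T : Module R ℓ ℓ
    T = ⟨H⟩ ⊗ᴹ H^⊗ k
    open ≈-Reasoning (Module.≈ᴹ-setoid T)
    πa : ⟨H⟩ →ₗ ⟨H⟩
    πa = H.π (toℕ a)
    rest : ⟨H⟩ →ₗ H^⊗ k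
    rest = π^ (b ∷ α) ∘ₗ Δ^ k
    F : ⟨H⟩ ⊗ᴹ ⟨H⟩ →ₗ T
    F = πa ⊗₁ rest
    module F = _→ₗ_ F
    s : ∀ i → Tensor (submodule (H.piece i)) (submodule (H.piece (n ∸ i)))
    s = proj₁ (H.Δ-graded h∈)
    summand : ℕ → ∣ ⟨H⟩ ⊗ᴹ ⟨H⟩ ∣
    summand i = ⟦ inclusion (H.piece i) ⊗₁ inclusion (H.piece (n ∸ i)) ⟧ (s i)
    fusion : ∀ t → ⟦ πa ⊗₁ π^ (b ∷ α) ⟧ (⟦ idₗ {M = ⟨H⟩} ⊗₁ Δ^ k ⟧ t) ≈ₜ ⟦ F ⟧ t
    fusion 0ₜ       = reflₜ
    fusion (x ⊗ y)  = reflₜ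
    fusion (t +ₜ u) = +ₜ-cong (fusion t) (fusion u)
    killed : ∀ i → i ≤ n → ∀ x y → x ∈ H.piece i → y ∈ H.piece (n ∸ i) →
      _≈ₜ_ {M = ⟨H⟩} {N = H^⊗ k} (⟦ πa ⟧ x ⊗ ⟦ rest ⟧ y) 0ₜ
    killed i i≤n x y x∈ y∈ with toℕ a ℕ.≟ i
    ... | yes ≡.refl = transₜ (⊗-congˡ (kills y∈
            (λ eq → p (≡.trans (≡.cong (toℕ a ℕ.+_) eq) (ℕ.m+[n∸m]≡n i≤n))))) (⊗-zeroʳ _)
    ... | no  a≢i    = transₜ (⊗-congʳ (H.π-other x∈ a≢i)) (⊗-zeroˡ _)

  π^-Δ^-kills : ∀ α → Kills α
  π^-Δ^-kills []          h∈ p = H.ε-graded h∈ (p ∘ ≡.sym)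
  π^-Δ^-kills (a ∷ [])    h∈ p = H.π-other h∈ (λ eq → p (≡.trans (ℕ.+-identityʳ (toℕ a)) eq))
  π^-Δ^-kills (a ∷ b ∷ α) = kills-∷ a b α (π^-Δ^-kills (b ∷ α))

  opaque
    ξ-kills : ∀ α {n h} → h ∈ H.piece n → size α ≢ n → ⟦ ξ α ⟧ h H.≈ H.0#
    ξ-kills α h∈ p = H.trans (m.⟦⟧-cong (π^-Δ^-kills α h∈ p)) m.0ᴹ-homo
      where module m = _→ₗ_ (m^ (length α))

    ξ-vanishes : ∀ α h → H.bound h ≤ size α → ⟦ ξ α ⟧ h H.≈ H.0#
    ξ-vanishes α h p = begin
      ⟦ ξ α ⟧ h                                          ≈⟨ ξ.⟦⟧-cong (H.part-sum h) ⟨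
      ⟦ ξ α ⟧ (∑< ⟨H⟩ (H.bound h) (λ n → H.part n h))    ≈⟨ ∑<-homo (ξ α) (H.bound h) _ ⟩
      ∑< ⟨H⟩ (H.bound h) (λ n → ⟦ ξ α ⟧ (H.part n h))
        ≈⟨ ∑<-zero ⟨H⟩ (H.bound h) (λ n n<b →
             ξ-kills α (H.part-∈ n h) (λ eq → ℕ.<-irrefl (≡.sym eq) (ℕ.<-≤-trans n<b p))) ⟩
      H.0#                                               ∎
      where
      module ξ = _→ₗ_ (ξ α)
      open ≈-Reasoning H.setoid

  H⊗QSym : Module R ℓ ℓ
  H⊗QSym = ⟨H⟩ ⊗ᴹ QSym

  -- The sum of ξ α h ⊗ M α ranges over the compositions α of size less than bound h; by
  -- ξ-vanishes, all remaining terms are zero.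
  β : ⟨H⟩ →ₗ H⊗QSym
  β = mkLinear {M = ⟨H⟩} {N = H⊗QSym}
    (λ h → ∑< H⊗QSym (H.bound h) (term h))
    (λ {x} {y} x≈y → S.∑<-bound (vanishes x) (vanishes y) (λ n →
      S.∑-cong (compositions n) (λ α → ⊗-congʳ (_→ₗ_.⟦⟧-cong (ξ α) x≈y))))
    (λ x y → S.∑<-bound-+ (vanishes (x H.+ y)) (vanishes x) (vanishes y) (λ n →
      transₜ (S.∑-cong (compositions n) (λ α → transₜ (⊗-congʳ (_→ₗ_.+ᴹ-homo (ξ α) x y)) (⊗-+ˡ _ _ _)))
        (S.∑-+ (compositions n) _ _)))
    (λ r x → S.∑<-bound-* r (vanishes (Module._*ₗ_ ⟨H⟩ r x)) (vanishes x) (λ n →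
      transₜ (S.∑-cong (compositions n) (λ α → ⊗-congʳ (_→ₗ_.*ₗ-homo (ξ α) r x)))
        (S.∑-* (compositions n) r _)))
    where
    module S = Sums H⊗QSym
    term : ∣ ⟨H⟩ ∣ → ℕ → ∣ H⊗QSym ∣
    term h n = ∑ H⊗QSym (compositions n) (λ α → ⟦ ξ α ⟧ h ⊗ M α)
    vanishes : ∀ h → S.Vanishes≥ (H.bound h) (term h)
    vanishes h n p = S.∑-zero (All.map
      (λ {α} eq → transₜ (⊗-congʳ (ξ-vanishes α h (ℕ.≤-trans p (ℕ.≤-reflexive (≡.sym eq))))) (⊗-zeroˡ (M α)))
      (compositions-size n))

  H⊗QSym-rawAlgebra : RawAlgebra R
  H⊗QSym-rawAlgebra = H.rawAlgebra ⊗ᴬ QSym-rawAlgebra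

  -- β, with H ⊗ QSym regarded as an H-module
  βᴴ : ⟨H⟩ →ₗ restrict H.algebra (extend H.algebra QSym)
  βᴴ = _∘ₗ_ {L = ⟨H⟩} {M = H⊗QSym} {N = restrict H.algebra (extend H.algebra QSym)}
    (⊗⇒extend H.algebra QSym) β

{-# OPTIONS --safe #-}

-- Since the M_α form a basis of QSym, an element of V ⊗ QSym is determined by its coefficients in V.
-- The coefficient of β(h) at α is ξ_α(h), and ξ_α is the convolution product of the projections π_a
-- over the parts a of α. This product makes sense for every word w of natural numbers; it is written
-- Ξ w and depends only on the composition obtained from w by removing zeros, because π_0 = unit ∘ ε
-- for connected H. In terms of coefficients, the claims on β become
--   Ξ_w(xy) = ∑ Ξ_u(x) Ξ_v(y), summed over u + v = w, which holds because H is commutative,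
--   Ξ_{uv} = Ξ_u ⋆ Ξ_v for the concatenation uv,
--   ∑ₙ Ξ_(n) = id,
--   Ξ_u ∘ Ξ_v = ∑ Ξ_{read A}, summed over the matrices A with column sums u and row sums v,
--   Ξ_u = Ξ_v for permutations v of u, which holds for cocommutative H because ⋆ is then commutative.
-- The fourth identity follows by induction on v from the first one and Ξ_u ∘ π_n = [|u| = n] Ξ_u.

module Submission where

open import Level using (Level)
open import Algebra.Bundles using (CommutativeRing)
open import Algebra.Module.Bundles using (Module)
open import Data.Bool using (if_then_else_)
open import Data.Empty using (⊥-elim)
open import Data.List as List using (List; []; _∷_; _++_; map; concatMap; filter; upTo; cartesianProductWith; length)
open import Data.List.Membership.Propositional using (find; lose) renaming (_∈_ to _∈ˡ_)
open import Data.List.Membership.Propositional.Properties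
  using (∈-map⁺; ∈-map⁻; ∈-concatMap⁺; ∈-concatMap⁻; ∈-cartesianProductWith⁺; ∈-cartesianProductWith⁻; ∈-cartesianProduct⁺; ∈-filter⁺; ∈-filter⁻; ∈-upTo⁺)
open import Data.List.Membership.Propositional.Properties.WithK using (unique∧set⇒bag)
open import Data.List.Properties using (∷-injective; filter-all; filter-none; map-++)
open import Data.List.Relation.Binary.BagAndSetEquality using (∼bag⇒↭)
open import Data.List.Relation.Binary.Permutation.Propositional as ↭ using (_↭_)
open import Data.List.Relation.Binary.Permutation.Propositional.Properties using (map⁺)
open import Data.List.Relation.Binary.Pointwise using (Pointwise-≡⇒≡)
open import Data.List.Relation.Unary.All as All using (All; []; _∷_)
import Data.List.Relation.Unary.All.Properties as All
open import Data.List.Relation.Unary.AllPairs using ([]; _∷_)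
open import Data.List.Relation.Unary.Any using (here; there)
open import Data.List.Relation.Unary.Sorted.TotalOrder.Properties using (↗↭↗⇒≋)
open import Data.List.Relation.Unary.Unique.Propositional using (Unique)
import Data.List.Relation.Unary.Unique.Propositional.Properties as Unique
open import Data.Nat as ℕ using (ℕ; zero; suc; _≤_; _<_; _⊔_; _+_)
open import Data.Nat.ListAction using (sum)
open import Data.Nat.ListAction.Properties using (sum-++; sum-↭)
import Data.Nat.Properties as ℕ
open import Data.List.Sort ℕ.≤-decTotalOrder using (sort; sort-↭; sort-↗)
open import Data.Product using (∃; _×_; _,_; proj₁; proj₂; map₁)
open import Data.Vec as Vec using (Vec; []; _∷_)
import Data.Vec.Properties as Vec
import Data.Vec.Relation.Unary.All as VecAll
open import Function using (_∘_; mk⇔)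
open import Relation.Binary.PropositionalEquality as ≡ using (_≡_; _≢_)
open import Relation.Nullary using (Dec; yes; no; does; _×-dec_)
open import Relation.Unary using (Pred; Decidable)
import Relation.Binary.Reasoning.Setoid as ≈-Reasoning
open import Defs

-- Words with zeros cannot be avoided: the two halves of a splitting `u + v` of a composition, and
-- the reading word of a reduced matrix, contain zeros in general. Indexing by words also lets each
-- identity run by plain recursion on a list, with `Ξ-ʳᵉᵈ` leading back to compositions. The
-- obstacle in the fourth identity is that two enumerations of matrices meet. Recursion on the row
-- sums produces `matricesWithSums`, built row by row, whereas `ΔP` filters a finite box of matrices
-- by their reading word. On `M γ` the comparison becomes a double count of the matrices with given
-- row sums, column sums and reading word. A tensor is recovered from its coefficients by a finite
-- expansion only. Each expansion therefore comes with a bound beyond which it is stable, and two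
-- tensors are compared at the maximum of their bounds. Linear maps out of tensor products are
-- compared on pure tensors, and the general lemmas take the products involving `V ⊗ QSym` as
-- parameters known by their values there.

-- Duplicate-free enumerations of compositions and antidiagonals

module _ {a b} {A : Set a} {B : Set b} where

  -- The map `g` recovers the index `x` from any element of `f x`, so lists belonging to different
  -- indices are disjoint.
  concatMap-unique : (f : A → List B) (g : B → A) → (∀ x {y} → y ∈ˡ f x → g y ≡ x) →
    (∀ x → Unique (f x)) → ∀ {xs} → Unique xs → Unique (concatMap f xs)
  concatMap-unique f g g-f f! []           = []
  concatMap-unique f g g-f f! {x ∷ xs} (x∉ ∷ xs!) = Unique.++⁺ (f! x) (concatMap-unique f g g-f f! xs!)
    λ {y} (y∈ , y∈′) → let x′ , x′∈ , y∈fx′ = find (∈-concatMap⁻ f y∈′) in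
      All.lookup x∉ x′∈ (≡.trans (≡.sym (g-f x y∈)) (g-f x′ y∈fx′))

-- The left inverse of `grow`: a first part 1 is dropped, and a larger first part is decremented.
shrink : Comp → Comp
shrink []                   = []
shrink ((1+ zero) ∷ α)      = α
shrink ((1+ ℕ.suc a) ∷ α)   = (1+ a) ∷ α

shrink-grow : ∀ α {β} → β ∈ˡ grow α → shrink β ≡ α
shrink-grow []           (here ≡.refl)         = ≡.refl
shrink-grow ((1+ a) ∷ α) (here ≡.refl)         = ≡.refl
shrink-grow ((1+ a) ∷ α) (there (here ≡.refl)) = ≡.refl

∈-grow-shrink : ∀ a α → ((1+ a) ∷ α) ∈ˡ grow (shrink ((1+ a) ∷ α))
∈-grow-shrink zero      []           = here ≡.refl
∈-grow-shrink zero      ((1+ b) ∷ α) = here ≡.refl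
∈-grow-shrink (ℕ.suc a) α            = there (here ≡.refl)

compositions-unique : ∀ n → Unique (compositions n)
compositions-unique zero      = [] ∷ []
compositions-unique (ℕ.suc n) = concatMap-unique grow shrink shrink-grow grow-unique (compositions-unique n)
  where
  grow-unique : ∀ α → Unique (grow α)
  grow-unique []           = [] ∷ []
  grow-unique ((1+ a) ∷ α) = ((λ ()) ∷ []) ∷ [] ∷ []

∈-compositions : ∀ α → α ∈ˡ compositions (size α)
∈-compositions α = complete (size α) α ≡.refl
  where
  complete : ∀ n α → size α ≡ n → α ∈ˡ compositions n
  complete zero      []                 eq = here ≡.refl
  complete (ℕ.suc n) ((1+ zero) ∷ α)    eq =
    ∈-concatMap⁺ grow (lose (complete n α (ℕ.suc-injective eq)) (∈-grow-shrink 0 α))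
  complete (ℕ.suc n) ((1+ ℕ.suc a) ∷ α) eq =
    ∈-concatMap⁺ grow (lose (complete n ((1+ a) ∷ α) (ℕ.suc-injective eq)) (∈-grow-shrink (ℕ.suc a) α))

antidiagonal-unique : ∀ n → Unique (antidiagonal n)
antidiagonal-unique zero      = [] ∷ []
antidiagonal-unique (ℕ.suc n) =
  All.map⁺ (All.universal (λ _ ()) (antidiagonal n)) ∷ Unique.map⁺ (λ { ≡.refl → ≡.refl }) (antidiagonal-unique n)

∈-antidiagonal : ∀ i j → (i , j) ∈ˡ antidiagonal (i ℕ.+ j)
∈-antidiagonal zero      zero      = here ≡.refl
∈-antidiagonal zero      (ℕ.suc j) = here ≡.refl
∈-antidiagonal (ℕ.suc i) j         = there (∈-map⁺ _ (∈-antidiagonal i j))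

parts-ʳᵉᵈ : ∀ α → parts α ʳᵉᵈ ≡ α
parts-ʳᵉᵈ []           = ≡.refl
parts-ʳᵉᵈ ((1+ a) ∷ α) = ≡.cong ((1+ a) ∷_) (parts-ʳᵉᵈ α)

-- Finite sums, and linear maps determined by pure tensors

-- Bundles a pointwise sum as a linear map, so that identities with a sum on one side fall under
-- extensionality principles such as `⊗-ext`.
∑ₗ : ∀ {ℓ a} {R : CommutativeRing ℓ ℓ} {A : Set a} {V W : Module R ℓ ℓ} → List A → (A → V →ₗ W) → V →ₗ W
∑ₗ {V = V} {W = W} xs F = mkLinear {M = V} {N = W} (λ v → ∑ W xs (λ x → ⟦ F x ⟧ v))
  (λ eq → ∑-cong xs (λ x → _→ₗ_.⟦⟧-cong (F x) eq))
  (λ v v′ → W.≈ᴹ-trans (∑-cong xs (λ x → _→ₗ_.+ᴹ-homo (F x) v v′)) (∑-+ xs _ _))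
  (λ r v → W.≈ᴹ-trans (∑-cong xs (λ x → _→ₗ_.*ₗ-homo (F x) r v)) (∑-* xs r _))
  where
  module W = Module W
  open Sums W

module MoreSums {ℓ} {R : CommutativeRing ℓ ℓ} (P : Module R ℓ ℓ) where
  open Module P
  open Sums P public
  open ≈-Reasoning ≈ᴹ-setoid

  module _ {a} {A : Set a} where

    ∑-↭ : ∀ {xs ys : List A} (f : A → ∣ P ∣) → xs ↭ ys → ∑ P xs f ≈ᴹ ∑ P ys f
    ∑-↭ f ↭.refl          = ≈ᴹ-refl
    ∑-↭ f (↭.prep x p)    = +ᴹ-congˡ (∑-↭ f p)
    ∑-↭ f (↭.swap {xs} {ys} x y p)  = begin
      f x +ᴹ (f y +ᴹ ∑ P xs f)   ≈⟨ +ᴹ-assoc _ _ _ ⟨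
      (f x +ᴹ f y) +ᴹ ∑ P xs f   ≈⟨ +ᴹ-cong (+ᴹ-comm _ _) (∑-↭ f p) ⟩
      (f y +ᴹ f x) +ᴹ ∑ P ys f   ≈⟨ +ᴹ-assoc _ _ _ ⟩
      f y +ᴹ (f x +ᴹ ∑ P ys f)   ∎
    ∑-↭ f (↭.trans p q)   = ≈ᴹ-trans (∑-↭ f p) (∑-↭ f q)

    ∑-filter : ∀ {p} {Q : Pred A p} (Q? : Decidable Q) xs (f : A → ∣ P ∣) →
      ∑ P (filter Q? xs) f ≈ᴹ ∑ P xs (λ x → if does (Q? x) then f x else 0ᴹ)
    ∑-filter Q? []       f = ≈ᴹ-refl
    ∑-filter Q? (x ∷ xs) f with Q? x
    ... | yes _ = +ᴹ-congˡ (∑-filter Q? xs f)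
    ... | no  _ = ≈ᴹ-trans (∑-filter Q? xs f) (≈ᴹ-sym (+ᴹ-identityˡ _))

    ∑-concatMap : ∀ {b} {B : Set b} (h : A → List B) xs (f : B → ∣ P ∣) →
      ∑ P (concatMap h xs) f ≈ᴹ ∑ P xs (λ x → ∑ P (h x) f)
    ∑-concatMap h []       f = ≈ᴹ-refl
    ∑-concatMap h (x ∷ xs) f = ≈ᴹ-trans (∑-++ (h x) (concatMap h xs) f) (+ᴹ-congˡ (∑-concatMap h xs f))

    ∑-single : ∀ {xs x} {f : A → ∣ P ∣} → Unique xs → x ∈ˡ xs → (∀ y → y ≢ x → f y ≈ᴹ 0ᴹ) → ∑ P xs f ≈ᴹ f x
    ∑-single {_ ∷ xs} {x} {f} (x∉ ∷ xs!) (here ≡.refl) f≈0 = ≈ᴹ-trans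
      (+ᴹ-congˡ (∑-zero (All.map (λ x≢y → f≈0 _ (x≢y ∘ ≡.sym)) x∉))) (+ᴹ-identityʳ _)
    ∑-single {y ∷ xs} {x} {f} (y∉ ∷ xs!) (there x∈) f≈0 = ≈ᴹ-trans
      (+ᴹ-cong (f≈0 y (All.lookup y∉ x∈)) (∑-single xs! x∈ f≈0)) (+ᴹ-identityˡ _)

  ∑<-zero : ∀ N {f : ℕ → ∣ P ∣} → (∀ n → n < N → f n ≈ᴹ 0ᴹ) → ∑< P N f ≈ᴹ 0ᴹ
  ∑<-zero zero      eq = ≈ᴹ-refl
  ∑<-zero (ℕ.suc N) eq = ≈ᴹ-trans
    (+ᴹ-cong (∑<-zero N (λ n n<N → eq n (ℕ.m<n⇒m<1+n n<N))) (eq N (ℕ.n<1+n N))) (+ᴹ-identityˡ _)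

  ∑<-single : ∀ {N n} {f : ℕ → ∣ P ∣} → n < N → (∀ m → m ≢ n → f m ≈ᴹ 0ᴹ) → ∑< P N f ≈ᴹ f n
  ∑<-single {ℕ.suc N} {n} {f} n<1+N f≈0 with n ℕ.≟ N
  ... | yes ≡.refl = ≈ᴹ-trans
    (+ᴹ-congʳ (∑<-zero N (λ m m<N → f≈0 m (λ m≡n → ℕ.<-irrefl m≡n m<N)))) (+ᴹ-identityˡ _)
  ... | no  n≢N    = ≈ᴹ-trans
    (+ᴹ-cong (∑<-single (ℕ.≤∧≢⇒< (ℕ.≤-pred n<1+N) n≢N) f≈0) (f≈0 N (n≢N ∘ ≡.sym))) (+ᴹ-identityʳ _)

  ∑-compositions : ℕ → (Comp → ∣ P ∣) → ∣ P ∣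
  ∑-compositions N f = ∑< P N (λ n → ∑ P (compositions n) f)

  ∑-compositions-cong : ∀ N {f g : Comp → ∣ P ∣} → (∀ α → f α ≈ᴹ g α) →
    ∑-compositions N f ≈ᴹ ∑-compositions N g
  ∑-compositions-cong N eq = ∑<-cong N (λ n → ∑-cong (compositions n) eq)

  ∑-compositions-+ : ∀ N (f g : Comp → ∣ P ∣) →
    ∑-compositions N (λ α → f α +ᴹ g α) ≈ᴹ (∑-compositions N f +ᴹ ∑-compositions N g)
  ∑-compositions-+ N f g = ≈ᴹ-trans (∑<-cong N (λ n → ∑-+ (compositions n) f g)) (∑<-+ N _ _)

  ∑-compositions-zero : ∀ N {f : Comp → ∣ P ∣} → (∀ α → size α < N → f α ≈ᴹ 0ᴹ) →
    ∑-compositions N f ≈ᴹ 0ᴹ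
  ∑-compositions-zero N f≈0 = ∑<-zero N (λ n n<N →
    ∑-zero (All.map (λ { {α} ≡.refl → f≈0 α n<N }) (compositions-size n)))

  ∑-compositions-single : ∀ {N} α {f : Comp → ∣ P ∣} → size α < N → (∀ β → β ≢ α → f β ≈ᴹ 0ᴹ) →
    ∑-compositions N f ≈ᴹ f α
  ∑-compositions-single {N} α {f} α<N f≈0 = ≈ᴹ-trans
    (∑<-single α<N (λ m m≢ → ∑-zero (All.map
      (λ {β} eq → f≈0 β (λ β≡α → m≢ (≡.trans (≡.sym eq) (≡.cong size β≡α)))) (compositions-size m))))
    (∑-single (compositions-unique (size α)) (∈-compositions α) f≈0)

module _ {ℓ} {R : CommutativeRing ℓ ℓ} {V W : Module R ℓ ℓ} (f : V →ₗ W) where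
  private
    module f = _→ₗ_ f
    module W = Module W

  ∑-homo : ∀ {a} {A : Set a} (xs : List A) (g : A → ∣ V ∣) → ⟦ f ⟧ (∑ V xs g) W.≈ᴹ ∑ W xs (⟦ f ⟧ ∘ g)
  ∑-homo []       g = f.0ᴹ-homo
  ∑-homo (x ∷ xs) g = W.≈ᴹ-trans (f.+ᴹ-homo _ _) (W.+ᴹ-congˡ (∑-homo xs g))

  ∑-compositions-homo : ∀ N (g : Comp → ∣ V ∣) →
    ⟦ f ⟧ (MoreSums.∑-compositions V N g) W.≈ᴹ MoreSums.∑-compositions W N (⟦ f ⟧ ∘ g)
  ∑-compositions-homo N g = W.≈ᴹ-trans (∑<-homo f N _)
    (Sums.∑<-cong W N (λ n → ∑-homo (compositions n) g))

⊗-ext : ∀ {ℓ} {R : CommutativeRing ℓ ℓ} {V W P : Module R ℓ ℓ} (f g : V ⊗ᴹ W →ₗ P) →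
  (∀ x y → Module._≈ᴹ_ P (⟦ f ⟧ (x ⊗ y)) (⟦ g ⟧ (x ⊗ y))) → ∀ t → Module._≈ᴹ_ P (⟦ f ⟧ t) (⟦ g ⟧ t)
⊗-ext {P = P} f g eq 0ₜ       = Module.≈ᴹ-trans P (_→ₗ_.0ᴹ-homo f) (Module.≈ᴹ-sym P (_→ₗ_.0ᴹ-homo g))
⊗-ext {P = P} f g eq (x ⊗ y)  = eq x y
⊗-ext {P = P} f g eq (s +ₜ t) = Module.≈ᴹ-trans P (_→ₗ_.+ᴹ-homo f s t)
  (Module.≈ᴹ-trans P (Module.+ᴹ-cong P (⊗-ext f g eq s) (⊗-ext f g eq t)) (Module.≈ᴹ-sym P (_→ₗ_.+ᴹ-homo g s t)))

⊗-ext₂ : ∀ {ℓ} {R : CommutativeRing ℓ ℓ} {V W X Y P : Module R ℓ ℓ} (f g : (V ⊗ᴹ W) ⊗ᴹ (X ⊗ᴹ Y) →ₗ P) →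
  (∀ a b c d → Module._≈ᴹ_ P (⟦ f ⟧ ((a ⊗ b) ⊗ (c ⊗ d))) (⟦ g ⟧ ((a ⊗ b) ⊗ (c ⊗ d)))) →
  ∀ s t → Module._≈ᴹ_ P (⟦ f ⟧ (s ⊗ t)) (⟦ g ⟧ (s ⊗ t))
⊗-ext₂ {V = V} {W} {X} {Y} f g eq s t =
  ⊗-ext {V = V} {W = W} (f ∘ₗ (-⊗_ {M = V ⊗ᴹ W} {N = X ⊗ᴹ Y} t)) (g ∘ₗ (-⊗_ {M = V ⊗ᴹ W} {N = X ⊗ᴹ Y} t))
    (λ a b → ⊗-ext {V = X} {W = Y}
      (f ∘ₗ (_⊗- {M = V ⊗ᴹ W} {N = X ⊗ᴹ Y} (a ⊗ b))) (g ∘ₗ (_⊗- {M = V ⊗ᴹ W} {N = X ⊗ᴹ Y} (a ⊗ b))) (eq a b) t) s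

∘-ext₂ : ∀ {ℓ} {R : CommutativeRing ℓ ℓ} {V W X Y Z P : Module R ℓ ℓ}
  (g : Z →ₗ P) (m : (V ⊗ᴹ W) ⊗ᴹ (X ⊗ᴹ Y) →ₗ Z) (f : (V ⊗ᴹ W) ⊗ᴹ (X ⊗ᴹ Y) →ₗ P) →
  (∀ a b c d → Module._≈ᴹ_ P (⟦ g ⟧ (⟦ m ⟧ ((a ⊗ b) ⊗ (c ⊗ d)))) (⟦ f ⟧ ((a ⊗ b) ⊗ (c ⊗ d)))) →
  ∀ s t → Module._≈ᴹ_ P (⟦ g ⟧ (⟦ m ⟧ (s ⊗ t))) (⟦ f ⟧ (s ⊗ t))
∘-ext₂ {V = V} {W} {X} {Y} {P = P} g m f = ⊗-ext₂ {V = V} {W} {X} {Y} {P} (g ∘ₗ m) f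

-- Matrices with given row and column sums

columns : ∀ {p q} → Matrix p q → Vec ℕ q
columns A = Vec.map Vec.sum (Vec.transpose A)

columns-∷ : ∀ {p q} (r : Vec ℕ q) (A : Matrix p q) → columns (r ∷ A) ≡ Vec.zipWith _+_ r (columns A)
columns-∷ r A = go r (Vec.transpose A)
  where
  go : ∀ {p q} (r : Vec ℕ q) (T : Matrix q p) →
    Vec.map Vec.sum ((Vec.replicate q _∷_ Vec.⊛ r) Vec.⊛ T) ≡ Vec.zipWith _+_ r (Vec.map Vec.sum T)
  go []      []      = ≡.refl
  go (x ∷ r) (c ∷ T) = ≡.cong (_ ∷_) (go r T)

sum-columns : ∀ {p q} (A : Matrix p q) → Vec.sum (columns A) ≡ Vec.sum (Vec.map Vec.sum A)
sum-columns {q = q} []      = zeros q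
  where
  zeros : ∀ q → Vec.sum (Vec.map Vec.sum (Vec.replicate {A = Vec ℕ 0} q [])) ≡ 0
  zeros zero    = ≡.refl
  zeros (suc q) = zeros q
sum-columns (r ∷ A) = ≡.trans (≡.cong Vec.sum (columns-∷ r A))
  (≡.trans (sum-zipWith r (columns A)) (≡.cong (Vec.sum r +_) (sum-columns A)))
  where
  sum-zipWith : ∀ {q} (r s : Vec ℕ q) → Vec.sum (Vec.zipWith _+_ r s) ≡ Vec.sum r + Vec.sum s
  sum-zipWith []      []      = ≡.refl
  sum-zipWith (x ∷ r) (y ∷ s) = ≡.trans (≡.cong (x + y +_) (sum-zipWith r s)) (ℕ+-interchange x y _ _)

sum-toList : ∀ {n} (r : Vec ℕ n) → sum (Vec.toList r) ≡ Vec.sum r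
sum-toList []      = ≡.refl
sum-toList (x ∷ r) = ≡.cong (x +_) (sum-toList r)

readMatrix-∷ : ∀ {p q} (r : Vec ℕ q) (A : Matrix p q) → readMatrix (r ∷ A) ≡ Vec.toList r ++ readMatrix A
readMatrix-∷ r A = Vec.toList-++ r (Vec.concat A)

sum-readMatrix : ∀ {p q} (A : Matrix p q) → sum (readMatrix A) ≡ Vec.sum (Vec.map Vec.sum A)
sum-readMatrix []      = ≡.refl
sum-readMatrix (r ∷ A) = ≡.trans (≡.cong sum (readMatrix-∷ r A)) (≡.trans (sum-++ (Vec.toList r) (readMatrix A))
  (≡.cong₂ _+_ (sum-toList r) (sum-readMatrix A)))

splittingsᵛ : ∀ {n} → Vec ℕ n → List (Vec ℕ n × Vec ℕ n)
splittingsᵛ []      = ([] , []) ∷ []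
splittingsᵛ (n ∷ w) = cartesianProductWith (λ (i , j) (u , v) → i ∷ u , j ∷ v) (antidiagonal n) (splittingsᵛ w)

splittings-toList : ∀ {n} (w : Vec ℕ n) →
  splittings (Vec.toList w) ≡ map (λ (u , v) → Vec.toList u , Vec.toList v) (splittingsᵛ w)
splittings-toList []      = ≡.refl
splittings-toList (n ∷ w) = ≡.trans (≡.cong (cartesianProductWith _ (antidiagonal n)) (splittings-toList w))
  (go (antidiagonal n) (splittingsᵛ w))
  where
  go : ∀ {n} (ijs : List (ℕ × ℕ)) (uvs : List (Vec ℕ n × Vec ℕ n)) →
    cartesianProductWith (λ (i , j) (u , v) → i ∷ u , j ∷ v) ijs (map (λ (u , v) → Vec.toList u , Vec.toList v) uvs)
    ≡ map (λ (u , v) → Vec.toList u , Vec.toList v) (cartesianProductWith (λ (i , j) (u , v) → i ∷ u , j ∷ v) ijs uvs)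
  go []         uvs = ≡.refl
  go (ij ∷ ijs) uvs = ≡.trans (≡.cong₂ _++_ (inner uvs) (go ijs uvs)) (≡.sym (map-++ _ (map _ uvs) _))
    where
    inner : ∀ uvs → map (λ (u , v) → proj₁ ij ∷ u , proj₂ ij ∷ v) (map (λ (u , v) → Vec.toList u , Vec.toList v) uvs)
      ≡ map (λ (u , v) → Vec.toList u , Vec.toList v) (map (λ (u , v) → proj₁ ij ∷ u , proj₂ ij ∷ v) uvs)
    inner []        = ≡.refl
    inner (_ ∷ uvs) = ≡.cong (_ ∷_) (inner uvs)

∈-splittingsᵛ⁺ : ∀ {n} (u v : Vec ℕ n) → (u , v) ∈ˡ splittingsᵛ (Vec.zipWith _+_ u v)
∈-splittingsᵛ⁺ []      []      = here ≡.refl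
∈-splittingsᵛ⁺ (i ∷ u) (j ∷ v) =
  ∈-cartesianProductWith⁺ (λ (i , j) (u , v) → i ∷ u , j ∷ v) (∈-antidiagonal i j) (∈-splittingsᵛ⁺ u v)

∈-splittingsᵛ⁻ : ∀ {n} (w : Vec ℕ n) {u v} → (u , v) ∈ˡ splittingsᵛ w → Vec.zipWith _+_ u v ≡ w
∈-splittingsᵛ⁻ []      (here ≡.refl) = ≡.refl
∈-splittingsᵛ⁻ (n ∷ w) uv∈ with ∈-cartesianProductWith⁻ _ (antidiagonal n) (splittingsᵛ w) uv∈
... | _ , _ , ij∈ , uv∈′ , ≡.refl = ≡.cong₂ _∷_ (All.lookup (antidiagonal-sum n) ij∈) (∈-splittingsᵛ⁻ w uv∈′)

splittingsᵛ-unique : ∀ {n} (w : Vec ℕ n) → Unique (splittingsᵛ w)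
splittingsᵛ-unique []      = [] ∷ []
splittingsᵛ-unique (n ∷ w) = Unique.cartesianProductWith⁺ _ (λ { ≡.refl → ≡.refl , ≡.refl })
  (antidiagonal-unique n) (splittingsᵛ-unique w)

-- all matrices with column sums u and row sums v
matricesWithSums : ∀ {p q} → Vec ℕ q → Vec ℕ p → List (Matrix p q)
matricesWithSums u []      = filter (λ _ → Vec.sum u ℕ.≟ 0) ([] ∷ [])
matricesWithSums u (n ∷ v) = concatMap (λ (r , u′) → map (r ∷_) (matricesWithSums u′ v))
  (filter (λ (r , _) → Vec.sum r ℕ.≟ n) (splittingsᵛ u))

∈-matricesWithSums⁺ : ∀ {p q} (A : Matrix p q) → A ∈ˡ matricesWithSums (columns A) (Vec.map Vec.sum A)
∈-matricesWithSums⁺ A = go A (columns A) ≡.refl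
  where
  -- The column sums are carried along an equation because `columns (r ∷ A)` becomes an entrywise
  -- sum only through `columns-∷`.
  go : ∀ {p q} (A : Matrix p q) u → columns A ≡ u → A ∈ˡ matricesWithSums u (Vec.map Vec.sum A)
  go []      u eq = ∈-filter⁺ (λ _ → Vec.sum u ℕ.≟ 0) (here ≡.refl)
    (≡.trans (≡.cong Vec.sum (≡.sym eq)) (sum-columns {q = Vec.length u} []))
  go (r ∷ A) u eq = ∈-concatMap⁺ (λ (r , u′) → map (r ∷_) (matricesWithSums u′ (Vec.map Vec.sum A)))
    (lose {x = r , columns A} (∈-filter⁺ (λ (r′ , _) → Vec.sum r′ ℕ.≟ Vec.sum r)
      (≡.subst (λ u → (r , columns A) ∈ˡ splittingsᵛ u) (≡.trans (≡.sym (columns-∷ r A)) eq) (∈-splittingsᵛ⁺ r (columns A)))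
      ≡.refl) (∈-map⁺ (r ∷_) (go A (columns A) ≡.refl)))

∈-matricesWithSums⁻ : ∀ {p q} (u : Vec ℕ q) (v : Vec ℕ p) {A} → A ∈ˡ matricesWithSums u v →
  columns A ≡ u × Vec.map Vec.sum A ≡ v
∈-matricesWithSums⁻ u [] {[]} A∈ with ∈-filter⁻ (λ _ → Vec.sum u ℕ.≟ 0) {xs = [] ∷ []} A∈
... | _ , u≡0 = zeros u u≡0 , ≡.refl
  where
  zeros : ∀ {q} (u : Vec ℕ q) → Vec.sum u ≡ 0 → columns {q = q} [] ≡ u
  zeros []         eq = ≡.refl
  zeros (zero ∷ u) eq = ≡.cong (0 ∷_) (zeros u eq)
∈-matricesWithSums⁻ {suc p} {q} u (n ∷ v) A∈
  with find (∈-concatMap⁻ {A = Vec ℕ q × Vec ℕ q} (λ (r , u′) → map (r ∷_) (matricesWithSums u′ v)) A∈)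
... | (r , u′) , ru′∈ , A∈′ with ∈-filter⁻ (λ ((r , _) : Vec ℕ q × Vec ℕ q) → Vec.sum r ℕ.≟ n) {xs = splittingsᵛ u} ru′∈ | ∈-map⁻ (r ∷_) A∈′
...   | ru′∈′ , ≡.refl | A′ , A′∈ , ≡.refl with ∈-matricesWithSums⁻ u′ v A′∈
...     | ≡.refl , ≡.refl = ≡.trans (columns-∷ r A′) (∈-splittingsᵛ⁻ u ru′∈′) , ≡.refl

-- A matrix remembers the splitting that it was built from: `r` is its first row, and `u′` consists
-- of the column sums of the other rows.
matricesWithSums-unique : ∀ {p q} (u : Vec ℕ q) (v : Vec ℕ p) → Unique (matricesWithSums u v)
matricesWithSums-unique u []      = Unique.filter⁺ (λ _ → Vec.sum u ℕ.≟ 0) ([] ∷ [])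
matricesWithSums-unique {suc p} {q} u (n ∷ v) = concatMap-unique {A = Vec ℕ q × Vec ℕ q} (λ (r , u′) → map (r ∷_) (matricesWithSums u′ v)) (λ A → Vec.head A , columns (Vec.tail A))
  (λ (r , u′) A∈ → left-inverse r u′ A∈)
  (λ (r , u′) → Unique.map⁺ (λ { ≡.refl → ≡.refl }) (matricesWithSums-unique u′ v))
  (Unique.filter⁺ (λ (r , _) → Vec.sum r ℕ.≟ n) (splittingsᵛ-unique u))
  where
  left-inverse : ∀ r u′ {A : Matrix (suc p) q} → A ∈ˡ map (r ∷_) (matricesWithSums u′ v) → (Vec.head A , columns (Vec.tail A)) ≡ (r , u′)
  left-inverse r u′ A∈ with ∈-map⁻ (r ∷_) A∈
  ... | A′ , A′∈ , ≡.refl = ≡.cong (r ,_) (proj₁ (∈-matricesWithSums⁻ u′ v A′∈))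

-- Reduced matrices listed by their sums and by their reading word

sizedMatricesWithSums : ∃ (Vec ℕ) → ∃ (Vec ℕ) → List SizedMatrix
sizedMatricesWithSums (q , u) (p , v) = map (λ A → p , q , A) (matricesWithSums u v)

-- An equation of pairs, because the lengths of the two vectors agree only propositionally.
fromList-toList : ∀ {n} (v : Vec ℕ n) → _≡_ {A = ∃ (Vec ℕ)} (length (Vec.toList v) , Vec.fromList (Vec.toList v)) (n , v)
fromList-toList []      = ≡.refl
fromList-toList (x ∷ v) = ≡.cong (λ (n , v) → suc n , x ∷ v) (fromList-toList v)

vectors-unique : ∀ {a} {X : Set a} {xs : List X} → Unique xs → ∀ n → Unique (vectors xs n)
vectors-unique xs! zero    = [] ∷ []
vectors-unique xs! (suc n) = Unique.cartesianProductWith⁺ _∷_ (λ { ≡.refl → ≡.refl , ≡.refl }) xs! (vectors-unique xs! n)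

∈-vectors : ∀ {a} {X : Set a} {xs : List X} {n} {v : Vec X n} → VecAll.All (_∈ˡ xs) v → v ∈ˡ vectors xs n
∈-vectors VecAll.[]        = here ≡.refl
∈-vectors (x∈ VecAll.∷ v∈) = ∈-cartesianProductWith⁺ _∷_ x∈ (∈-vectors v∈)

matrices≤-unique : ∀ n → Unique (matrices≤ n)
matrices≤-unique n = concatMap-unique {A = ℕ × ℕ}
  (λ (u , v) → map (λ A → u , v , A) (vectors (vectors (upTo (suc n)) v) u)) (λ (u , v , _) → u , v)
  (λ (u , v) A∈ → left-inverse u v A∈)
  (λ (u , v) → Unique.map⁺ (λ { ≡.refl → ≡.refl }) (vectors-unique (vectors-unique [0⋯n]! v) u))
  (Unique.cartesianProduct⁺ [0⋯n]! [0⋯n]!)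
  where
  [0⋯n]! : Unique (upTo (suc n))
  [0⋯n]! = Unique.upTo⁺ (suc n)
  left-inverse : ∀ u v {A : SizedMatrix} →
    A ∈ˡ map (λ B → u , v , B) (vectors (vectors (upTo (suc n)) v) u) → (proj₁ A , proj₁ (proj₂ A)) ≡ (u , v)
  left-inverse u v A∈ with ∈-map⁻ (λ B → u , v , B) A∈
  ... | _ , _ , ≡.refl = ≡.refl

entries-≤ : ∀ {n} (r : Vec ℕ n) {k} → Vec.sum r ≤ k → VecAll.All (_≤ k) r
entries-≤ []      r≤k = VecAll.[]
entries-≤ (x ∷ r) r≤k = ℕ.≤-trans (ℕ.m≤m+n x _) r≤k VecAll.∷ entries-≤ r (ℕ.≤-trans (ℕ.m≤n+m _ x) r≤k)

length≤sum : ∀ {n} (v : Vec ℕ n) → VecAll.All (_≢ 0) v → n ≤ Vec.sum v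
length≤sum []           _                     = ℕ.z≤n
length≤sum (zero ∷ v)   (0≢0 VecAll.∷ _)      = ⊥-elim (0≢0 ≡.refl)
length≤sum (suc x ∷ v)  (_ VecAll.∷ v≢0)      = ℕ.s≤s (ℕ.≤-trans (length≤sum v v≢0) (ℕ.m≤n+m _ x))

-- Nonzero row sums are at least 1, so the number of rows is at most the sum of all entries. The
-- same holds for columns, and each entry is bounded by this total as well.
∈-matrices≤ : ∀ {p q} (A : Matrix p q) → VecAll.All (_≢ 0) (Vec.map Vec.sum A) → VecAll.All (_≢ 0) (columns A) →
  ∀ {n} → sum (readMatrix A) ≡ n → (p , q , A) ∈ˡ matrices≤ n
∈-matrices≤ {p} {q} A rows≢0 columns≢0 {n} eq = ∈-concatMap⁺ {A = ℕ × ℕ}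
  (λ (u , v) → map (λ A → u , v , A) (vectors (vectors (upTo (suc n)) v) u))
  (lose {x = p , q}
  (∈-cartesianProduct⁺ (bounded (length≤sum _ rows≢0) ≡.refl) (bounded (length≤sum _ columns≢0) (sum-columns A)))
  (∈-map⁺ (λ A → p , q , A) (∈-vectors (rows∈ A (ℕ.≤-reflexive total)))))
  where
  total : Vec.sum (Vec.map Vec.sum A) ≡ n
  total = ≡.trans (≡.sym (sum-readMatrix A)) eq
  bounded : ∀ {m s} → m ≤ s → s ≡ Vec.sum (Vec.map Vec.sum A) → m ∈ˡ upTo (suc n)
  bounded m≤s s≡ = ∈-upTo⁺ (ℕ.s≤s (ℕ.≤-trans m≤s (ℕ.≤-reflexive (≡.trans s≡ total))))
  rows∈ : ∀ {p q} (A : Matrix p q) → Vec.sum (Vec.map Vec.sum A) ≤ n → VecAll.All (_∈ˡ vectors (upTo (suc n)) q) A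
  rows∈ []      _  = VecAll.[]
  rows∈ (r ∷ A) p≤ = ∈-vectors (VecAll.map (∈-upTo⁺ ∘ ℕ.s≤s) (entries-≤ r (ℕ.≤-trans (ℕ.m≤m+n _ _) p≤)))
    VecAll.∷ rows∈ A (ℕ.≤-trans (ℕ.m≤n+m _ (Vec.sum r)) p≤)

nonzeroRows⇒sums≢0 : ∀ {p q} (A : Matrix p q) → NonzeroRows A → VecAll.All (_≢ 0) (Vec.map Vec.sum A)
nonzeroRows⇒sums≢0 []      VecAll.[]          = VecAll.[]
nonzeroRows⇒sums≢0 (r ∷ A) (r≢0 VecAll.∷ A≢0) =
  (λ sum≡0 → r≢0 (VecAll.map ℕ.n≤0⇒n≡0 (entries-≤ r (ℕ.≤-reflexive sum≡0)))) VecAll.∷ nonzeroRows⇒sums≢0 A A≢0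

sums≢0⇒nonzeroRows : ∀ {p q} (A : Matrix p q) → VecAll.All (_≢ 0) (Vec.map Vec.sum A) → NonzeroRows A
sums≢0⇒nonzeroRows []      _                       = VecAll.[]
sums≢0⇒nonzeroRows (r ∷ A) (sum≢0 VecAll.∷ sums≢0) = (sum≢0 ∘ sum≡0 r) VecAll.∷ sums≢0⇒nonzeroRows A sums≢0
  where
  sum≡0 : ∀ {n} (r : Vec ℕ n) → VecAll.All (_≡ 0) r → Vec.sum r ≡ 0
  sum≡0 []      VecAll.[]               = ≡.refl
  sum≡0 (_ ∷ r) (≡.refl VecAll.∷ r≡0) = sum≡0 r r≡0

parts-of-positive : ∀ {n} (v : Vec ℕ n) → VecAll.All (_≢ 0) v → parts (Vec.toList v ʳᵉᵈ) ≡ Vec.toList v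
parts-of-positive []          _                = ≡.refl
parts-of-positive (zero ∷ v)  (0≢0 VecAll.∷ _) = ⊥-elim (0≢0 ≡.refl)
parts-of-positive (suc x ∷ v) (_ VecAll.∷ v≢0) = ≡.cong (suc x ∷_) (parts-of-positive v v≢0)

positive-of-parts : ∀ {n} (v : Vec ℕ n) α → Vec.toList v ≡ parts α → VecAll.All (_≢ 0) v
positive-of-parts []      []           eq     = VecAll.[]
positive-of-parts (_ ∷ v) ((1+ a) ∷ α) eq     with ∷-injective eq
... | ≡.refl , eq′ = (λ ()) VecAll.∷ positive-of-parts v α eq′

toSized : List ℕ → ∃ (Vec ℕ)
toSized w = length w , Vec.fromList w

HasSums : Comp → Comp → SizedMatrix → Set
HasSums α β (_ , _ , A) = row A ʳᵉᵈ ≡ β × column A ʳᵉᵈ ≡ α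

hasSums? : ∀ α β A → Dec (HasSums α β A)
hasSums? α β (_ , _ , A) = (row A ʳᵉᵈ ≟ᶜ β) ×-dec (column A ʳᵉᵈ ≟ᶜ α)

Reads : Comp → SizedMatrix → Set
Reads γ (_ , _ , A) = readMatrix A ʳᵉᵈ ≡ γ

reads? : ∀ γ A → Dec (Reads γ A)
reads? γ (_ , _ , A) = readMatrix A ʳᵉᵈ ≟ᶜ γ

-- The reduced matrices with row sums β and column sums α are all matrices with these sums,
-- because α and β have no zeros.
matricesReading-↭ : ∀ α β γ →
  filter (hasSums? α β) (matricesReading γ) ↭ filter (reads? γ) (sizedMatricesWithSums (toSized (parts α)) (toSized (parts β)))
-- Neither list has repetitions, so having the same elements already makes them permutations of each
-- other.
matricesReading-↭ α β γ = ∼bag⇒↭ (unique∧set⇒bag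
  (Unique.filter⁺ (hasSums? α β) (Unique.filter⁺ read? (matrices≤-unique (size γ))))
  (Unique.filter⁺ (reads? γ) (Unique.map⁺ {f = λ A → _ , _ , A} (λ { ≡.refl → ≡.refl }) (matricesWithSums-unique (Vec.fromList (parts α)) (Vec.fromList (parts β)))))
  (λ {A} → mk⇔ (to A) (from A)))
  where
  read? : ∀ A → Dec (Reduced (proj₂ (proj₂ A)) × Reads γ A)
  read? (_ , _ , A) = reduced? A ×-dec (readMatrix A ʳᵉᵈ ≟ᶜ γ)

  ∈-sized : ∀ {p q} (A : Matrix p q) u v → Vec.toList (columns A) ≡ u → row A ≡ v →
    (p , q , A) ∈ˡ sizedMatricesWithSums (toSized u) (toSized v)
  ∈-sized {p} {q} A _ _ ≡.refl ≡.refl = ≡.subst₂ (λ u v → (p , q , A) ∈ˡ sizedMatricesWithSums u v)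
    (≡.sym (fromList-toList (columns A))) (≡.sym (fromList-toList (Vec.map Vec.sum A)))
    (∈-map⁺ (λ A → p , q , A) (∈-matricesWithSums⁺ A))

  to : ∀ A → A ∈ˡ filter (hasSums? α β) (matricesReading γ) →
    A ∈ˡ filter (reads? γ) (sizedMatricesWithSums (toSized (parts α)) (toSized (parts β)))
  to (p , q , A) A∈ with ∈-filter⁻ (hasSums? α β) {xs = matricesReading γ} A∈
  ... | A∈′ , row≡ , column≡ with ∈-filter⁻ read? {xs = matrices≤ (size γ)} A∈′
  ...   | _ , (rows≢0 , columns≢0) , read≡ = ∈-filter⁺ (reads? γ)
    (∈-sized A _ _
      (≡.trans (≡.sym (parts-of-positive (columns A) (nonzeroRows⇒sums≢0 (Vec.transpose A) columns≢0))) (≡.cong parts column≡))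
      (≡.trans (≡.sym (parts-of-positive (Vec.map Vec.sum A) (nonzeroRows⇒sums≢0 A rows≢0))) (≡.cong parts row≡)))
    read≡

  from : ∀ A → A ∈ˡ filter (reads? γ) (sizedMatricesWithSums (toSized (parts α)) (toSized (parts β))) →
    A ∈ˡ filter (hasSums? α β) (matricesReading γ)
  from A A∈ with ∈-filter⁻ (reads? γ) {xs = sizedMatricesWithSums (toSized (parts α)) (toSized (parts β))} A∈
  ... | A∈′ , read≡ with ∈-map⁻ _ A∈′
  ...   | B , B∈ , ≡.refl with ∈-matricesWithSums⁻ (Vec.fromList (parts α)) (Vec.fromList (parts β)) B∈
  ...     | columns≡ , rows≡ = ∈-filter⁺ (hasSums? α β)
    (∈-filter⁺ read? (∈-matrices≤ B rows≢0 columns≢0 (≡.trans (≡.sym (sum-ʳᵉᵈ (readMatrix B))) (≡.cong size read≡)))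
      ((sums≢0⇒nonzeroRows B rows≢0 , sums≢0⇒nonzeroRows (Vec.transpose B) columns≢0) , read≡))
    (≡.trans (≡.cong _ʳᵉᵈ row≡) (parts-ʳᵉᵈ β) , ≡.trans (≡.cong _ʳᵉᵈ column≡) (parts-ʳᵉᵈ α))
    where
    row≡ : row B ≡ parts β
    row≡ = ≡.trans (≡.cong Vec.toList rows≡) (Vec.toList∘fromList (parts β))
    column≡ : column B ≡ parts α
    column≡ = ≡.trans (≡.cong Vec.toList columns≡) (Vec.toList∘fromList (parts α))
    rows≢0 : VecAll.All (_≢ 0) (Vec.map Vec.sum B)
    rows≢0 = positive-of-parts _ β row≡
    columns≢0 : VecAll.All (_≢ 0) (columns B)
    columns≢0 = positive-of-parts _ α column≡

-- Coefficients of tensors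

module Coefficients {ℓ} (R : CommutativeRing ℓ ℓ) where
  open QuasisymmetricFunctions R
  private
    module R = CommutativeRing R
    module Q = Module QSym

  coeffₗ : List ℕ → QSym →ₗ 𝟙ᴿ
  coeffₗ w = mkLinear {M = QSym} {N = 𝟙ᴿ} (λ f → coeff f w) (λ eq → eq w) (λ _ _ → R.refl) (λ _ _ → R.refl)

  coeff-M-≡ : ∀ {α} w → w ʳᵉᵈ ≡ α → coeff (M α) w ≡ R.1#
  coeff-M-≡ {α} w eq with w ʳᵉᵈ ≟ᶜ α
  ... | yes _ = ≡.refl
  ... | no ≢α = ⊥-elim (≢α eq)

  coeff-M-≢ : ∀ {α} w → w ʳᵉᵈ ≢ α → coeff (M α) w ≡ R.0#
  coeff-M-≢ {α} w ≢α with w ʳᵉᵈ ≟ᶜ α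
  ... | yes eq = ⊥-elim (≢α eq)
  ... | no  _  = ≡.refl

  private
    module S𝟙 = MoreSums 𝟙ᴿ
    module SQ = MoreSums QSym

  -- At the word `w` only the term of `w ʳᵉᵈ` can survive. If `w` has degree at least `N`, no such
  -- term is in range, and `f` itself vanishes at `w` by its degree bound.
  monomial-expansion : ∀ f {N} → degreeBound f ≤ N →
    SQ.∑-compositions N (λ α → coeff f (parts α) *Q M α) Q.≈ᴹ f
  monomial-expansion f {N} b≤N w = begin
    coeff (SQ.∑-compositions N (λ α → coeff f (parts α) *Q M α)) w
      ≈⟨ ∑-compositions-homo (coeffₗ w) N _ ⟩
    S𝟙.∑-compositions N (λ α → coeff f (parts α) R.* coeff (M α) w)
      ≈⟨ single ⟩
    coeff f w ∎
    where
    open ≈-Reasoning R.setoid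
    α = w ʳᵉᵈ
    at-α : coeff f (parts α) R.* coeff (M α) w R.≈ coeff f w
    at-α = R.trans (R.*-congˡ (R.reflexive (coeff-M-≡ w ≡.refl)))
      (R.trans (R.*-identityʳ _) (quasisymmetric f (parts α) w (parts-ʳᵉᵈ α)))
    single : S𝟙.∑-compositions N (λ α → coeff f (parts α) R.* coeff (M α) w) R.≈ coeff f w
    single with sum w ℕ.<? N
    ... | yes w<N = R.trans
      (S𝟙.∑-compositions-single α (≡.subst (_< N) (≡.sym (sum-ʳᵉᵈ w)) w<N)
        (λ β β≢α → R.trans (R.*-congˡ (R.reflexive (coeff-M-≢ w (β≢α ∘ ≡.sym)))) (R.zeroʳ _)))
      at-α
    ... | no w≮N  = R.trans
      (S𝟙.∑-compositions-zero N (λ β β<N → R.trans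
        (R.*-congˡ (R.reflexive (coeff-M-≢ w (λ w≡β → w≮N (≡.subst (_< N) (≡.trans (≡.cong size (≡.sym w≡β)) (sum-ʳᵉᵈ w)) β<N)))))
        (R.zeroʳ _)))
      (R.sym (bounded f w (ℕ.≤-trans b≤N (ℕ.≮⇒≥ w≮N))))

  QSym-ext : ∀ {P : Module R ℓ ℓ} (φ ψ : QSym →ₗ P) →
    (∀ α → Module._≈ᴹ_ P (⟦ φ ⟧ (M α)) (⟦ ψ ⟧ (M α))) → ∀ f → Module._≈ᴹ_ P (⟦ φ ⟧ f) (⟦ ψ ⟧ f)
  QSym-ext {P} φ ψ eq f = begin
    ⟦ φ ⟧ f                                            ≈⟨ φ.⟦⟧-cong (monomial-expansion f ℕ.≤-refl) ⟨
    ⟦ φ ⟧ (SQ.∑-compositions N (λ α → c α *Q M α))     ≈⟨ ∑-compositions-homo φ N _ ⟩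
    SP.∑-compositions N (λ α → ⟦ φ ⟧ (c α *Q M α))
      ≈⟨ SP.∑-compositions-cong N (λ α → P.≈ᴹ-trans (φ.*ₗ-homo _ _) (P.≈ᴹ-trans (P.*ₗ-congˡ (eq α)) (P.≈ᴹ-sym (ψ.*ₗ-homo _ _)))) ⟩
    SP.∑-compositions N (λ α → ⟦ ψ ⟧ (c α *Q M α))     ≈⟨ ∑-compositions-homo ψ N _ ⟨
    ⟦ ψ ⟧ (SQ.∑-compositions N (λ α → c α *Q M α))     ≈⟨ ψ.⟦⟧-cong (monomial-expansion f ℕ.≤-refl) ⟩
    ⟦ ψ ⟧ f                                            ∎
    where
    module P = Module P
    module SP = MoreSums P
    module φ = _→ₗ_ φ
    module ψ = _→ₗ_ ψ
    N = degreeBound f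
    c : Comp → R.Carrier
    c α = coeff f (parts α)
    open ≈-Reasoning P.≈ᴹ-setoid

  linearExtension-M : ∀ (P : Module R ℓ ℓ) φ α → Module._≈ᴹ_ P (⟦ linearExtension P φ ⟧ (M α)) (φ α)
  linearExtension-M P φ α = P.≈ᴹ-trans
    (SP.∑-compositions-single {N = ℕ.suc (size α)} α (ℕ.n<1+n (size α))
      (λ β β≢α → P.≈ᴹ-trans
        (P.*ₗ-congʳ (R.reflexive (coeff-M-≢ (parts β) (λ eq → β≢α (≡.trans (≡.sym (parts-ʳᵉᵈ β)) eq)))))
        (P.*ₗ-zeroˡ _)))
    (P.≈ᴹ-trans (P.*ₗ-congʳ (R.reflexive (coeff-M-≡ (parts α) (parts-ʳᵉᵈ α)))) (P.*ₗ-identityˡ _))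
    where
    module P = Module P
    module SP = MoreSums P

  module _ (V : Module R ℓ ℓ) where
    private
      module V = Module V
      module SV = MoreSums V
      VQ : Module R ℓ ℓ
      VQ = V ⊗ᴹ QSym
      module ST = MoreSums VQ

    coeffAt : List ℕ → V ⊗ᴹ QSym →ₗ V
    coeffAt w = lift {M = V} {N = QSym} {P = V} record
      { op = λ x f → coeff f w V.*ₗ x
      ; cong = λ eq eq′ → V.*ₗ-cong (eq′ w) eq
      ; +-homoˡ = λ x x′ f → V.*ₗ-distribˡ _ x x′
      ; +-homoʳ = λ x f g → V.*ₗ-distribʳ x _ _
      ; *-homoˡ = λ r x f → V.*ₗ-comm _ r x
      ; *-homoʳ = λ r x f → V.*ₗ-assoc r _ x
      }

    -- The expansion is claimed for all larger bounds too, so that the bounds of two summands, or of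
    -- two tensors to be compared, can be replaced by their maximum.
    tensor-expansion : (t : Tensor V QSym) →
      ∃ λ N → ∀ {N′} → N ≤ N′ → ST.∑-compositions N′ (λ α → ⟦ coeffAt (parts α) ⟧ t ⊗ M α) ≈ₜ t
    tensor-expansion 0ₜ       = 0 , λ {N′} _ → ST.∑-compositions-zero N′ (λ α _ → ⊗-zeroˡ (M α))
    tensor-expansion (x ⊗ f)  = degreeBound f , λ {N′} b≤N′ → transₜ
      (ST.∑-compositions-cong N′ (λ α → ⊗-balanced (coeff f (parts α)) x (M α)))
      (transₜ (symₜ (∑-compositions-homo (_⊗- {M = V} {N = QSym} x) N′ (λ α → coeff f (parts α) *Q M α)))
        (⊗-congˡ (monomial-expansion f b≤N′)))
    tensor-expansion (s +ₜ t) with tensor-expansion s | tensor-expansion t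
    ... | N₁ , eq₁ | N₂ , eq₂ = N₁ ⊔ N₂ , λ {N′} p → transₜ
      (ST.∑-compositions-cong N′ (λ α → ⊗-+ˡ _ _ (M α)))
      (transₜ (ST.∑-compositions-+ N′ _ _)
        (+ₜ-cong (eq₁ (ℕ.≤-trans (ℕ.m≤m⊔n N₁ N₂) p)) (eq₂ (ℕ.≤-trans (ℕ.m≤n⊔m N₁ N₂) p))))

    coeffAt-injective : ∀ s t → (∀ α → ⟦ coeffAt (parts α) ⟧ s V.≈ᴹ ⟦ coeffAt (parts α) ⟧ t) → s ≈ₜ t
    coeffAt-injective s t eq with tensor-expansion s | tensor-expansion t
    ... | N₁ , eq₁ | N₂ , eq₂ = transₜ (symₜ (eq₁ (ℕ.m≤m⊔n N₁ N₂)))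
      (transₜ (ST.∑-compositions-cong (N₁ ⊔ N₂) (λ α → ⊗-congʳ (eq α))) (eq₂ (ℕ.m≤n⊔m N₁ N₂)))

    coeffAt-⊗M-≡ : ∀ w x → ⟦ coeffAt w ⟧ (x ⊗ M (w ʳᵉᵈ)) V.≈ᴹ x
    coeffAt-⊗M-≡ w x = V.≈ᴹ-trans (V.*ₗ-congʳ (R.reflexive (coeff-M-≡ w ≡.refl))) (V.*ₗ-identityˡ x)

    coeffAt-⊗M-≢ : ∀ w x {α} → α ≢ w ʳᵉᵈ → ⟦ coeffAt w ⟧ (x ⊗ M α) V.≈ᴹ V.0ᴹ
    coeffAt-⊗M-≢ w x α≢ = V.≈ᴹ-trans (V.*ₗ-congʳ (R.reflexive (coeff-M-≢ w (α≢ ∘ ≡.sym)))) (V.*ₗ-zeroˡ x)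

  module _ (V : Module R ℓ ℓ) where
    private
      module V = Module V
      assoc⁻¹ᵛ : V ⊗ᴹ (QSym ⊗ᴹ QSym) →ₗ (V ⊗ᴹ QSym) ⊗ᴹ QSym
      assoc⁻¹ᵛ = assoc⁻¹ {M = V} {N = QSym} {P = QSym}
      assocᵛ : (V ⊗ᴹ QSym) ⊗ᴹ QSym →ₗ V ⊗ᴹ (QSym ⊗ᴹ QSym)
      assocᵛ = assoc {M = V} {N = QSym} {P = QSym}

    -- After reassociation, a coefficient in two sets of variables is an iterated coefficient in
    -- one. Injectivity then follows by using `coeffAt-injective` first over `V ⊗ QSym` and then
    -- over `V`.
    coeffAt₂ : List ℕ → List ℕ → V ⊗ᴹ (QSym ⊗ᴹ QSym) →ₗ V
    coeffAt₂ u v = coeffAt V u ∘ₗ coeffAt (V ⊗ᴹ QSym) v ∘ₗ assoc⁻¹ᵛ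

    private
      assoc-assoc⁻¹ : ∀ t → ⟦ assocᵛ ∘ₗ assoc⁻¹ᵛ ⟧ t ≈ₜ t
      assoc-assoc⁻¹ = ⊗-ext {V = V} {W = QSym ⊗ᴹ QSym} (assocᵛ ∘ₗ assoc⁻¹ᵛ) (idₗ {M = V ⊗ᴹ (QSym ⊗ᴹ QSym)})
        (λ x → ⊗-ext {V = QSym} {W = QSym}
          (assocᵛ ∘ₗ assoc⁻¹ᵛ ∘ₗ (_⊗- {M = V} {N = QSym ⊗ᴹ QSym} x)) (_⊗- {M = V} {N = QSym ⊗ᴹ QSym} x)
          (λ f g → reflₜ))

    coeffAt₂-injective : ∀ s t →
      (∀ α β → ⟦ coeffAt₂ (parts α) (parts β) ⟧ s V.≈ᴹ ⟦ coeffAt₂ (parts α) (parts β) ⟧ t) → s ≈ₜ t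
    coeffAt₂-injective s t eq = transₜ (symₜ (assoc-assoc⁻¹ s))
      (transₜ (_→ₗ_.⟦⟧-cong assocᵛ
        (coeffAt-injective (V ⊗ᴹ QSym) (⟦ assoc⁻¹ᵛ ⟧ s) (⟦ assoc⁻¹ᵛ ⟧ t) (λ β →
          coeffAt-injective V _ _ (λ α → eq α β))))
        (assoc-assoc⁻¹ t))

    coeffAt₂-assoc : ∀ u v t → ⟦ coeffAt₂ u v ⟧ (⟦ assocᵛ ⟧ t) V.≈ᴹ ⟦ coeffAt V u ⟧ (⟦ coeffAt (V ⊗ᴹ QSym) v ⟧ t)
    coeffAt₂-assoc u v = ⊗-ext {V = V ⊗ᴹ QSym} {W = QSym}
      (coeffAt₂ u v ∘ₗ assocᵛ) (coeffAt V u ∘ₗ coeffAt (V ⊗ᴹ QSym) v)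
      (λ s g → ⊗-ext {V = V} {W = QSym}
        (coeffAt₂ u v ∘ₗ assocᵛ ∘ₗ (-⊗_ {M = V ⊗ᴹ QSym} {N = QSym} g))
        (coeffAt V u ∘ₗ coeffAt (V ⊗ᴹ QSym) v ∘ₗ (-⊗_ {M = V ⊗ᴹ QSym} {N = QSym} g))
        (λ x f → V.≈ᴹ-refl) s)

  coeff₂ : List ℕ → List ℕ → QSym ⊗ᴹ QSym →ₗ 𝟙ᴿ
  coeff₂ u v = lift {M = QSym} {N = QSym} {P = 𝟙ᴿ} record
    { op = λ f g → coeff f u R.* coeff g v
    ; cong = λ eq eq′ → R.*-cong (eq u) (eq′ v)
    ; +-homoˡ = λ _ _ _ → R.distribʳ _ _ _
    ; +-homoʳ = λ _ _ _ → R.distribˡ _ _ _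
    ; *-homoˡ = λ _ _ _ → R.*-assoc _ _ _
    ; *-homoʳ = λ r f g → Module.*ₗ-comm 𝟙ᴿ (coeff f u) r (coeff g v)
    }

  -- Splits off the factor in `V`, which reduces claims about `id ⊗ Δ` and `id ⊗ ΔP′` to claims
  -- about scalars.
  coeffAt₂-⊗ : ∀ (V : Module R ℓ ℓ) u v x s →
    Module._≈ᴹ_ V (⟦ coeffAt₂ V u v ⟧ (x ⊗ s)) (Module._*ₗ_ V (⟦ coeff₂ u v ⟧ s) x)
  coeffAt₂-⊗ V u v x = ⊗-ext {V = QSym} {W = QSym} {P = V}
    (coeffAt₂ V u v ∘ₗ (_⊗- {M = V} {N = QSym ⊗ᴹ QSym} x))
    (mkLinear {M = 𝟙ᴿ} {N = V} (λ r → r V.*ₗ x) V.*ₗ-congʳ (V.*ₗ-distribʳ x) (λ r s → V.*ₗ-assoc r s x) ∘ₗ coeff₂ u v)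
    (λ f g → V.≈ᴹ-trans (V.*ₗ-comm _ _ x) (V.≈ᴹ-trans (V.≈ᴹ-sym (V.*ₗ-assoc _ _ x)) (V.*ₗ-congʳ (R.*-comm _ _)) ) )
    where module V = Module V

-- Convolution

module GradedModules {ℓ} {R : CommutativeRing ℓ ℓ} {V : Module R ℓ ℓ} (𝓥 : Grading V) where
  open Module V
  open Grading 𝓥
  open MoreSums V

  π-same : ∀ {n x} → x ∈ piece n → ⟦ π n ⟧ x ≈ᴹ x
  π-same {n} {x} x∈ = ≈ᴹ-trans
    -- The range is extended to include `n`, which `bound x` need not exceed.
    (≈ᴹ-sym (∑<-single (ℕ.m≤n⊔m (bound x) (ℕ.suc n)) (λ m m≢n → π-other x∈ m≢n)))
    (≈ᴹ-trans (∑<-stable (part-vanishes x) (ℕ.m≤m⊔n (bound x) (ℕ.suc n))) (part-sum x))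

  graded-ext : ∀ {P : Module R ℓ ℓ} (f g : V →ₗ P) →
    (∀ {n x} → x ∈ piece n → Module._≈ᴹ_ P (⟦ f ⟧ x) (⟦ g ⟧ x)) → ∀ x → Module._≈ᴹ_ P (⟦ f ⟧ x) (⟦ g ⟧ x)
  graded-ext {P} f g eq x = begin
    ⟦ f ⟧ x                                    ≈⟨ f.⟦⟧-cong (part-sum x) ⟨
    ⟦ f ⟧ (∑< V (bound x) (λ n → part n x))    ≈⟨ ∑<-homo f (bound x) _ ⟩
    ∑< P (bound x) (λ n → ⟦ f ⟧ (part n x))    ≈⟨ Sums.∑<-cong P (bound x) (λ n → eq (part-∈ n x)) ⟩
    ∑< P (bound x) (λ n → ⟦ g ⟧ (part n x))    ≈⟨ ∑<-homo g (bound x) _ ⟨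
    ⟦ g ⟧ (∑< V (bound x) (λ n → part n x))    ≈⟨ g.⟦⟧-cong (part-sum x) ⟩
    ⟦ g ⟧ x                                    ∎
    where
    open ≈-Reasoning (Module.≈ᴹ-setoid P)
    module f = _→ₗ_ f
    module g = _→ₗ_ g

module ConvolutionOfAlgebras {ℓ} {R : CommutativeRing ℓ ℓ} (A : RawAlgebra R)
  (Δ : RawAlgebra.⟨_⟩ A →ₗ RawAlgebra.⟨_⟩ A ⊗ᴹ RawAlgebra.⟨_⟩ A)
  (Δ-algebra : IsAlgebraHomomorphism A (A ⊗ᴬ A) Δ) where
  private
    module A = RawAlgebra A
    V : Module R ℓ ℓ
    V = A.⟨_⟩
    VV : Module R ℓ ℓ
    VV = V ⊗ᴹ V
  open Module V using (_≈ᴹ_; ≈ᴹ-refl; ≈ᴹ-trans; ≈ᴹ-setoid)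
  open MoreSums V
  open ≈-Reasoning ≈ᴹ-setoid

  infixl 7 _·_
  _·_ : ∣ V ∣ → ∣ V ∣ → ∣ V ∣
  x · y = ⟦ A.mul ⟧ (x ⊗ y)

  ∑-·-∑ : ∀ {a b} {I : Set a} {J : Set b} (is : List I) (js : List J) (f : I → ∣ V ∣) (g : J → ∣ V ∣) →
    ∑ V is f · ∑ V js g ≈ᴹ ∑ V is (λ i → ∑ V js (λ j → f i · g j))
  ∑-·-∑ is js f g = ≈ᴹ-trans
    (∑-homo (A.mul ∘ₗ (-⊗_ {M = V} {N = V} (∑ V js g))) is f)
    (∑-cong is (λ i → ∑-homo (A.mul ∘ₗ (_⊗- {M = V} {N = V} (f i))) js g))

  infixr 7 _⋆_

  _⋆_ : (f g : V →ₗ V) → V →ₗ V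
  f ⋆ g = A.mul ∘ₗ (f ⊗₁ g) ∘ₗ Δ

  -- Since `Δ` is multiplicative, `f` and `g` are evaluated on products of tensor components of
  -- `Δ x` and `Δ y`. The interchange law then sorts the resulting factors into those from `x` and
  -- those from `y`.
  ⋆-mul : (∀ a b c d → (a · b) · (c · d) ≈ᴹ (a · c) · (b · d)) →
    ∀ {a b} {I : Set a} {J : Set b} (is : List I) (js : List J) (f g : V →ₗ V)
    (f₁ f₂ : I → V →ₗ V) (g₁ g₂ : J → V →ₗ V) →
    (∀ x y → ⟦ f ⟧ (x · y) ≈ᴹ ∑ V is (λ i → ⟦ f₁ i ⟧ x · ⟦ f₂ i ⟧ y)) →
    (∀ x y → ⟦ g ⟧ (x · y) ≈ᴹ ∑ V js (λ j → ⟦ g₁ j ⟧ x · ⟦ g₂ j ⟧ y)) →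
    ∀ x y → ⟦ f ⋆ g ⟧ (x · y) ≈ᴹ ∑ V is (λ i → ∑ V js (λ j → ⟦ f₁ i ⋆ g₁ j ⟧ x · ⟦ f₂ i ⋆ g₂ j ⟧ y))
  ⋆-mul ·-interchange is js f g f₁ f₂ g₁ g₂ f-mul g-mul x y = begin
    ⟦ f ⋆ g ⟧ (x · y)
      ≈⟨ _→ₗ_.⟦⟧-cong (A.mul ∘ₗ (f ⊗₁ g)) (IsAlgebraHomomorphism.mul-homo Δ-algebra x y) ⟩
    ⟦ lhs ⟧ (⟦ Δ ⟧ x ⊗ ⟦ Δ ⟧ y)
      ≈⟨ ⊗-ext₂ {V = V} {W = V} {X = V} {Y = V} lhs rhs pure (⟦ Δ ⟧ x) (⟦ Δ ⟧ y) ⟩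
    ⟦ rhs ⟧ (⟦ Δ ⟧ x ⊗ ⟦ Δ ⟧ y) ∎
    where
    lhs : VV ⊗ᴹ VV →ₗ V
    lhs = A.mul ∘ₗ (f ⊗₁ g) ∘ₗ RawAlgebra.mul (A ⊗ᴬ A)
    rhs : VV ⊗ᴹ VV →ₗ V
    rhs = ∑ₗ {V = VV ⊗ᴹ VV} {W = V} is (λ i → ∑ₗ {V = VV ⊗ᴹ VV} {W = V} js (λ j →
      A.mul ∘ₗ ((A.mul ∘ₗ (f₁ i ⊗₁ g₁ j)) ⊗₁ (A.mul ∘ₗ (f₂ i ⊗₁ g₂ j)))))
    pure : ∀ a b c d → ⟦ f ⟧ (a · c) · ⟦ g ⟧ (b · d) ≈ᴹ
      ∑ V is (λ i → ∑ V js (λ j → (⟦ f₁ i ⟧ a · ⟦ g₁ j ⟧ b) · (⟦ f₂ i ⟧ c · ⟦ g₂ j ⟧ d)))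
    pure a b c d = ≈ᴹ-trans (_→ₗ_.⟦⟧-cong A.mul (⊗-cong (f-mul a c) (g-mul b d))) (≈ᴹ-trans (∑-·-∑ is js _ _)
      (∑-cong is (λ i → ∑-cong js (λ j → ·-interchange _ _ _ _))))

module Convolution {ℓ} {R : CommutativeRing ℓ ℓ} (H : CommutativeGradedHopfAlgebra R) where
  open Bernstein H
  open MoreSums ⟨H⟩ hiding (∑<-zero)
  open GradedModules H.grading public
  private
    module R = CommutativeRing R
    HH : Module R ℓ ℓ
    HH = ⟨H⟩ ⊗ᴹ ⟨H⟩
  open ≈-Reasoning H.setoid

  infix 4 _≗ₗ_

  _≗ₗ_ : (f g : ⟨H⟩ →ₗ ⟨H⟩) → Set ℓ
  f ≗ₗ g = ∀ x → ⟦ f ⟧ x H.≈ ⟦ g ⟧ x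

  infixr 7 _⋆_

  _⋆_ : (f g : ⟨H⟩ →ₗ ⟨H⟩) → ⟨H⟩ →ₗ ⟨H⟩
  f ⋆ g = H.mul ∘ₗ (f ⊗₁ g) ∘ₗ H.Δ

  uε : ⟨H⟩ →ₗ ⟨H⟩
  uε = H.unitₗ ∘ₗ H.ε

  ⊗₁-cong : ∀ (f f′ g g′ : ⟨H⟩ →ₗ ⟨H⟩) → f ≗ₗ f′ → g ≗ₗ g′ → ∀ t → ⟦ f ⊗₁ g ⟧ t ≈ₜ ⟦ f′ ⊗₁ g′ ⟧ t
  ⊗₁-cong f f′ g g′ f≈ g≈ = ⊗-ext {V = ⟨H⟩} {W = ⟨H⟩} (f ⊗₁ g) (f′ ⊗₁ g′) (λ x y → ⊗-cong (f≈ x) (g≈ y))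

  ⋆-cong : ∀ (f f′ g g′ : ⟨H⟩ →ₗ ⟨H⟩) → f ≗ₗ f′ → g ≗ₗ g′ → f ⋆ g ≗ₗ f′ ⋆ g′
  ⋆-cong f f′ g g′ f≈ g≈ x = _→ₗ_.⟦⟧-cong H.mul (⊗₁-cong f f′ g g′ f≈ g≈ (⟦ H.Δ ⟧ x))

  module C = IsCoalgebra H.isCoalgebra

  ⋆-identityˡ : ∀ f → uε ⋆ f ≗ₗ f
  ⋆-identityˡ f x = H.trans
    (⊗-ext {V = ⟨H⟩} {W = ⟨H⟩} (H.mul ∘ₗ (uε ⊗₁ f)) (f ∘ₗ unitorˡ {M = ⟨H⟩} ∘ₗ (H.ε ⊗₁ idₗ {M = ⟨H⟩}))
      (λ a b → H.sym (_→ₗ_.*ₗ-homo f _ b)) (⟦ H.Δ ⟧ x))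
    (_→ₗ_.⟦⟧-cong f (C.counitˡ x))

  ⋆-identityʳ : ∀ f → f ⋆ uε ≗ₗ f
  ⋆-identityʳ f x = H.trans
    (⊗-ext {V = ⟨H⟩} {W = ⟨H⟩} (H.mul ∘ₗ (f ⊗₁ uε)) (f ∘ₗ unitorʳ {M = ⟨H⟩} ∘ₗ (idₗ {M = ⟨H⟩} ⊗₁ H.ε))
      (λ a b → H.trans (H.*-comm _ _) (H.sym (_→ₗ_.*ₗ-homo f _ a))) (⟦ H.Δ ⟧ x))
    (_→ₗ_.⟦⟧-cong f (C.counitʳ x))

  ⋆-assoc : ∀ f g h → (f ⋆ g) ⋆ h ≗ₗ f ⋆ (g ⋆ h)
  ⋆-assoc f g h x = begin
    ⟦ (f ⋆ g) ⋆ h ⟧ x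
      ≈⟨ ⊗-ext {V = ⟨H⟩} {W = ⟨H⟩} (H.mul ∘ₗ ((f ⋆ g) ⊗₁ h)) (m₃ ∘ₗ assocᴴ ∘ₗ (H.Δ ⊗₁ idₗ {M = ⟨H⟩})) left (⟦ H.Δ ⟧ x) ⟩
    ⟦ m₃ ⟧ (⟦ assocᴴ ⟧ (⟦ H.Δ ⊗₁ idₗ {M = ⟨H⟩} ⟧ (⟦ H.Δ ⟧ x)))
      ≈⟨ _→ₗ_.⟦⟧-cong m₃ (C.coassoc x) ⟩
    ⟦ m₃ ⟧ (⟦ idₗ {M = ⟨H⟩} ⊗₁ H.Δ ⟧ (⟦ H.Δ ⟧ x))
      ≈⟨ ⊗-ext {V = ⟨H⟩} {W = ⟨H⟩} (m₃ ∘ₗ (idₗ {M = ⟨H⟩} ⊗₁ H.Δ)) (H.mul ∘ₗ (f ⊗₁ (g ⋆ h))) (λ a b → H.refl) (⟦ H.Δ ⟧ x) ⟩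
    ⟦ f ⋆ (g ⋆ h) ⟧ x ∎
    where
    assocᴴ : (⟨H⟩ ⊗ᴹ ⟨H⟩) ⊗ᴹ ⟨H⟩ →ₗ ⟨H⟩ ⊗ᴹ (⟨H⟩ ⊗ᴹ ⟨H⟩)
    assocᴴ = assoc {M = ⟨H⟩} {N = ⟨H⟩} {P = ⟨H⟩}
    m₃ : ⟨H⟩ ⊗ᴹ (⟨H⟩ ⊗ᴹ ⟨H⟩) →ₗ ⟨H⟩
    m₃ = H.mul ∘ₗ (f ⊗₁ (H.mul ∘ₗ (g ⊗₁ h)))
    left : ∀ a b → ⟦ f ⋆ g ⟧ a H.* ⟦ h ⟧ b H.≈ ⟦ m₃ ⟧ (⟦ assocᴴ ⟧ (⟦ H.Δ ⟧ a ⊗ b))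
    left a b = ⊗-ext {V = ⟨H⟩} {W = ⟨H⟩}
      (H.mul ∘ₗ (-⊗_ {M = ⟨H⟩} {N = ⟨H⟩} (⟦ h ⟧ b)) ∘ₗ H.mul ∘ₗ (f ⊗₁ g))
      (m₃ ∘ₗ assocᴴ ∘ₗ (-⊗_ {M = HH} {N = ⟨H⟩} b))
      (λ c d → H.*-assoc _ _ _) (⟦ H.Δ ⟧ a)

  ⋆-comm : Cocommutative H.rawCoalgebra → ∀ f g → f ⋆ g ≗ₗ g ⋆ f
  ⋆-comm cocomm f g x = H.trans
    (_→ₗ_.⟦⟧-cong H.mul (_→ₗ_.⟦⟧-cong (f ⊗₁ g) (symₜ (cocomm x))))
    (⊗-ext {V = ⟨H⟩} {W = ⟨H⟩} (H.mul ∘ₗ (f ⊗₁ g) ∘ₗ swap {M = ⟨H⟩} {N = ⟨H⟩}) (H.mul ∘ₗ (g ⊗₁ f))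
      (λ a b → H.*-comm _ _) (⟦ H.Δ ⟧ x))

  ⋆-zeroˡ : ∀ {f} g → (∀ x → ⟦ f ⟧ x H.≈ H.0#) → ∀ x → ⟦ f ⋆ g ⟧ x H.≈ H.0#
  -- The sum over the empty list serves as the zero map.
  ⋆-zeroˡ {f} g f≈0 x = ⊗-ext {V = ⟨H⟩} {W = ⟨H⟩} (H.mul ∘ₗ (f ⊗₁ g)) (∑ₗ {A = ℕ} {V = HH} {W = ⟨H⟩} [] (λ _ → H.mul))
    (λ a b → H.trans (H.*-congʳ (f≈0 a)) (H.zeroˡ _)) (⟦ H.Δ ⟧ x)

  *-interchange : ∀ a b c d → (a H.* b) H.* (c H.* d) H.≈ (a H.* c) H.* (b H.* d)
  *-interchange a b c d = begin
    (a H.* b) H.* (c H.* d)   ≈⟨ H.*-assoc a b _ ⟩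
    a H.* (b H.* (c H.* d))   ≈⟨ H.*-congˡ (H.*-assoc b c d) ⟨
    a H.* ((b H.* c) H.* d)   ≈⟨ H.*-congˡ (H.*-congʳ (H.*-comm b c)) ⟩
    a H.* ((c H.* b) H.* d)   ≈⟨ H.*-congˡ (H.*-assoc c b d) ⟩
    a H.* (c H.* (b H.* d))   ≈⟨ H.*-assoc a c _ ⟨
    (a H.* c) H.* (b H.* d)   ∎

  -- Both sides are bilinear, so `x` and `y` may be taken homogeneous of degrees `k` and `l`. Then
  -- `(k , l)` is the only pair that can contribute, and it is listed exactly when `k + l` is `n`.
  π-mul : ∀ n x y → ⟦ H.π n ⟧ (x H.* y) H.≈ ∑ ⟨H⟩ (antidiagonal n) (λ (i , j) → ⟦ H.π i ⟧ x H.* ⟦ H.π j ⟧ y)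
  π-mul n x y = graded-ext
    (H.π n ∘ₗ H.mul ∘ₗ (-⊗_ {M = ⟨H⟩} {N = ⟨H⟩} y))
    (∑ₗ {V = ⟨H⟩} {W = ⟨H⟩} (antidiagonal n) (λ (i , j) → H.mul ∘ₗ (-⊗_ {M = ⟨H⟩} {N = ⟨H⟩} (⟦ H.π j ⟧ y)) ∘ₗ H.π i))
    (λ {k} {x} x∈ → graded-ext
      (H.π n ∘ₗ H.mul ∘ₗ (_⊗- {M = ⟨H⟩} {N = ⟨H⟩} x))
      (∑ₗ {V = ⟨H⟩} {W = ⟨H⟩} (antidiagonal n) (λ (i , j) → H.mul ∘ₗ (_⊗- {M = ⟨H⟩} {N = ⟨H⟩} (⟦ H.π i ⟧ x)) ∘ₗ H.π j))
      (λ {l} {y} y∈ → homogeneous k l x∈ y∈) y) x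
    where
    homogeneous : ∀ k l {x y} → x ∈ H.piece k → y ∈ H.piece l →
      ⟦ H.π n ⟧ (x H.* y) H.≈ ∑ ⟨H⟩ (antidiagonal n) (λ (i , j) → ⟦ H.π i ⟧ x H.* ⟦ H.π j ⟧ y)
    homogeneous k l {x} {y} x∈ y∈ = case-sum (k ℕ.+ l ℕ.≟ n)
      where
      other : ∀ i j → (i , j) ≢ (k , l) → ⟦ H.π i ⟧ x H.* ⟦ H.π j ⟧ y H.≈ H.0#
      other i j ≢kl with i ℕ.≟ k
      ... | no i≢k     = H.trans (H.*-congʳ (H.π-other x∈ i≢k)) (H.zeroˡ _)
      ... | yes ≡.refl = H.trans (H.*-congˡ (H.π-other y∈ (λ { ≡.refl → ≢kl ≡.refl }))) (H.zeroʳ _)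
      case-sum : Dec (k ℕ.+ l ≡ n) →
        ⟦ H.π n ⟧ (x H.* y) H.≈ ∑ ⟨H⟩ (antidiagonal n) (λ (i , j) → ⟦ H.π i ⟧ x H.* ⟦ H.π j ⟧ y)
      case-sum (yes ≡.refl) = H.trans (π-same (H.*-graded x∈ y∈)) (H.sym (H.trans
        (∑-single (antidiagonal-unique n) (∈-antidiagonal k l) (λ (i , j) → other i j))
        (H.*-cong (π-same x∈) (π-same y∈))))
      case-sum (no k+l≢n)   = H.trans (H.π-other (H.*-graded x∈ y∈) (k+l≢n ∘ ≡.sym)) (H.sym
        (∑-zero (All.map (λ { {i , j} i+j≡n → other i j (λ { ≡.refl → k+l≢n i+j≡n }) }) (antidiagonal-sum n))))

  Ξ : List ℕ → ⟨H⟩ →ₗ ⟨H⟩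
  Ξ []      = uε
  Ξ (n ∷ w) = H.π n ⋆ Ξ w

  Ξ-++ : ∀ u v → Ξ (u ++ v) ≗ₗ Ξ u ⋆ Ξ v
  Ξ-++ []      v x = H.sym (⋆-identityˡ (Ξ v) x)
  Ξ-++ (n ∷ u) v x = H.trans (⋆-cong (H.π n) (H.π n) (Ξ (u ++ v)) (Ξ u ⋆ Ξ v) (λ _ → H.refl) (Ξ-++ u v) x) (H.sym (⋆-assoc (H.π n) (Ξ u) (Ξ v) x))

  Ξ-mul : ∀ w x y → ⟦ Ξ w ⟧ (x H.* y) H.≈ ∑ ⟨H⟩ (splittings w) (λ (u , v) → ⟦ Ξ u ⟧ x H.* ⟦ Ξ v ⟧ y)
  Ξ-mul []      x y = H.trans (H.⟦⟧-cong (IsAlgebraHomomorphism.mul-homo H.ε-algebra x y))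
    (H.trans (H.*-homo _ _) (H.sym (H.+-identityʳ _)))
  Ξ-mul (n ∷ w) x y = H.trans
    (ConvolutionOfAlgebras.⋆-mul _ _ H.Δ-algebra *-interchange (antidiagonal n) (splittings w) (H.π n) (Ξ w) (H.π ∘ proj₁) (H.π ∘ proj₂) (Ξ ∘ proj₁) (Ξ ∘ proj₂)
      (π-mul n) (Ξ-mul w) x y)
    (H.sym (∑-cartesianProductWith _ (antidiagonal n) (splittings w) _))

  -- Both are right-nested convolutions of projections. The recursion for `ξ` stops at one part and
  -- that for `Ξ` at the empty word, which costs one counit law.
  ξ-Ξ : ∀ α → ξ α ≗ₗ Ξ (parts α)
  ξ-Ξ []          x = H.refl
  ξ-Ξ (a ∷ [])    x = H.sym (⋆-identityʳ (H.π (toℕ a)) x)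
  ξ-Ξ (a ∷ b ∷ α) x = ⊗-ext {V = ⟨H⟩} {W = ⟨H⟩}
    (H.mul ∘ₗ (idₗ {M = ⟨H⟩} ⊗₁ m^ k) ∘ₗ (H.π (toℕ a) ⊗₁ π^ (b ∷ α)) ∘ₗ (idₗ {M = ⟨H⟩} ⊗₁ Δ^ k))
    (H.mul ∘ₗ (H.π (toℕ a) ⊗₁ Ξ (parts (b ∷ α))))
    (λ y z → H.*-congˡ (ξ-Ξ (b ∷ α) z)) (⟦ H.Δ ⟧ x)
    where
    k : ℕ
    k = ℕ.suc (List.length α)

  Ξ-↭ : Cocommutative H.rawCoalgebra → ∀ {u v} → u ↭ v → Ξ u ≗ₗ Ξ v
  Ξ-↭ cocomm ↭.refl         x = H.refl
  Ξ-↭ cocomm (↭.prep {u} {v} n p)   x = ⋆-cong (H.π n) (H.π n) (Ξ u) (Ξ v) (λ _ → H.refl) (Ξ-↭ cocomm p) x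
  Ξ-↭ cocomm (↭.swap {u} {v} m n p) x = begin
    ⟦ H.π m ⋆ (H.π n ⋆ Ξ u) ⟧ x   ≈⟨ ⋆-assoc (H.π m) (H.π n) (Ξ u) x ⟨
    ⟦ (H.π m ⋆ H.π n) ⋆ Ξ u ⟧ x   ≈⟨ ⋆-cong (H.π m ⋆ H.π n) (H.π n ⋆ H.π m) (Ξ u) (Ξ v) (⋆-comm cocomm (H.π m) (H.π n)) (Ξ-↭ cocomm p) x ⟩
    ⟦ (H.π n ⋆ H.π m) ⋆ Ξ v ⟧ x   ≈⟨ ⋆-assoc (H.π n) (H.π m) (Ξ v) x ⟩
    ⟦ H.π n ⋆ (H.π m ⋆ Ξ v) ⟧ x   ∎
  Ξ-↭ cocomm (↭.trans p q)  x = H.trans (Ξ-↭ cocomm p x) (Ξ-↭ cocomm q x)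

  module _ (connected : H.Connected) where

    -- Both maps vanish in positive degree. In degree 0, connectedness makes `ε` injective, and `ε`
    -- takes the same value on `x` and on `uε x`.
    π-0 : H.π 0 ≗ₗ uε
    π-0 = graded-ext (H.π 0) uε λ {n} {x} x∈ → case-degree n x∈ (n ℕ.≟ 0)
      where
      case-degree : ∀ n {x} → x ∈ H.piece n → Dec (n ≡ 0) → ⟦ H.π 0 ⟧ x H.≈ ⟦ uε ⟧ x
      case-degree n {x} x∈ (no n≢0)   = H.trans (H.π-other x∈ (n≢0 ∘ ≡.sym))
        (H.sym (H.trans (H.⟦⟧-cong (H.ε-graded x∈ n≢0)) H.0#-homo))
      case-degree n {x} x∈ (yes ≡.refl) = H.trans (π-same x∈) (proj₁ connected
        {x , x∈} {⟦ uε ⟧ x , Submodule.resp (H.piece 0) (H.*-identityʳ _) (Submodule.*-closed (H.piece 0) (⟦ H.ε ⟧ x) H.1-graded)}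
        (R.sym (R.trans (_→ₗ_.⟦⟧-cong H.ε (H.sym (H.*-identityʳ _)))
          (R.trans (_→ₗ_.*ₗ-homo H.ε (⟦ H.ε ⟧ x) H.1#)
            (R.trans (R.*-congˡ (IsAlgebraHomomorphism.one-homo H.ε-algebra)) (R.*-identityʳ _))))))

    Ξ-ʳᵉᵈ : ∀ w → Ξ w ≗ₗ Ξ (parts (w ʳᵉᵈ))
    Ξ-ʳᵉᵈ []            x = H.refl
    Ξ-ʳᵉᵈ (zero ∷ w)    x = H.trans (⋆-cong (H.π 0) uε (Ξ w) (Ξ w) π-0 (λ _ → H.refl) x)
      (H.trans (⋆-identityˡ (Ξ w) x) (Ξ-ʳᵉᵈ w x))
    Ξ-ʳᵉᵈ (ℕ.suc n ∷ w) x = ⋆-cong (H.π (ℕ.suc n)) (H.π (ℕ.suc n)) (Ξ w) (Ξ (parts (w ʳᵉᵈ))) (λ _ → H.refl) (Ξ-ʳᵉᵈ w) x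

    Ξ-kills : ∀ w {n h} → h ∈ H.piece n → sum w ≢ n → ⟦ Ξ w ⟧ h H.≈ H.0#
    Ξ-kills w {h = h} h∈ w≢n = H.trans (Ξ-ʳᵉᵈ w h) (H.trans (H.sym (ξ-Ξ (w ʳᵉᵈ) h))
      (ξ-kills (w ʳᵉᵈ) h∈ (λ eq → w≢n (≡.trans (≡.sym (sum-ʳᵉᵈ w)) eq))))

    -- `Ξ w` vanishes outside degree `sum w`, so projecting to that degree beforehand changes
    -- nothing.
    Ξ-π-same : ∀ w → Ξ w ∘ₗ H.π (sum w) ≗ₗ Ξ w
    Ξ-π-same w = graded-ext (Ξ w ∘ₗ H.π (sum w)) (Ξ w) (λ {m} h∈ → case-degree m h∈ (sum w ℕ.≟ m))
      where
      case-degree : ∀ m {h} → h ∈ H.piece m → Dec (sum w ≡ m) → ⟦ Ξ w ⟧ (⟦ H.π (sum w) ⟧ h) H.≈ ⟦ Ξ w ⟧ h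
      case-degree m h∈ (yes ≡.refl) = _→ₗ_.⟦⟧-cong (Ξ w) (π-same h∈)
      case-degree m h∈ (no w≢m)     = H.trans (_→ₗ_.⟦⟧-cong (Ξ w) (H.π-other h∈ w≢m))
        (H.trans (_→ₗ_.0ᴹ-homo (Ξ w)) (H.sym (Ξ-kills w h∈ w≢m)))

    Ξ-π-other : ∀ w {n} → sum w ≢ n → ∀ h → ⟦ Ξ w ⟧ (⟦ H.π n ⟧ h) H.≈ H.0#
    Ξ-π-other w {n} w≢n h = Ξ-kills w (H.part-∈ n h) w≢n

-- Comparison of lifted bilinear maps, and extension of scalars

module _ {ℓ} {R : CommutativeRing ℓ ℓ} where

  lift-agree : ∀ {M N P : Module R ℓ ℓ} (b b′ : Bilinear M N P) →
    (∀ x y → Module._≈ᴹ_ P (Bilinear.op b x y) (Bilinear.op b′ x y)) →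
    ∀ {t t′} → t ≈ₜ t′ → Module._≈ᴹ_ P (⟦ lift b ⟧ t) (⟦ lift b′ ⟧ t′)
  lift-agree {M} {N} {P} b b′ agree {t} eq = Module.≈ᴹ-trans P (⊗-ext {V = M} {W = N} (lift b) (lift b′) agree t)
    (_→ₗ_.⟦⟧-cong (lift b′) eq)

  opˡ : ∀ {M N P : Module R ℓ ℓ} (b : Bilinear M N P) → ∣ N ∣ → M →ₗ P
  opˡ {M} {N} {P} b y = mkLinear {M = M} {N = P} (λ x → Bilinear.op b x y) (λ eq → Bilinear.cong b eq (Module.≈ᴹ-refl N))
    (λ x x′ → Bilinear.+-homoˡ b x x′ y) (λ r x → Bilinear.*-homoˡ b r x y)

  opʳ : ∀ {M N P : Module R ℓ ℓ} (b : Bilinear M N P) → ∣ M ∣ → N →ₗ P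
  opʳ {M} {N} {P} b x = mkLinear {M = N} {N = P} (Bilinear.op b x) (λ eq → Bilinear.cong b (Module.≈ᴹ-refl M) eq)
    (λ y y′ → Bilinear.+-homoʳ b x y y′) (λ r y → Bilinear.*-homoʳ b r x y)

module _ {ℓ} {R : CommutativeRing ℓ ℓ} (A : CommutativeAlgebra R) where
  private module A = CommutativeAlgebra A

  restrictₗ : ∀ {G G′ : Module A.commutativeRing ℓ ℓ} → G →ₗ G′ → restrict A G →ₗ restrict A G′
  restrictₗ {G} {G′} f = mkLinear {M = restrict A G} {N = restrict A G′} ⟦ f ⟧ (_→ₗ_.⟦⟧-cong f) (_→ₗ_.+ᴹ-homo f)
    (λ r x → _→ₗ_.*ₗ-homo f (A.unit r) x)

  -- `extend A C` has the same additive group as `A ⊗ C`, so after restriction of scalars this is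
  -- extensionality over `R`.
  extend-ext : ∀ {C : Module R ℓ ℓ} {G : Module A.commutativeRing ℓ ℓ} (f g : extend A C →ₗ G) →
    (∀ a c → Module._≈ᴹ_ G (⟦ f ⟧ (a ⊗ c)) (⟦ g ⟧ (a ⊗ c))) → ∀ t → Module._≈ᴹ_ G (⟦ f ⟧ t) (⟦ g ⟧ t)
  extend-ext {C} {G} f g = ⊗-ext {V = A.⟨_⟩} {W = C} {P = restrict A G}
    (restrictₗ f ∘ₗ ⊗⇒extend A C) (restrictₗ g ∘ₗ ⊗⇒extend A C)

  module _ {C D : Module R ℓ ℓ} where
    private
      P : Module A.commutativeRing ℓ ℓ
      P = extend A D ⊗ᴹ extend A D
      module P = Module P

    -- Agda infers the bᵢ and bᵢ′ from stuck applications of lift. In this way, a goal involving the bᵢ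
    -- is compared with a fact involving the bᵢ′ only on pure tensors, where unfolding is cheap.
    Δ-homo-transfer :
      {b₀ b₀′ : Bilinear A.⟨_⟩ C (restrict A (extend A D))}
      {b₂ b₂′ : Bilinear A.⟨_⟩ D (A.⟨_⟩ ⊗ᴹ (D ⊗ᴹ D))}
      {b₁ b₁′ : Bilinear A.⟨_⟩ (D ⊗ᴹ D) (restrict A (extend A D ⊗ᴹ extend A D))}
      {b₅ b₅′ : Bilinear A.⟨_⟩ C (A.⟨_⟩ ⊗ᴹ (C ⊗ᴹ C))}
      {b₄ b₄′ : Bilinear A.⟨_⟩ (C ⊗ᴹ C) (restrict A (extend A C ⊗ᴹ extend A C))}
      {b₃ b₃′ : Bilinear (extend A C) (extend A C) (extend A D ⊗ᴹ extend A D)}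
      (x : Tensor A.⟨_⟩ C) →
      _≈ₜ_ {M = extend A D} {N = extend A D} (⟦ lift b₁′ ⟧ (⟦ lift b₂′ ⟧ (⟦ lift b₀′ ⟧ x))) (⟦ lift b₃′ ⟧ (⟦ lift b₄′ ⟧ (⟦ lift b₅′ ⟧ x))) →
      (∀ a c → Bilinear.op b₀ a c ≈ₜ Bilinear.op b₀′ a c) →
      (∀ a d → Bilinear.op b₂ a d ≈ₜ Bilinear.op b₂′ a d) →
      (∀ a d d′ → _≈ₜ_ {M = extend A D} {N = extend A D} (Bilinear.op b₁ a (d ⊗ d′)) (Bilinear.op b₁′ a (d ⊗ d′))) →
      (∀ a c → Bilinear.op b₅ a c ≈ₜ Bilinear.op b₅′ a c) →
      (∀ a c c′ → _≈ₜ_ {M = extend A C} {N = extend A C} (Bilinear.op b₄ a (c ⊗ c′)) (Bilinear.op b₄′ a (c ⊗ c′))) →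
      (∀ a c a′ c′ → _≈ₜ_ {M = extend A D} {N = extend A D} (Bilinear.op b₃ (a ⊗ c) (a′ ⊗ c′)) (Bilinear.op b₃′ (a ⊗ c) (a′ ⊗ c′))) →
      _≈ₜ_ {M = extend A D} {N = extend A D} (⟦ lift b₁ ⟧ (⟦ lift b₂ ⟧ (⟦ lift b₀ ⟧ x))) (⟦ lift b₃ ⟧ (⟦ lift b₄ ⟧ (⟦ lift b₅ ⟧ x)))
    Δ-homo-transfer {b₀} {b₀′} {b₂} {b₂′} {b₁} {b₁′} {b₅} {b₅′} {b₄} {b₄′} {b₃} {b₃′} x eq agree₀ agree₂ agree₁ agree₅ agree₄ agree₃ =
      transₜ (lift-agree b₁ b₁′ (λ a → ⊗-ext {V = D} {W = D} (opʳ b₁ a) (opʳ b₁′ a) (agree₁ a))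
               (lift-agree b₂ b₂′ agree₂ (lift-agree b₀ b₀′ agree₀ {t = x} reflₜ)))
      (transₜ eq (symₜ (lift-agree b₃ b₃′
        (λ s t → extend-ext (opˡ b₃ t) (opˡ b₃′ t) (λ a c → extend-ext (opʳ b₃ (a ⊗ c)) (opʳ b₃′ (a ⊗ c)) (agree₃ a c) t) s)
        (lift-agree b₄ b₄′ (λ a → ⊗-ext {V = C} {W = C} (opʳ b₄ a) (opʳ b₄′ a) (agree₄ a))
          (lift-agree b₅ b₅′ agree₅ {t = x} reflₜ)))))

-- Relative coalgebra homomorphisms

module RelativeCoalgebras {ℓ} {R : CommutativeRing ℓ ℓ} (A : CommutativeAlgebra R) where
  private
    module A = CommutativeAlgebra A

  module _ (D : Module R ℓ ℓ) (m : (A.⟨_⟩ ⊗ᴹ D) ⊗ᴹ (A.⟨_⟩ ⊗ᴹ D) →ₗ A.⟨_⟩ ⊗ᴹ (D ⊗ᴹ D))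
    (m-pure : ∀ a d b d′ → ⟦ m ⟧ ((a ⊗ d) ⊗ (b ⊗ d′)) ≈ₜ (a A.* b) ⊗ (d ⊗ d′)) where
    private
      P : Module A.commutativeRing ℓ ℓ
      P = extend A D ⊗ᴹ extend A D

    -- The canonical projection from the tensor product over `R` to the one over `A`.
    ⊗-over : (A.⟨_⟩ ⊗ᴹ D) ⊗ᴹ (A.⟨_⟩ ⊗ᴹ D) →ₗ restrict A P
    ⊗-over = lift {M = A.⟨_⟩ ⊗ᴹ D} {N = A.⟨_⟩ ⊗ᴹ D} {P = restrict A P} record
      { op = _⊗_
      ; cong = ⊗-cong
      ; +-homoˡ = ⊗-+ˡ
      ; +-homoʳ = ⊗-+ʳ
      ; *-homoˡ = λ r s t → ⊗-congʳ (scalar r s)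
      ; *-homoʳ = λ r s t → transₜ (⊗-congˡ (scalar r t)) (symₜ (⊗-balanced (A.unit r) s t))
      }
      where
      scalar : ∀ r s → Module._*ₗ_ (A.⟨_⟩ ⊗ᴹ D) r s ≈ₜ Module._*ₗ_ (extend A D) (A.unit r) s
      scalar r 0ₜ       = reflₜ
      scalar r (a ⊗ d)  = reflₜ
      scalar r (s +ₜ t) = +ₜ-cong (scalar r s) (scalar r t)

    -- `m` collects the scalars `a` and `b` in one factor. As the target is balanced over `A`, the
    -- scalar `b` can be moved back to the second tensor factor.
    extend-⊗-m : ∀ s t → _≈ₜ_ {M = extend A D} {N = extend A D} (⟦ extend-⊗ A D D ⟧ (⟦ m ⟧ (s ⊗ t))) (s ⊗ t)
    extend-⊗-m = ∘-ext₂ {V = A.⟨_⟩} {W = D} {X = A.⟨_⟩} {Y = D} {P = restrict A P}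
      (restrictₗ A (extend-⊗ A D D) ∘ₗ ⊗⇒extend A (D ⊗ᴹ D)) m ⊗-over
      (λ a d b d′ → transₜ (_→ₗ_.⟦⟧-cong (extend-⊗ A D D) (m-pure a d b d′))
        (transₜ (⊗-congʳ (⊗-congʳ (A.trans (A.*-identityʳ _) (A.*-comm a b))))
          (transₜ (⊗-balanced b (a ⊗ d) (A.1# ⊗ d′)) (⊗-congˡ (⊗-congʳ (A.*-identityʳ b))))))

  -- The hypothesis on Δ lives in A ⊗ (D ⊗ D) instead of (A ⊗ D) ⊗_A (A ⊗ D), because for D = QSym
  -- the elements of the former are determined by their coefficients.
  isRelativeCoalgebraHomomorphism : ∀ (C D : RawCoalgebra R)
    (m : (A.⟨_⟩ ⊗ᴹ RawCoalgebra.⟨_⟩ D) ⊗ᴹ (A.⟨_⟩ ⊗ᴹ RawCoalgebra.⟨_⟩ D) →ₗ A.⟨_⟩ ⊗ᴹ (RawCoalgebra.⟨_⟩ D ⊗ᴹ RawCoalgebra.⟨_⟩ D)) →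
    (∀ a d b d′ → ⟦ m ⟧ ((a ⊗ d) ⊗ (b ⊗ d′)) ≈ₜ (a A.* b) ⊗ (d ⊗ d′)) →
    (φ : RawCoalgebra.⟨_⟩ C →ₗ A.⟨_⟩ ⊗ᴹ RawCoalgebra.⟨_⟩ D) →
    (∀ c → ⟦ idₗ {M = A.⟨_⟩} ⊗₁ RawCoalgebra.Δ D ⟧ (⟦ φ ⟧ c) ≈ₜ ⟦ m ⟧ (⟦ φ ⊗₁ φ ⟧ (⟦ RawCoalgebra.Δ C ⟧ c))) →
    (∀ c → ⟦ extend-𝟙 A ⟧ (⟦ idₗ {M = A.⟨_⟩} ⊗₁ RawCoalgebra.ε D ⟧ (⟦ φ ⟧ c)) A.≈ A.unit (⟦ RawCoalgebra.ε C ⟧ c)) →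
    IsRelativeCoalgebraHomomorphism A C (extendCoalgebra A D)
      (_∘ₗ_ {L = RawCoalgebra.⟨_⟩ C} {M = A.⟨_⟩ ⊗ᴹ RawCoalgebra.⟨_⟩ D} {N = restrict A (extend A (RawCoalgebra.⟨_⟩ D))}
        (⊗⇒extend A (RawCoalgebra.⟨_⟩ D)) φ)
  isRelativeCoalgebraHomomorphism C D m m-pure φ φ-Δ φ-ε = record
    { Δ-homo = extend-ext A {C = C.⟨_⟩} {G = P} (D′.Δ ∘ₗ f♯) ((f♯ ⊗₁ f♯) ∘ₗ C′.Δ) (λ a c → begin
        ⟦ D′.Δ ⟧ (Module._*ₗ_ (extend A D.⟨_⟩) a (⟦ φ ⟧ c))
          ≈⟨ _→ₗ_.*ₗ-homo D′.Δ a (⟦ φ ⟧ c) ⟩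
        a P.*ₗ ⟦ D′.Δ ⟧ (⟦ φ ⟧ c)
          ≈⟨ P.*ₗ-congˡ (_→ₗ_.⟦⟧-cong (extend-⊗ A D.⟨_⟩ D.⟨_⟩) (φ-Δ c)) ⟩
        a P.*ₗ ⟦ extend-⊗ A D.⟨_⟩ D.⟨_⟩ ⟧ (⟦ m ⟧ (⟦ φ ⊗₁ φ ⟧ (⟦ C.Δ ⟧ c)))
          -- For fixed `a` both sides are linear in `Δ c`, which may thus be replaced by a pure
          -- tensor.
          ≈⟨ ⊗-ext {V = C.⟨_⟩} {W = C.⟨_⟩} {P = restrict A P} (lhs a) (rhs a) (pure a) (⟦ C.Δ ⟧ c) ⟩
        ⟦ f♯ ⊗₁ f♯ ⟧ (⟦ C′.Δ ⟧ (a ⊗ c)) ∎)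
    ; ε-homo = extend-ext A {C = C.⟨_⟩} {G = 𝟙} (D′.ε ∘ₗ f♯) C′.ε (λ a c → A.trans
        (_→ₗ_.*ₗ-homo D′.ε a (⟦ φ ⟧ c)) (A.*-congˡ (φ-ε c)))
    }
    where
    module C = RawCoalgebra C
    module D = RawCoalgebra D
    C′ D′ : RawCoalgebra A.commutativeRing
    C′ = extendCoalgebra A C
    D′ = extendCoalgebra A D
    module C′ = RawCoalgebra C′
    module D′ = RawCoalgebra D′
    P : Module A.commutativeRing ℓ ℓ
    P = extend A D.⟨_⟩ ⊗ᴹ extend A D.⟨_⟩
    module P = Module P
    open ≈-Reasoning P.≈ᴹ-setoid
    f♯ : extend A C.⟨_⟩ →ₗ extend A D.⟨_⟩
    f♯ = _♯ A {C = C.⟨_⟩} {G = extend A D.⟨_⟩} (_∘ₗ_ {L = C.⟨_⟩} {M = A.⟨_⟩ ⊗ᴹ D.⟨_⟩} {N = restrict A (extend A D.⟨_⟩)}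
      (⊗⇒extend A D.⟨_⟩) φ)
    scale : A.Carrier → restrict A P →ₗ restrict A P
    scale a = mkLinear {M = restrict A P} {N = restrict A P} (a P.*ₗ_) P.*ₗ-congˡ (P.*ₗ-distribˡ a) (λ r x → P.*ₗ-comm a (A.unit r) x)
    lhs rhs : A.Carrier → C.⟨_⟩ ⊗ᴹ C.⟨_⟩ →ₗ restrict A P
    lhs a = scale a ∘ₗ restrictₗ A (extend-⊗ A D.⟨_⟩ D.⟨_⟩) ∘ₗ ⊗⇒extend A (D.⟨_⟩ ⊗ᴹ D.⟨_⟩) ∘ₗ m ∘ₗ (φ ⊗₁ φ)
    rhs a = restrictₗ A (f♯ ⊗₁ f♯) ∘ₗ restrictₗ A (extend-⊗ A C.⟨_⟩ C.⟨_⟩) ∘ₗ ⊗⇒extend A (C.⟨_⟩ ⊗ᴹ C.⟨_⟩)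
      ∘ₗ _⊗- {M = A.⟨_⟩} {N = C.⟨_⟩ ⊗ᴹ C.⟨_⟩} a
    pure : ∀ a c c′ → ⟦ lhs a ⟧ (c ⊗ c′) P.≈ᴹ ⟦ rhs a ⟧ (c ⊗ c′)
    pure a c c′ = begin
      a P.*ₗ ⟦ extend-⊗ A D.⟨_⟩ D.⟨_⟩ ⟧ (⟦ m ⟧ (⟦ φ ⟧ c ⊗ ⟦ φ ⟧ c′))
        ≈⟨ P.*ₗ-congˡ (extend-⊗-m D.⟨_⟩ m m-pure (⟦ φ ⟧ c) (⟦ φ ⟧ c′)) ⟩
      (Module._*ₗ_ (extend A D.⟨_⟩) a (⟦ φ ⟧ c)) ⊗ ⟦ φ ⟧ c′
        -- The factors 1 come from `extend-⊗`, which sends `a ⊗ (c ⊗ c′)` to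
        -- `a ((1 ⊗ c) ⊗ (1 ⊗ c′))`.
        ≈⟨ ⊗-cong (E.*ₗ-congʳ (A.*-identityʳ a)) (E.*ₗ-identityˡ (⟦ φ ⟧ c′)) ⟨
      (Module._*ₗ_ (extend A D.⟨_⟩) (a A.* A.1#) (⟦ φ ⟧ c)) ⊗ (Module._*ₗ_ (extend A D.⟨_⟩) A.1# (⟦ φ ⟧ c′)) ∎
      where module E = Module (extend A D.⟨_⟩)

  -- For the counit of `QSym` the map `g` is the coefficient at the empty word, so the counit
  -- condition on `β` becomes a statement about `Ξ []`.
  extend-𝟙-unique : ∀ {D : Module R ℓ ℓ} (e : D →ₗ 𝟙) (g : A.⟨_⟩ ⊗ᴹ D →ₗ A.⟨_⟩) →
    (∀ a d → ⟦ g ⟧ (a ⊗ d) A.≈ A.unit (⟦ e ⟧ d) A.* a) →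
    ∀ t → ⟦ extend-𝟙 A ⟧ (⟦ idₗ {M = A.⟨_⟩} ⊗₁ e ⟧ t) A.≈ ⟦ g ⟧ t
  extend-𝟙-unique e g g-pure 0ₜ       = A.sym (_→ₗ_.0ᴹ-homo g)
  extend-𝟙-unique e g g-pure (a ⊗ d)  = A.trans (A.*-comm a _) (A.sym (g-pure a d))
  extend-𝟙-unique e g g-pure (s +ₜ t) = A.trans
    (A.+-cong (extend-𝟙-unique e g g-pure s) (extend-𝟙-unique e g g-pure t)) (A.sym (_→ₗ_.+ᴹ-homo g s t))

-- Coefficients of products, coproducts and the evaluation `εP`

deconcatenations-++ : ∀ γ → All (λ (α , β) → α ++ β ≡ γ) (deconcatenations γ)
deconcatenations-++ []      = ≡.refl ∷ []
deconcatenations-++ (c ∷ γ) = ≡.refl ∷ All.map⁺ (All.map (≡.cong (c ∷_)) (deconcatenations-++ γ))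

∈-deconcatenations : ∀ α β → (α , β) ∈ˡ deconcatenations (α ++ β)
∈-deconcatenations []      []      = here ≡.refl
∈-deconcatenations []      (b ∷ β) = here ≡.refl
∈-deconcatenations (a ∷ α) β       = there (∈-map⁺ (map₁ (a ∷_)) (∈-deconcatenations α β))

deconcatenations-unique : ∀ γ → Unique (deconcatenations γ)
deconcatenations-unique []      = [] ∷ []
deconcatenations-unique (c ∷ γ) = All.map⁺ (All.universal (λ _ ()) (deconcatenations γ)) ∷
  Unique.map⁺ (λ { ≡.refl → ≡.refl }) (deconcatenations-unique γ)

module AlgebraCoefficients {ℓ} (R : CommutativeRing ℓ ℓ) where
  open QuasisymmetricFunctions R
  open Coefficients R
  private
    module R = CommutativeRing R
    module S𝟙 = MoreSums 𝟙ᴿ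

  -- By linearity it suffices to take `f = M γ`. The pair `(α , β)` occurs once among the
  -- deconcatenations of `γ` if `γ` is `α ++ β`, and not at all otherwise.
  coeff₂-Δ : ∀ α β f →
    ⟦ coeff₂ (parts α) (parts β) ⟧ (⟦ RawCoalgebra.Δ QSym-rawCoalgebra ⟧ f) R.≈ coeff f (parts (α ++ β))
  coeff₂-Δ α β = QSym-ext (c₂ ∘ₗ RawCoalgebra.Δ QSym-rawCoalgebra) (coeffₗ (parts (α ++ β))) λ γ → R.trans
      (_→ₗ_.⟦⟧-cong c₂ (linearExtension-M (QSym ⊗ᴹ QSym) _ γ))
      (R.trans (∑-homo c₂ (deconcatenations γ) _) (at γ (α ++ β ≟ᶜ γ)))
    where
    c₂ : QSym ⊗ᴹ QSym →ₗ 𝟙ᴿ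
    c₂ = coeff₂ (parts α) (parts β)
    other : ∀ μ ν → (μ , ν) ≢ (α , β) → coeff (M μ) (parts α) R.* coeff (M ν) (parts β) R.≈ R.0#
    other μ ν ≢αβ with μ ≟ᶜ α
    ... | no μ≢α = R.trans
      (R.*-congʳ (R.reflexive (coeff-M-≢ (parts α) (λ eq → μ≢α (≡.trans (≡.sym eq) (parts-ʳᵉᵈ α)))))) (R.zeroˡ _)
    ... | yes ≡.refl = R.trans
      (R.*-congˡ (R.reflexive (coeff-M-≢ (parts β)
        (λ eq → ≢αβ (≡.cong (α ,_) (≡.trans (≡.sym eq) (parts-ʳᵉᵈ β))))))) (R.zeroʳ _)
    at : ∀ γ → Dec (α ++ β ≡ γ) →
      ∑ 𝟙ᴿ (deconcatenations γ) (λ (μ , ν) → coeff (M μ) (parts α) R.* coeff (M ν) (parts β)) R.≈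
      coeff (M γ) (parts (α ++ β))
    at γ (yes ≡.refl) = begin
      ∑ 𝟙ᴿ (deconcatenations γ) (λ (μ , ν) → coeff (M μ) (parts α) R.* coeff (M ν) (parts β))
        ≈⟨ S𝟙.∑-single (deconcatenations-unique γ) (∈-deconcatenations α β) (λ (μ , ν) → other μ ν) ⟩
      coeff (M α) (parts α) R.* coeff (M β) (parts β)
        ≈⟨ R.*-cong (R.reflexive (coeff-M-≡ (parts α) (parts-ʳᵉᵈ α))) (R.reflexive (coeff-M-≡ (parts β) (parts-ʳᵉᵈ β))) ⟩
      R.1# R.* R.1#                  ≈⟨ R.*-identityˡ R.1# ⟩
      R.1#                           ≡⟨ coeff-M-≡ (parts γ) (parts-ʳᵉᵈ γ) ⟨
      coeff (M γ) (parts γ)          ∎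
      where open ≈-Reasoning R.setoid
    at γ (no ≢γ) = R.trans
      (S𝟙.∑-zero (All.map (λ { {μ , ν} eq → other μ ν (λ { ≡.refl → ≢γ eq }) }) (deconcatenations-++ γ)))
      (R.sym (R.reflexive (coeff-M-≢ (parts (α ++ β)) (λ eq → ≢γ (≡.trans (≡.sym (parts-ʳᵉᵈ (α ++ β))) eq)))))

  coeffAt₂-Δ : ∀ (V : Module R ℓ ℓ) α β t → Module._≈ᴹ_ V
    (⟦ coeffAt₂ V (parts α) (parts β) ⟧ (⟦ idₗ {M = V} ⊗₁ RawCoalgebra.Δ QSym-rawCoalgebra ⟧ t))
    (⟦ coeffAt V (parts (α ++ β)) ⟧ t)
  coeffAt₂-Δ V α β = ⊗-ext {V = V} {W = QSym}
    (coeffAt₂ V (parts α) (parts β) ∘ₗ (idₗ {M = V} ⊗₁ RawCoalgebra.Δ QSym-rawCoalgebra))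
    (coeffAt V (parts (α ++ β)))
    (λ x f → V.≈ᴹ-trans (coeffAt₂-⊗ V (parts α) (parts β) x (⟦ RawCoalgebra.Δ QSym-rawCoalgebra ⟧ f))
      (V.*ₗ-congʳ (coeff₂-Δ α β f)))
    where module V = Module V

  εP-expansion : ∀ (V : Module R ℓ ℓ) (t : Tensor V QSym) → ∃ λ N → ∀ {N′} → N ≤ N′ → Module._≈ᴹ_ V
    (⟦ unitorʳ {M = V} ⟧ (⟦ idₗ {M = V} ⊗₁ εP ⟧ t)) (∑< V N′ (λ n → ⟦ coeffAt V (n ∷ []) ⟧ t))
  εP-expansion V 0ₜ = 0 , λ {N′} _ → V.≈ᴹ-sym (MoreSums.∑<-zero V N′ (λ _ _ → V.≈ᴹ-refl))
    where module V = Module V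
  εP-expansion V (x ⊗ f) = degreeBound f , λ {N′} p → V.≈ᴹ-trans
    (∑<-homo (mkLinear {M = 𝟙ᴿ} {N = V} (λ r → r V.*ₗ x) V.*ₗ-congʳ (V.*ₗ-distribʳ x) (λ r s → V.*ₗ-assoc r s x))
      (degreeBound f) (λ n → coeff f (n ∷ [])))
    (V.≈ᴹ-sym (MoreSums.∑<-stable V (λ n b≤n → V.≈ᴹ-trans
      (V.*ₗ-congʳ (bounded f (n ∷ []) (ℕ.≤-trans b≤n (ℕ.≤-reflexive (≡.sym (ℕ.+-identityʳ n)))))) (V.*ₗ-zeroˡ x)) p))
    where module V = Module V
  εP-expansion V (s +ₜ t) with εP-expansion V s | εP-expansion V t
  ... | N₁ , eq₁ | N₂ , eq₂ = N₁ ⊔ N₂ , λ {N′} p → V.≈ᴹ-trans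
    (V.+ᴹ-cong (eq₁ (ℕ.≤-trans (ℕ.m≤m⊔n N₁ N₂) p)) (eq₂ (ℕ.≤-trans (ℕ.m≤n⊔m N₁ N₂) p)))
    (V.≈ᴹ-sym (Sums.∑<-+ V N′ _ _))
    where module V = Module V

  module _ (V : Module R ℓ ℓ) (n : ℕ) where
    private
      module V = Module V
      -- `M α` as an element of the degree `n` piece. The default `0Q` stands in for the other
      -- sizes, where the coefficient of a homogeneous tensor is zero.
      M′ : Comp → ∣ submodule (QSymPiece n) ∣
      M′ α with size α ℕ.≟ n
      ... | yes α≡n = M α , λ w w≢n → R.reflexive (coeff-M-≢ w (λ eq →
              w≢n (≡.trans (≡.sym (sum-ʳᵉᵈ w)) (≡.trans (≡.cong size eq) α≡n))))
      ... | no  _   = 0Q , λ _ _ → R.refl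

    homogeneous-tensor : ∀ t → (∀ α → size α ≢ n → ⟦ coeffAt V (parts α) ⟧ t V.≈ᴹ V.0ᴹ) →
      _∈id⊗_ {M = V} {N = QSym} t (QSymPiece n)
    homogeneous-tensor t c≈0 with tensor-expansion V t
    ... | N , eq = MoreSums.∑-compositions (V ⊗ᴹ submodule (QSymPiece n)) N (λ α → ⟦ coeffAt V (parts α) ⟧ t ⊗ M′ α) ,
      transₜ (∑-compositions-homo (idₗ {M = V} ⊗₁ inclusion (QSymPiece n)) N _)
        (transₜ (MoreSums.∑-compositions-cong (V ⊗ᴹ QSym) N term) (eq ℕ.≤-refl))
      where
      term : ∀ α → _≈ₜ_ {M = V} {N = QSym} (⟦ coeffAt V (parts α) ⟧ t ⊗ proj₁ (M′ α)) (⟦ coeffAt V (parts α) ⟧ t ⊗ M α)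
      term α with size α ℕ.≟ n
      ... | yes α≡n = reflₜ
      ... | no  α≢n = transₜ (⊗-congʳ (c≈0 α α≢n)) (transₜ (⊗-zeroˡ _)
              (symₜ (transₜ (⊗-congʳ (c≈0 α α≢n)) (⊗-zeroˡ _))))

  module _ (V : Module R ℓ ℓ) (mul : V ⊗ᴹ V →ₗ V) where
    private
      module V = Module V
      open MoreSums V
      infixl 7 _·_
      _·_ : ∣ V ∣ → ∣ V ∣ → ∣ V ∣
      x · y = ⟦ mul ⟧ (x ⊗ y)
      ·-*ₗ : ∀ r s x y → (r V.*ₗ x) · (s V.*ₗ y) V.≈ᴹ (r R.* s) V.*ₗ (x · y)
      ·-*ₗ r s x y = V.≈ᴹ-trans (_→ₗ_.*ₗ-homo (mul ∘ₗ (-⊗_ {M = V} {N = V} (s V.*ₗ y))) r x)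
        (V.≈ᴹ-trans (V.*ₗ-congˡ (_→ₗ_.*ₗ-homo (mul ∘ₗ (_⊗- {M = V} {N = V} x)) s y)) (V.≈ᴹ-sym (V.*ₗ-assoc r s _)))

    module _ (m : (V ⊗ᴹ QSym) ⊗ᴹ (V ⊗ᴹ QSym) →ₗ V ⊗ᴹ QSym)
      (m-pure : ∀ a f b g → ⟦ m ⟧ ((a ⊗ f) ⊗ (b ⊗ g)) ≈ₜ ⟦ mul ⟧ (a ⊗ b) ⊗ (f ·Q g)) where

      -- On pure tensors this is the definition of the Cauchy product, with the scalars moved out of
      -- `mul`.
      coeffAt-mul : ∀ w s t → ⟦ coeffAt V w ⟧ (⟦ m ⟧ (s ⊗ t)) V.≈ᴹ
        ∑ V (splittings w) (λ (u , v) → ⟦ coeffAt V u ⟧ s · ⟦ coeffAt V v ⟧ t)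
      coeffAt-mul w = ∘-ext₂ {V = V} {W = QSym} {X = V} {Y = QSym} (coeffAt V w) m
        (∑ₗ {V = (V ⊗ᴹ QSym) ⊗ᴹ (V ⊗ᴹ QSym)} {W = V} (splittings w) (λ (u , v) → mul ∘ₗ (coeffAt V u ⊗₁ coeffAt V v)))
        (λ a f b g → V.≈ᴹ-trans (_→ₗ_.⟦⟧-cong (coeffAt V w) (m-pure a f b g)) (V.≈ᴹ-trans
          (∑-homo (mkLinear {M = 𝟙ᴿ} {N = V} (λ r → r V.*ₗ (a · b)) V.*ₗ-congʳ (V.*ₗ-distribʳ _) (λ r s → V.*ₗ-assoc r s _))
            (splittings w) (λ (u , v) → coeff f u R.* coeff g v))
          (∑-cong (splittings w) (λ (u , v) → V.≈ᴹ-sym (·-*ₗ _ _ a b)))))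

      isAlgebraHomomorphism : ∀ (A : RawAlgebra R) (f : RawAlgebra.⟨_⟩ A →ₗ V ⊗ᴹ QSym) (e : Tensor V QSym)
        (Φ : List ℕ → ∣ RawAlgebra.⟨_⟩ A ∣ → ∣ V ∣) →
        (∀ w x → ⟦ coeffAt V w ⟧ (⟦ f ⟧ x) V.≈ᴹ Φ w x) →
        (∀ w x y → Φ w (⟦ RawAlgebra.mul A ⟧ (x ⊗ y)) V.≈ᴹ ∑ V (splittings w) (λ (u , v) → Φ u x · Φ v y)) →
        (∀ α → Φ (parts α) (RawAlgebra.one A) V.≈ᴹ ⟦ coeffAt V (parts α) ⟧ e) →
        IsAlgebraHomomorphism A (record { ⟨_⟩ = V ⊗ᴹ QSym ; mul = m ; one = e }) f
      isAlgebraHomomorphism A f e Φ f-Φ Φ-mul Φ-one = record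
        { mul-homo = λ x y → coeffAt-injective V _ _ (λ α → begin
            ⟦ coeffAt V (parts α) ⟧ (⟦ f ⟧ (⟦ RawAlgebra.mul A ⟧ (x ⊗ y)))
              ≈⟨ f-Φ (parts α) _ ⟩
            Φ (parts α) (⟦ RawAlgebra.mul A ⟧ (x ⊗ y))
              ≈⟨ Φ-mul (parts α) x y ⟩
            ∑ V (splittings (parts α)) (λ (u , v) → Φ u x · Φ v y)
              ≈⟨ ∑-cong (splittings (parts α)) (λ (u , v) → _→ₗ_.⟦⟧-cong mul (⊗-cong (f-Φ u x) (f-Φ v y))) ⟨
            ∑ V (splittings (parts α)) (λ (u , v) → ⟦ coeffAt V u ⟧ (⟦ f ⟧ x) · ⟦ coeffAt V v ⟧ (⟦ f ⟧ y))
              ≈⟨ coeffAt-mul (parts α) (⟦ f ⟧ x) (⟦ f ⟧ y) ⟨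
            ⟦ coeffAt V (parts α) ⟧ (⟦ m ⟧ (⟦ f ⟧ x ⊗ ⟦ f ⟧ y)) ∎)
        ; one-homo = coeffAt-injective V _ _ (λ α → V.≈ᴹ-trans (f-Φ (parts α) _) (Φ-one α))
        }
        where open ≈-Reasoning V.≈ᴹ-setoid

    module _ (m : (V ⊗ᴹ QSym) ⊗ᴹ (V ⊗ᴹ QSym) →ₗ V ⊗ᴹ (QSym ⊗ᴹ QSym))
      (m-pure : ∀ a f b g → ⟦ m ⟧ ((a ⊗ f) ⊗ (b ⊗ g)) ≈ₜ ⟦ mul ⟧ (a ⊗ b) ⊗ (f ⊗ g)) where

      coeffAt₂-mul : ∀ u v s t → ⟦ coeffAt₂ V u v ⟧ (⟦ m ⟧ (s ⊗ t)) V.≈ᴹ ⟦ coeffAt V u ⟧ s · ⟦ coeffAt V v ⟧ t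
      coeffAt₂-mul u v = ∘-ext₂ {V = V} {W = QSym} {X = V} {Y = QSym} (coeffAt₂ V u v) m
        (mul ∘ₗ (coeffAt V u ⊗₁ coeffAt V v))
        (λ a f b g → V.≈ᴹ-trans (_→ₗ_.⟦⟧-cong (coeffAt₂ V u v) (m-pure a f b g))
          (V.≈ᴹ-trans (coeffAt₂-⊗ V u v (a · b) (f ⊗ g)) (V.≈ᴹ-sym (·-*ₗ _ _ a b))))

      -- The coefficient of the left side at `(α , β)` is the one of `f c` at the concatenation,
      -- while `m` multiplies the two separate coefficients. So the claim is the rule for `Ψ` on
      -- concatenated words.
      Δ-from-coefficients : ∀ {C : Module R ℓ ℓ} (ΔC : C →ₗ C ⊗ᴹ C) (f : C →ₗ V ⊗ᴹ QSym) (Ψ : List ℕ → C →ₗ V) →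
        (∀ w c → ⟦ coeffAt V w ⟧ (⟦ f ⟧ c) V.≈ᴹ ⟦ Ψ w ⟧ c) →
        (∀ u v c → ⟦ Ψ (u ++ v) ⟧ c V.≈ᴹ ⟦ mul ⟧ (⟦ Ψ u ⊗₁ Ψ v ⟧ (⟦ ΔC ⟧ c))) →
        ∀ c → ⟦ idₗ {M = V} ⊗₁ RawCoalgebra.Δ QSym-rawCoalgebra ⟧ (⟦ f ⟧ c) ≈ₜ ⟦ m ⟧ (⟦ f ⊗₁ f ⟧ (⟦ ΔC ⟧ c))
      Δ-from-coefficients {C} ΔC f Ψ f-Ψ Ψ-++ c = coeffAt₂-injective V _ _ (λ α β → begin
        ⟦ coeffAt₂ V (parts α) (parts β) ⟧ (⟦ idₗ {M = V} ⊗₁ RawCoalgebra.Δ QSym-rawCoalgebra ⟧ (⟦ f ⟧ c))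
          ≈⟨ coeffAt₂-Δ V α β (⟦ f ⟧ c) ⟩
        ⟦ coeffAt V (parts (α ++ β)) ⟧ (⟦ f ⟧ c)
          ≈⟨ f-Ψ (parts (α ++ β)) c ⟩
        ⟦ Ψ (parts (α ++ β)) ⟧ c
          ≡⟨ ≡.cong (λ w → ⟦ Ψ w ⟧ c) (map-++ toℕ α β) ⟩
        ⟦ Ψ (parts α ++ parts β) ⟧ c
          ≈⟨ Ψ-++ (parts α) (parts β) c ⟩
        ⟦ mul ⟧ (⟦ Ψ (parts α) ⊗₁ Ψ (parts β) ⟧ (⟦ ΔC ⟧ c))
          ≈⟨ ⊗-ext {V = C} {W = C} (mul ∘ₗ (Ψ (parts α) ⊗₁ Ψ (parts β))) (coeffAt₂ V (parts α) (parts β) ∘ₗ m ∘ₗ (f ⊗₁ f))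
               (pure (parts α) (parts β)) (⟦ ΔC ⟧ c) ⟩
        ⟦ coeffAt₂ V (parts α) (parts β) ⟧ (⟦ m ⟧ (⟦ f ⊗₁ f ⟧ (⟦ ΔC ⟧ c))) ∎)
        where
        open ≈-Reasoning V.≈ᴹ-setoid
        pure : ∀ u v x y → ⟦ Ψ u ⟧ x · ⟦ Ψ v ⟧ y V.≈ᴹ ⟦ coeffAt₂ V u v ⟧ (⟦ m ⟧ (⟦ f ⟧ x ⊗ ⟦ f ⟧ y))
        pure u v x y = V.≈ᴹ-sym (V.≈ᴹ-trans (coeffAt₂-mul u v (⟦ f ⟧ x) (⟦ f ⟧ y))
          (_→ₗ_.⟦⟧-cong mul (⊗-cong (f-Ψ u x) (f-Ψ v y))))

-- Composition of convolution products

module Composition {ℓ} {R : CommutativeRing ℓ ℓ} (H : CommutativeGradedHopfAlgebra R) where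
  open Bernstein H
  open Convolution H
  open MoreSums ⟨H⟩ hiding (∑<-zero)
  open ≈-Reasoning H.setoid

  Ξ-⋆ : ∀ w (f g : ⟨H⟩ →ₗ ⟨H⟩) x → ⟦ Ξ w ⟧ (⟦ f ⋆ g ⟧ x) H.≈
    ∑ ⟨H⟩ (splittings w) (λ (u , v) → ⟦ (Ξ u ∘ₗ f) ⋆ (Ξ v ∘ₗ g) ⟧ x)
  Ξ-⋆ w f g x = ⊗-ext {V = ⟨H⟩} {W = ⟨H⟩} {P = ⟨H⟩} (Ξ w ∘ₗ H.mul ∘ₗ (f ⊗₁ g))
    (∑ₗ {V = ⟨H⟩ ⊗ᴹ ⟨H⟩} {W = ⟨H⟩} (splittings w) (λ (u , v) → H.mul ∘ₗ ((Ξ u ∘ₗ f) ⊗₁ (Ξ v ∘ₗ g))))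
    (λ a b → Ξ-mul w (⟦ f ⟧ a) (⟦ g ⟧ b)) (⟦ H.Δ ⟧ x)

  ⋆-∑ : ∀ {a} {I : Set a} (f g : ⟨H⟩ →ₗ ⟨H⟩) (is : List I) (gs : I → ⟨H⟩ →ₗ ⟨H⟩) →
    (∀ x → ⟦ g ⟧ x H.≈ ∑ ⟨H⟩ is (λ i → ⟦ gs i ⟧ x)) →
    ∀ x → ⟦ f ⋆ g ⟧ x H.≈ ∑ ⟨H⟩ is (λ i → ⟦ f ⋆ gs i ⟧ x)
  ⋆-∑ f g is gs g≈ x = ⊗-ext {V = ⟨H⟩} {W = ⟨H⟩} {P = ⟨H⟩} (H.mul ∘ₗ (f ⊗₁ g))
    (∑ₗ {V = ⟨H⟩ ⊗ᴹ ⟨H⟩} {W = ⟨H⟩} is (λ i → H.mul ∘ₗ (f ⊗₁ gs i)))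
    (λ a b → H.trans (H.*-congˡ (g≈ b)) (∑-homo (H.mul ∘ₗ (_⊗- {M = ⟨H⟩} {N = ⟨H⟩} (⟦ f ⟧ a))) is (λ i → ⟦ gs i ⟧ b)))
    (⟦ H.Δ ⟧ x)

  module _ (connected : H.Connected) where

    uε-∈ : ∀ x → ⟦ uε ⟧ x ∈ H.piece 0
    uε-∈ x = Submodule.resp (H.piece 0) (H.*-identityʳ _) (Submodule.*-closed (H.piece 0) (⟦ H.ε ⟧ x) H.1-graded)

    -- A word with sum 0 consists of zeros and reduces to the empty word. Moreover `uε` is the
    -- projection to degree 0, hence idempotent.
    Ξ-uε : ∀ w → sum w ≡ 0 → ∀ x → ⟦ Ξ w ⟧ (⟦ uε ⟧ x) H.≈ ⟦ uε ⟧ x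
    Ξ-uε w w≡0 x = begin
      ⟦ Ξ w ⟧ (⟦ uε ⟧ x)                  ≈⟨ Ξ-ʳᵉᵈ connected w (⟦ uε ⟧ x) ⟩
      ⟦ Ξ (parts (w ʳᵉᵈ)) ⟧ (⟦ uε ⟧ x)    ≡⟨ ≡.cong (λ α → ⟦ Ξ (parts α) ⟧ (⟦ uε ⟧ x)) (empty w w≡0) ⟩
      ⟦ uε ⟧ (⟦ uε ⟧ x)                   ≈⟨ π-0 connected (⟦ uε ⟧ x) ⟨
      ⟦ H.π 0 ⟧ (⟦ uε ⟧ x)                ≈⟨ π-same (uε-∈ x) ⟩
      ⟦ uε ⟧ x                            ∎
      where
      empty : ∀ w → sum w ≡ 0 → w ʳᵉᵈ ≡ []
      empty []         _  = ≡.refl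
      empty (zero ∷ w) eq = empty w eq

    -- In a splitting of `u` into `r` and `s`, the word `r` becomes the first row, and degree forces
    -- its sum to be `n`. The other rows form a matrix with column sums `s` and row sums `v`.
    -- Without rows there is just the empty matrix, listed exactly when `u` is zero; otherwise the
    -- left side vanishes by degree.
    Ξ-Ξ : ∀ {p q} (u : Vec ℕ q) (v : Vec ℕ p) x → ⟦ Ξ (Vec.toList u) ⟧ (⟦ Ξ (Vec.toList v) ⟧ x) H.≈
      ∑ ⟨H⟩ (matricesWithSums u v) (λ A → ⟦ Ξ (readMatrix A) ⟧ x)
    Ξ-Ξ u [] x = case-sum (Vec.sum u ℕ.≟ 0)
      where
      case-sum : Dec (Vec.sum u ≡ 0) →
        ⟦ Ξ (Vec.toList u) ⟧ (⟦ uε ⟧ x) H.≈ ∑ ⟨H⟩ (matricesWithSums u []) (λ A → ⟦ Ξ (readMatrix A) ⟧ x)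
      case-sum (yes u≡0) = begin
        ⟦ Ξ (Vec.toList u) ⟧ (⟦ uε ⟧ x)   ≈⟨ Ξ-uε (Vec.toList u) (≡.trans (sum-toList u) u≡0) x ⟩
        ⟦ uε ⟧ x                          ≈⟨ H.+-identityʳ _ ⟨
        ⟦ uε ⟧ x H.+ H.0#
          ≡⟨ ≡.cong (λ As → ∑ ⟨H⟩ As (λ A → ⟦ Ξ (readMatrix A) ⟧ x)) (filter-all (λ _ → Vec.sum u ℕ.≟ 0) (u≡0 ∷ [])) ⟨
        ∑ ⟨H⟩ (matricesWithSums u []) (λ A → ⟦ Ξ (readMatrix A) ⟧ x) ∎
      case-sum (no u≢0) = H.trans (Ξ-kills connected (Vec.toList u) (uε-∈ x) (u≢0 ∘ ≡.trans (≡.sym (sum-toList u))))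
        (H.reflexive (≡.cong (λ As → ∑ ⟨H⟩ As (λ A → ⟦ Ξ (readMatrix A) ⟧ x)) (≡.sym (filter-none (λ _ → Vec.sum u ℕ.≟ 0) (u≢0 ∷ [])))))
    Ξ-Ξ {ℕ.suc p} {q} u (n ∷ v) x = begin
      ⟦ Ξ (Vec.toList u) ⟧ (⟦ H.π n ⋆ Ξ (Vec.toList v) ⟧ x)
        ≈⟨ Ξ-⋆ (Vec.toList u) (H.π n) (Ξ (Vec.toList v)) x ⟩
      ∑ ⟨H⟩ (splittings (Vec.toList u)) (λ (r , s) → term r s)
        ≡⟨ ≡.cong (λ rss → ∑ ⟨H⟩ rss (λ (r , s) → term r s)) (splittings-toList u) ⟩
      ∑ ⟨H⟩ (map (λ (r , s) → Vec.toList r , Vec.toList s) (splittingsᵛ u)) (λ (r , s) → term r s)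
        ≈⟨ ∑-map (λ (r , s) → Vec.toList r , Vec.toList s) (splittingsᵛ u) (λ (r , s) → term r s) ⟩
      ∑ ⟨H⟩ (splittingsᵛ u) (λ (r , s) → term (Vec.toList r) (Vec.toList s))
        ≈⟨ ∑-cong (splittingsᵛ u) (λ (r , s) → case-sum r s (Vec.sum r ℕ.≟ n)) ⟩
      ∑ ⟨H⟩ (splittingsᵛ u) (λ (r , s) → if does (Vec.sum r ℕ.≟ n) then withRow r s else H.0#)
        ≈⟨ ∑-filter (λ (r , _) → Vec.sum r ℕ.≟ n) (splittingsᵛ u) (λ (r , s) → withRow r s) ⟨
      ∑ ⟨H⟩ (filter (λ (r , _) → Vec.sum r ℕ.≟ n) (splittingsᵛ u)) (λ (r , s) → withRow r s)
        ≈⟨ ∑-cong (filter (λ (r , _) → Vec.sum r ℕ.≟ n) (splittingsᵛ u)) (λ (r , s) →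
             ∑-map (r ∷_) (matricesWithSums s v) (λ A → ⟦ Ξ (readMatrix A) ⟧ x)) ⟨
      ∑ ⟨H⟩ (filter (λ (r , _) → Vec.sum r ℕ.≟ n) (splittingsᵛ u)) (λ (r , s) →
        ∑ ⟨H⟩ (map (r ∷_) (matricesWithSums s v)) (λ A → ⟦ Ξ (readMatrix A) ⟧ x))
        ≈⟨ ∑-concatMap (λ (r , s) → map (r ∷_) (matricesWithSums s v)) (filter (λ (r , _) → Vec.sum r ℕ.≟ n) (splittingsᵛ u))
             (λ A → ⟦ Ξ (readMatrix A) ⟧ x) ⟨
      ∑ ⟨H⟩ (matricesWithSums u (n ∷ v)) (λ A → ⟦ Ξ (readMatrix A) ⟧ x) ∎
      where
      term : List ℕ → List ℕ → H.Carrier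
      term r s = ⟦ (Ξ r ∘ₗ H.π n) ⋆ (Ξ s ∘ₗ Ξ (Vec.toList v)) ⟧ x
      withRow : Vec ℕ q → Vec ℕ q → H.Carrier
      withRow r s = ∑ ⟨H⟩ (matricesWithSums s v) (λ A → ⟦ Ξ (readMatrix (r ∷ A)) ⟧ x)
      -- The decision is an argument so that the conditional reduces in each clause.
      case-sum : ∀ r s (r≟n : Dec (Vec.sum r ≡ n)) →
        term (Vec.toList r) (Vec.toList s) H.≈ (if does r≟n then withRow r s else H.0#)
      case-sum r s (yes ≡.refl) = begin
        term (Vec.toList r) (Vec.toList s)
          ≈⟨ ⋆-cong (Ξ (Vec.toList r) ∘ₗ H.π n) (Ξ (Vec.toList r)) (Ξ (Vec.toList s) ∘ₗ Ξ (Vec.toList v)) (Ξ (Vec.toList s) ∘ₗ Ξ (Vec.toList v))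
               (λ y → H.trans (H.reflexive (≡.cong (λ k → ⟦ Ξ (Vec.toList r) ⟧ (⟦ H.π k ⟧ y)) (≡.sym (sum-toList r))))
                 (Ξ-π-same connected (Vec.toList r) y))
               (λ _ → H.refl) x ⟩
        ⟦ Ξ (Vec.toList r) ⋆ (Ξ (Vec.toList s) ∘ₗ Ξ (Vec.toList v)) ⟧ x
          ≈⟨ ⋆-∑ (Ξ (Vec.toList r)) (Ξ (Vec.toList s) ∘ₗ Ξ (Vec.toList v)) (matricesWithSums s v) (λ A → Ξ (readMatrix A)) (Ξ-Ξ s v) x ⟩
        ∑ ⟨H⟩ (matricesWithSums s v) (λ A → ⟦ Ξ (Vec.toList r) ⋆ Ξ (readMatrix A) ⟧ x)
          ≈⟨ ∑-cong (matricesWithSums s v) (λ A → Ξ-++ (Vec.toList r) (readMatrix A) x) ⟨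
        ∑ ⟨H⟩ (matricesWithSums s v) (λ A → ⟦ Ξ (Vec.toList r ++ readMatrix A) ⟧ x)
          ≈⟨ ∑-cong (matricesWithSums s v) (λ A → H.reflexive (≡.cong (λ w → ⟦ Ξ w ⟧ x) (≡.sym (readMatrix-∷ r A)))) ⟩
        withRow r s ∎
      case-sum r s (no r≢n) = ⋆-zeroˡ {Ξ (Vec.toList r) ∘ₗ H.π n} (Ξ (Vec.toList s) ∘ₗ Ξ (Vec.toList v))
        (Ξ-π-other connected (Vec.toList r) (r≢n ∘ ≡.trans (≡.sym (sum-toList r)))) x

-- Sorted representatives of compositions

sort-cong : ∀ {u v} → u ↭ v → sort u ≡ sort v
sort-cong {u} {v} u↭v = Pointwise-≡⇒≡ (↗↭↗⇒≋ ℕ.≤-totalOrder (sort-↗ u) (sort-↗ v)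
  (↭.↭⇒↭ₛ (↭.trans (sort-↭ u) (↭.trans u↭v (↭.↭-sym (sort-↭ v))))))

ʳᵉᵈ-↭ : ∀ {u v} → u ↭ v → u ʳᵉᵈ ↭ v ʳᵉᵈ
ʳᵉᵈ-↭ ↭.refl                             = ↭.refl
ʳᵉᵈ-↭ (↭.prep zero p)                    = ʳᵉᵈ-↭ p
ʳᵉᵈ-↭ (↭.prep (suc x) p)                 = ↭.prep (1+ x) (ʳᵉᵈ-↭ p)
ʳᵉᵈ-↭ (↭.swap zero zero p)               = ʳᵉᵈ-↭ p
ʳᵉᵈ-↭ (↭.swap zero (suc y) p)            = ↭.prep (1+ y) (ʳᵉᵈ-↭ p)
ʳᵉᵈ-↭ (↭.swap (suc x) zero p)            = ↭.prep (1+ x) (ʳᵉᵈ-↭ p)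
ʳᵉᵈ-↭ (↭.swap (suc x) (suc y) p)         = ↭.swap (1+ x) (1+ y) (ʳᵉᵈ-↭ p)
ʳᵉᵈ-↭ (↭.trans p q)                      = ↭.trans (ʳᵉᵈ-↭ p) (ʳᵉᵈ-↭ q)

-- The rearrangement of `α` with weakly increasing parts. Sorting takes place on numbers, and `ʳᵉᵈ`
-- turns the positive results back into parts.
sortᶜ : Comp → Comp
sortᶜ α = sort (parts α) ʳᵉᵈ

sortᶜ-cong : ∀ {α β} → α ↭ β → sortᶜ α ≡ sortᶜ β
sortᶜ-cong p = ≡.cong _ʳᵉᵈ (sort-cong (map⁺ toℕ p))

size-sortᶜ : ∀ α → size (sortᶜ α) ≡ size α
size-sortᶜ α = ≡.trans (sum-ʳᵉᵈ (sort (parts α))) (sum-↭ (sort-↭ (parts α)))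

-- Symmetric tensors

module SymmetricTensors {ℓ} (R : CommutativeRing ℓ ℓ) where
  open QuasisymmetricFunctions R
  open Coefficients R
  private
    module R = CommutativeRing R

  -- the monomial symmetric function if α is sorted, and zero otherwise
  m : Comp → QuasisymmetricFunction
  m α = record
    { coeff = m-coeff
    ; quasisymmetric = λ u v eq → R.reflexive (≡.cong (λ β → if does (sortᶜ β ≟ᶜ α) then R.1# else R.0#) eq)
    ; degreeBound = ℕ.suc (size α)
    ; bounded = m-bounded
    }
    where
    m-coeff : List ℕ → R.Carrier
    m-coeff w = if does (sortᶜ (w ʳᵉᵈ) ≟ᶜ α) then R.1# else R.0#
    m-bounded : ∀ w → ℕ.suc (size α) ≤ sum w → m-coeff w R.≈ R.0#
    m-bounded w p with sortᶜ (w ʳᵉᵈ) ≟ᶜ α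
    ... | yes eq = ⊥-elim (ℕ.<-irrefl
      (≡.trans (≡.sym (≡.cong size eq)) (≡.trans (size-sortᶜ (w ʳᵉᵈ)) (sum-ʳᵉᵈ w))) p)
    ... | no  _  = R.refl

  m-symmetric : ∀ α → m α ∈ Λ
  m-symmetric α u v u↭v = R.reflexive (≡.cong (λ β → if does (β ≟ᶜ α) then R.1# else R.0#) (sortᶜ-cong (ʳᵉᵈ-↭ u↭v)))

  coeff-m-≡ : ∀ {α} w → sortᶜ (w ʳᵉᵈ) ≡ α → coeff (m α) w ≡ R.1#
  coeff-m-≡ {α} w eq with sortᶜ (w ʳᵉᵈ) ≟ᶜ α
  ... | yes _ = ≡.refl
  ... | no ≢α = ⊥-elim (≢α eq)

  coeff-m-≢ : ∀ {α} w → sortᶜ (w ʳᵉᵈ) ≢ α → coeff (m α) w ≡ R.0#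
  coeff-m-≢ {α} w ≢α with sortᶜ (w ʳᵉᵈ) ≟ᶜ α
  ... | yes eq = ⊥-elim (≢α eq)
  ... | no  _  = ≡.refl

  module _ (V : Module R ℓ ℓ) where
    private
      module V = Module V
      module SV = MoreSums V
      module ST = MoreSums (V ⊗ᴹ QSym)

    coeffAt-ʳᵉᵈ : ∀ u v t → u ʳᵉᵈ ≡ v ʳᵉᵈ → ⟦ coeffAt V u ⟧ t V.≈ᴹ ⟦ coeffAt V v ⟧ t
    coeffAt-ʳᵉᵈ u v t eq = ⊗-ext {V = V} {W = QSym} (coeffAt V u) (coeffAt V v)
      (λ x f → V.*ₗ-congʳ (quasisymmetric f u v eq)) t

    -- Collecting the monomial expansion by rearrangement classes gives the sum of `c α ⊗ m α`. It
    -- may range over all compositions, since `m α` is zero for unsorted `α`.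
    symmetric-tensor : ∀ t → (∀ {u v} → u ↭ v → ⟦ coeffAt V u ⟧ t V.≈ᴹ ⟦ coeffAt V v ⟧ t) →
      _∈id⊗_ {M = V} {N = QSym} t Λ
    symmetric-tensor t sym with tensor-expansion V t
    ... | N , expansion = MoreSums.∑-compositions (V ⊗ᴹ submodule Λ) N (λ α → c α ⊗ (m α , m-symmetric α)) ,
      transₜ (∑-compositions-homo (idₗ {M = V} ⊗₁ inclusion Λ) N (λ α → c α ⊗ (m α , m-symmetric α)))
        (coeffAt-injective V _ t (λ β → V.≈ᴹ-trans
          (∑-compositions-homo (coeffAt V (parts β)) N (λ α → c α ⊗ m α)) (at β)))
      where
      c : Comp → ∣ V ∣
      c α = ⟦ coeffAt V (parts α) ⟧ t
      c-sortᶜ : ∀ β → c (sortᶜ β) V.≈ᴹ c β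
      c-sortᶜ β = V.≈ᴹ-trans
        (coeffAt-ʳᵉᵈ (parts (sortᶜ β)) (sort (parts β)) t (parts-ʳᵉᵈ (sortᶜ β)))
        (sym (sort-↭ (parts β)))
      -- Beyond the range of the expansion the coefficients of `t` must be seen to vanish, as the
      -- sum of the `c α ⊗ m α` does there.
      vanishes : ∀ β → N ≤ size β → c β V.≈ᴹ V.0ᴹ
      vanishes β N≤β = V.≈ᴹ-trans (_→ₗ_.⟦⟧-cong (coeffAt V (parts β)) (symₜ (expansion ℕ.≤-refl)))
        (V.≈ᴹ-trans (∑-compositions-homo (coeffAt V (parts β)) N (λ α → c α ⊗ M α))
          (SV.∑-compositions-zero N (λ α α<N → coeffAt-⊗M-≢ V (parts β) (c α)
            (λ α≡ → ℕ.<⇒≱ α<N (ℕ.≤-trans N≤β (ℕ.≤-reflexive (≡.cong size (≡.sym (≡.trans α≡ (parts-ʳᵉᵈ β))))))))))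
      sorted-parts : ∀ β → sortᶜ (parts β ʳᵉᵈ) ≡ sortᶜ β
      sorted-parts β = ≡.cong sortᶜ (parts-ʳᵉᵈ β)
      at : ∀ β → SV.∑-compositions N (λ α → coeff (m α) (parts β) V.*ₗ c α) V.≈ᴹ c β
      at β with size β ℕ.<? N
      ... | yes β<N = V.≈ᴹ-trans
        (SV.∑-compositions-single (sortᶜ β) (≡.subst (_< N) (≡.sym (size-sortᶜ β)) β<N)
          (λ α α≢ → V.≈ᴹ-trans
            (V.*ₗ-congʳ (R.reflexive (coeff-m-≢ (parts β) (λ eq → α≢ (≡.trans (≡.sym eq) (sorted-parts β))))))
            (V.*ₗ-zeroˡ _)))
        (V.≈ᴹ-trans (V.*ₗ-congʳ (R.reflexive (coeff-m-≡ (parts β) (sorted-parts β))))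
          (V.≈ᴹ-trans (V.*ₗ-identityˡ _) (c-sortᶜ β)))
      ... | no β≮N  = V.≈ᴹ-trans
        (SV.∑-compositions-zero N (λ α α<N → V.≈ᴹ-trans
          (V.*ₗ-congʳ (R.reflexive (coeff-m-≢ (parts β) (λ eq → β≮N (≡.subst (_< N)
            (≡.trans (≡.cong size (≡.trans (≡.sym eq) (sorted-parts β))) (size-sortᶜ β)) α<N)))))
          (V.*ₗ-zeroˡ _)))
        (V.≈ᴹ-sym (vanishes β (ℕ.≮⇒≥ β≮N)))

-- Coefficients of the second comultiplication

module MatrixCoefficients {ℓ} (R : CommutativeRing ℓ ℓ) where
  open QuasisymmetricFunctions R
  open Coefficients R
  private
    module R = CommutativeRing R
    module S𝟙 = MoreSums 𝟙ᴿ

  matrices : (α β : Comp) → List (Matrix (List.length (parts β)) (List.length (parts α)))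
  matrices α β = matricesWithSums (Vec.fromList (parts α)) (Vec.fromList (parts β))

  -- On `M γ` both sides count the matrices with column sums `α`, row sums `β` and reading word `γ`.
  -- The left side selects by sums among those with the right reading word, the right side by
  -- reading word among those with the right sums. The twist is what pairs `α` with columns.
  coeff₂-ΔP′ : ∀ α β f → ⟦ coeff₂ (parts α) (parts β) ⟧ (⟦ ΔP′ ⟧ f) R.≈
    ∑ 𝟙ᴿ (matrices α β) (λ A → coeff f (readMatrix A))
  coeff₂-ΔP′ α β = QSym-ext (c₂ ∘ₗ ΔP′) (∑ₗ {V = QSym} {W = 𝟙ᴿ} (matrices α β) (λ A → coeffₗ (readMatrix A))) λ γ → begin
      ⟦ c₂ˢ ⟧ (⟦ ΔP ⟧ (M γ))
        ≈⟨ _→ₗ_.⟦⟧-cong c₂ˢ (linearExtension-M (QSym ⊗ᴹ QSym) _ γ) ⟩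
      ⟦ c₂ˢ ⟧ (∑ (QSym ⊗ᴹ QSym) (matricesReading γ) (λ (_ , _ , A) → M (row A ʳᵉᵈ) ⊗ M (column A ʳᵉᵈ)))
        ≈⟨ ∑-homo c₂ˢ (matricesReading γ) (λ (_ , _ , A) → M (row A ʳᵉᵈ) ⊗ M (column A ʳᵉᵈ)) ⟩
      ∑ 𝟙ᴿ (matricesReading γ) (λ (_ , _ , A) → coeff (M (column A ʳᵉᵈ)) (parts α) R.* coeff (M (row A ʳᵉᵈ)) (parts β))
        ≈⟨ S𝟙.∑-cong (matricesReading γ) (λ (_ , _ , A) → indicator A (row A ʳᵉᵈ ≟ᶜ β) (column A ʳᵉᵈ ≟ᶜ α)) ⟩
      ∑ 𝟙ᴿ (matricesReading γ) (λ A → if does (hasSums? α β A) then R.1# else R.0#)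
        ≈⟨ S𝟙.∑-filter (hasSums? α β) (matricesReading γ) (λ _ → R.1#) ⟨
      ∑ 𝟙ᴿ (filter (hasSums? α β) (matricesReading γ)) (λ _ → R.1#)
        ≈⟨ S𝟙.∑-↭ (λ _ → R.1#) (matricesReading-↭ α β γ) ⟩
      ∑ 𝟙ᴿ (filter (reads? γ) (sizedMatricesWithSums (toSized (parts α)) (toSized (parts β)))) (λ _ → R.1#)
        ≈⟨ S𝟙.∑-filter (reads? γ) (sizedMatricesWithSums (toSized (parts α)) (toSized (parts β))) (λ _ → R.1#) ⟩
      ∑ 𝟙ᴿ (sizedMatricesWithSums (toSized (parts α)) (toSized (parts β))) (λ A → if does (reads? γ A) then R.1# else R.0#)
        ≈⟨ S𝟙.∑-map (λ A → _ , _ , A) (matrices α β) (λ A → if does (reads? γ A) then R.1# else R.0#) ⟩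
      ∑ 𝟙ᴿ (matrices α β) (λ A → coeff (M γ) (readMatrix A)) ∎
    where
    open ≈-Reasoning R.setoid
    c₂ c₂ˢ : QSym ⊗ᴹ QSym →ₗ 𝟙ᴿ
    c₂ = coeff₂ (parts α) (parts β)
    c₂ˢ = c₂ ∘ₗ swap {M = QSym} {N = QSym}
    M-≢ : ∀ {δ} γ → δ ≢ γ → coeff (M δ) (parts γ) R.≈ R.0#
    M-≢ γ ≢γ = R.reflexive (coeff-M-≢ (parts γ) (λ eq → ≢γ (≡.trans (≡.sym eq) (parts-ʳᵉᵈ γ))))
    indicator : ∀ {p q} (A : Matrix p q) (row≟ : Dec (row A ʳᵉᵈ ≡ β)) (column≟ : Dec (column A ʳᵉᵈ ≡ α)) →
      coeff (M (column A ʳᵉᵈ)) (parts α) R.* coeff (M (row A ʳᵉᵈ)) (parts β) R.≈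
      (if does (row≟ ×-dec column≟) then R.1# else R.0#)
    indicator A (yes row≡) (yes column≡) = R.trans
      (R.*-cong (R.reflexive (coeff-M-≡ (parts α) (≡.trans (parts-ʳᵉᵈ α) (≡.sym column≡))))
        (R.reflexive (coeff-M-≡ (parts β) (≡.trans (parts-ʳᵉᵈ β) (≡.sym row≡)))))
      (R.*-identityˡ R.1#)
    indicator A (yes _)    (no column≢)  = R.trans (R.*-congʳ (M-≢ α column≢)) (R.zeroˡ _)
    indicator A (no row≢)  _             = R.trans (R.*-congˡ (M-≢ β row≢)) (R.zeroʳ _)

  module _ (V : Module R ℓ ℓ) where
    private
      module V = Module V
      open MoreSums V

    coeffAt₂-ΔP′ : ∀ α β t → ⟦ coeffAt₂ V (parts α) (parts β) ⟧ (⟦ idₗ {M = V} ⊗₁ ΔP′ ⟧ t) V.≈ᴹ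
      ∑ V (matrices α β) (λ A → ⟦ coeffAt V (readMatrix A) ⟧ t)
    coeffAt₂-ΔP′ α β = ⊗-ext {V = V} {W = QSym}
      (coeffAt₂ V (parts α) (parts β) ∘ₗ (idₗ {M = V} ⊗₁ ΔP′))
      (∑ₗ {V = V ⊗ᴹ QSym} {W = V} (matrices α β) (λ A → coeffAt V (readMatrix A)))
      (λ x f → V.≈ᴹ-trans (coeffAt₂-⊗ V (parts α) (parts β) x (⟦ ΔP′ ⟧ f))
        (V.≈ᴹ-trans (V.*ₗ-congʳ (coeff₂-ΔP′ α β f))
          (∑-homo (mkLinear {M = 𝟙ᴿ} {N = V} (λ r → r V.*ₗ x) V.*ₗ-congʳ (V.*ₗ-distribʳ x) (λ r s → V.*ₗ-assoc r s x))
            (matrices α β) (λ A → coeff f (readMatrix A)))))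

    -- Taking the coefficient at `β` in the last factor commutes with the outer `f`. The left side
    -- thus has coefficient `Ψ_α (Ψ_β x)`, and the right side has the sum over matrices.
    coaction-from-coefficients : ∀ (f : V →ₗ V ⊗ᴹ QSym) (Ψ : List ℕ → V →ₗ V) →
      (∀ w x → ⟦ coeffAt V w ⟧ (⟦ f ⟧ x) V.≈ᴹ ⟦ Ψ w ⟧ x) →
      (∀ α β x → ⟦ Ψ (parts α) ⟧ (⟦ Ψ (parts β) ⟧ x) V.≈ᴹ ∑ V (matrices α β) (λ A → ⟦ Ψ (readMatrix A) ⟧ x)) →
      ∀ x → ⟦ assoc {M = V} {N = QSym} {P = QSym} ⟧ (⟦ f ⊗₁ idₗ {M = QSym} ⟧ (⟦ f ⟧ x)) ≈ₜ ⟦ idₗ {M = V} ⊗₁ ΔP′ ⟧ (⟦ f ⟧ x)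
    coaction-from-coefficients f Ψ f-Ψ Ψ-Ψ x = coeffAt₂-injective V _ _ (λ α β → begin
      ⟦ coeffAt₂ V (parts α) (parts β) ⟧ (⟦ assoc {M = V} {N = QSym} {P = QSym} ⟧ (⟦ f ⊗₁ idₗ {M = QSym} ⟧ (⟦ f ⟧ x)))
        ≈⟨ coeffAt₂-assoc V (parts α) (parts β) (⟦ f ⊗₁ idₗ {M = QSym} ⟧ (⟦ f ⟧ x)) ⟩
      ⟦ coeffAt V (parts α) ⟧ (⟦ coeffAt (V ⊗ᴹ QSym) (parts β) ⟧ (⟦ f ⊗₁ idₗ {M = QSym} ⟧ (⟦ f ⟧ x)))
        ≈⟨ _→ₗ_.⟦⟧-cong (coeffAt V (parts α)) (natural (parts β) (⟦ f ⟧ x)) ⟩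
      ⟦ coeffAt V (parts α) ⟧ (⟦ f ⟧ (⟦ coeffAt V (parts β) ⟧ (⟦ f ⟧ x)))
        ≈⟨ f-Ψ (parts α) _ ⟩
      ⟦ Ψ (parts α) ⟧ (⟦ coeffAt V (parts β) ⟧ (⟦ f ⟧ x))
        ≈⟨ _→ₗ_.⟦⟧-cong (Ψ (parts α)) (f-Ψ (parts β) x) ⟩
      ⟦ Ψ (parts α) ⟧ (⟦ Ψ (parts β) ⟧ x)
        ≈⟨ Ψ-Ψ α β x ⟩
      ∑ V (matrices α β) (λ A → ⟦ Ψ (readMatrix A) ⟧ x)
        ≈⟨ ∑-cong (matrices α β) (λ A → f-Ψ (readMatrix A) x) ⟨
      ∑ V (matrices α β) (λ A → ⟦ coeffAt V (readMatrix A) ⟧ (⟦ f ⟧ x))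
        ≈⟨ coeffAt₂-ΔP′ α β (⟦ f ⟧ x) ⟨
      ⟦ coeffAt₂ V (parts α) (parts β) ⟧ (⟦ idₗ {M = V} ⊗₁ ΔP′ ⟧ (⟦ f ⟧ x)) ∎)
      where
      open ≈-Reasoning V.≈ᴹ-setoid
      natural : ∀ w t → ⟦ coeffAt (V ⊗ᴹ QSym) w ⟧ (⟦ f ⊗₁ idₗ {M = QSym} ⟧ t) ≈ₜ ⟦ f ⟧ (⟦ coeffAt V w ⟧ t)
      natural w = ⊗-ext {V = V} {W = QSym} {P = V ⊗ᴹ QSym}
        (coeffAt (V ⊗ᴹ QSym) w ∘ₗ (f ⊗₁ idₗ {M = QSym})) (f ∘ₗ coeffAt V w)
        (λ y g → symₜ (_→ₗ_.*ₗ-homo f (coeff g w) y))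

-- The Bernstein homomorphism

module BernsteinMap {ℓ} {R : CommutativeRing ℓ ℓ} (H : CommutativeGradedHopfAlgebra R)
  (connected : CommutativeGradedHopfAlgebra.Connected H) where
  open Bernstein H
  open Convolution H
  open Composition H
  open Coefficients R
  private
    module R = CommutativeRing R
    module S = MoreSums ⟨H⟩
  open ≈-Reasoning H.setoid

  -- Only the term of `w ʳᵉᵈ` contributes. If that composition lies beyond the range defining `β h`,
  -- then `ξ-vanishes` makes the expected value zero as well.
  coeffAt-β : ∀ w h → ⟦ coeffAt ⟨H⟩ w ⟧ (⟦ β ⟧ h) H.≈ ⟦ Ξ w ⟧ h
  coeffAt-β w h = begin
    ⟦ coeffAt ⟨H⟩ w ⟧ (⟦ β ⟧ h)
      ≈⟨ ∑-compositions-homo (coeffAt ⟨H⟩ w) (H.bound h) (λ α → ⟦ ξ α ⟧ h ⊗ M α) ⟩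
    S.∑-compositions (H.bound h) (λ α → ⟦ coeffAt ⟨H⟩ w ⟧ (⟦ ξ α ⟧ h ⊗ M α))
      ≈⟨ at (size (w ʳᵉᵈ) ℕ.<? H.bound h) ⟩
    ⟦ ξ (w ʳᵉᵈ) ⟧ h
      ≈⟨ ξ-Ξ (w ʳᵉᵈ) h ⟩
    ⟦ Ξ (parts (w ʳᵉᵈ)) ⟧ h
      ≈⟨ Ξ-ʳᵉᵈ connected w h ⟨
    ⟦ Ξ w ⟧ h ∎
    where
    at : Dec (size (w ʳᵉᵈ) < H.bound h) →
      S.∑-compositions (H.bound h) (λ α → ⟦ coeffAt ⟨H⟩ w ⟧ (⟦ ξ α ⟧ h ⊗ M α)) H.≈ ⟦ ξ (w ʳᵉᵈ) ⟧ h
    at (yes w<b) = H.trans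
      (S.∑-compositions-single (w ʳᵉᵈ) w<b (λ α α≢ → coeffAt-⊗M-≢ ⟨H⟩ w (⟦ ξ α ⟧ h) α≢))
      (coeffAt-⊗M-≡ ⟨H⟩ w (⟦ ξ (w ʳᵉᵈ) ⟧ h))
    at (no w≮b)  = H.trans
      (S.∑-compositions-zero (H.bound h) (λ α α<b → coeffAt-⊗M-≢ ⟨H⟩ w (⟦ ξ α ⟧ h) (λ { ≡.refl → w≮b α<b })))
      (H.sym (ξ-vanishes (w ʳᵉᵈ) h (ℕ.≮⇒≥ w≮b)))

  β-one : ∀ α → ⟦ Ξ (parts α) ⟧ H.1# H.≈ ⟦ coeffAt ⟨H⟩ (parts α) ⟧ (H.1# ⊗ M [])
  β-one []      = H.trans (H.⟦⟧-cong (IsAlgebraHomomorphism.one-homo H.ε-algebra))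
    (H.trans H.1#-homo (H.sym (coeffAt-⊗M-≡ ⟨H⟩ [] H.1#)))
  β-one (a ∷ α) = H.trans (Ξ-kills connected (parts (a ∷ α)) H.1-graded (λ ()))
    (H.sym (coeffAt-⊗M-≢ ⟨H⟩ (parts (a ∷ α)) H.1# {[]} (λ ())))

  β-algebra : IsAlgebraHomomorphism H.rawAlgebra H⊗QSym-rawAlgebra β
  β-algebra = AlgebraCoefficients.isAlgebraHomomorphism R ⟨H⟩ H.mul (RawAlgebra.mul H⊗QSym-rawAlgebra)
    (λ _ _ _ _ → reflₜ) H.rawAlgebra β (H.1# ⊗ M []) (λ w h → ⟦ Ξ w ⟧ h) coeffAt-β Ξ-mul β-one

  β-graded : ∀ n h → h ∈ H.piece n → _∈id⊗_ {M = ⟨H⟩} {N = QSym} (⟦ β ⟧ h) (QSymPiece n)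
  β-graded n h h∈ = AlgebraCoefficients.homogeneous-tensor R ⟨H⟩ n (⟦ β ⟧ h)
    (λ α α≢n → H.trans (coeffAt-β (parts α) h) (Ξ-kills connected (parts α) h∈ α≢n))

  β-εP : ∀ h → ⟦ unitorʳ {M = ⟨H⟩} ⟧ (⟦ idₗ {M = ⟨H⟩} ⊗₁ εP ⟧ (⟦ β ⟧ h)) H.≈ h
  β-εP h with AlgebraCoefficients.εP-expansion R ⟨H⟩ (⟦ β ⟧ h)
  ... | N , expansion = begin
    ⟦ unitorʳ {M = ⟨H⟩} ⟧ (⟦ idₗ {M = ⟨H⟩} ⊗₁ εP ⟧ (⟦ β ⟧ h))
      -- The range has to suffice both for the tensor `β h` and for the homogeneous parts of `h`.
      ≈⟨ expansion (ℕ.m≤m⊔n N (H.bound h)) ⟩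
    ∑< ⟨H⟩ (N ⊔ H.bound h) (λ n → ⟦ coeffAt ⟨H⟩ (n ∷ []) ⟧ (⟦ β ⟧ h))
      ≈⟨ S.∑<-cong (N ⊔ H.bound h) (λ n → H.trans (coeffAt-β (n ∷ []) h) (⋆-identityʳ (H.π n) h)) ⟩
    ∑< ⟨H⟩ (N ⊔ H.bound h) (λ n → H.part n h)
      ≈⟨ S.∑<-stable (H.part-vanishes h) (ℕ.m≤n⊔m N (H.bound h)) ⟩
    ∑< ⟨H⟩ (H.bound h) (λ n → H.part n h)
      ≈⟨ H.part-sum h ⟩
    h ∎

  β-coaction : ∀ h → ⟦ assoc {M = ⟨H⟩} {N = QSym} {P = QSym} ⟧ (⟦ β ⊗₁ idₗ {M = QSym} ⟧ (⟦ β ⟧ h))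
    ≈ₜ ⟦ idₗ {M = ⟨H⟩} ⊗₁ ΔP′ ⟧ (⟦ β ⟧ h)
  β-coaction = MatrixCoefficients.coaction-from-coefficients R ⟨H⟩ β Ξ coeffAt-β
    (λ α β x → H.trans
      (H.reflexive (≡.cong₂ (λ u v → ⟦ Ξ u ⟧ (⟦ Ξ v ⟧ x)) (≡.sym (Vec.toList∘fromList (parts α))) (≡.sym (Vec.toList∘fromList (parts β)))))
      (Ξ-Ξ connected (Vec.fromList (parts α)) (Vec.fromList (parts β)) x))

  β-symmetric : Cocommutative H.rawCoalgebra → ∀ h → _∈id⊗_ {M = ⟨H⟩} {N = QSym} (⟦ β ⟧ h) Λ
  β-symmetric cocomm h = SymmetricTensors.symmetric-tensor R ⟨H⟩ (⟦ β ⟧ h)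
    (λ {u} {v} u↭v → H.trans (coeffAt-β u h) (H.trans (Ξ-↭ cocomm u↭v h) (H.sym (coeffAt-β v h))))

  -- a proof of IsRelativeCoalgebraHomomorphism H.algebra H.rawCoalgebra (extendCoalgebra H.algebra QSym-rawCoalgebra) βᴴ,
  -- without a type signature because comparing this type with the inferred one unfolds all linear maps
  βᴴ-homomorphism = RelativeCoalgebras.isRelativeCoalgebraHomomorphism H.algebra H.rawCoalgebra QSym-rawCoalgebra
    m (λ _ _ _ _ → reflₜ) β
    (AlgebraCoefficients.Δ-from-coefficients R ⟨H⟩ H.mul m (λ _ _ _ _ → reflₜ) H.Δ β Ξ coeffAt-β Ξ-++)
    (λ h → H.trans
      (RelativeCoalgebras.extend-𝟙-unique H.algebra (RawCoalgebra.ε QSym-rawCoalgebra) (coeffAt ⟨H⟩ []) (λ _ _ → H.refl) (⟦ β ⟧ h))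
      (coeffAt-β [] h))
    where
    m : (⟨H⟩ ⊗ᴹ QSym) ⊗ᴹ (⟨H⟩ ⊗ᴹ QSym) →ₗ ⟨H⟩ ⊗ᴹ (QSym ⊗ᴹ QSym)
    m = (H.mul ⊗₁ idₗ {M = QSym ⊗ᴹ QSym}) ∘ₗ interchange {M = ⟨H⟩} {N = QSym} {P = ⟨H⟩} {Q = QSym}

theorem5p7 : {ℓ : Level} (R : CommutativeRing ℓ ℓ) (H : CommutativeGradedHopfAlgebra R) →
    CommutativeGradedHopfAlgebra.Connected H →
    let open Bernstein H in
    ( IsAlgebraHomomorphism H.rawAlgebra H⊗QSym-rawAlgebra β
    × IsRelativeCoalgebraHomomorphism H.algebra H.rawCoalgebra (extendCoalgebra H.algebra QSym-rawCoalgebra) βᴴ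
    × (∀ n h → h ∈ H.piece n → _∈id⊗_ {M = ⟨H⟩} {N = QSym} (⟦ β ⟧ h) (QSymPiece n)) )
    × (∀ h → ⟦ unitorʳ {M = ⟨H⟩} ⟧ (⟦ idₗ {M = ⟨H⟩} ⊗₁ εP ⟧ (⟦ β ⟧ h)) H.≈ h)
    × (∀ h → ⟦ assoc {M = ⟨H⟩} {N = QSym} {P = QSym} ⟧ (⟦ β ⊗₁ idₗ {M = QSym} ⟧ (⟦ β ⟧ h))
    ≈ₜ ⟦ idₗ {M = ⟨H⟩} ⊗₁ ΔP′ ⟧ (⟦ β ⟧ h))
    × (Cocommutative H.rawCoalgebra → ∀ h → _∈id⊗_ {M = ⟨H⟩} {N = QSym} (⟦ β ⟧ h) Λ)
theorem5p7 R H connected =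
  ( β-algebra
  , record
    -- The corresponding bilinear maps agree definitionally on pure tensors, hence the trivial
    -- arguments.
    { Δ-homo = λ x → Δ-homo-transfer H.algebra {C = ⟨H⟩} {D = QSym} x (IsCoalgebraHomomorphism.Δ-homo βᴴ-homomorphism x)
        (λ _ _ → reflₜ) (λ _ _ → reflₜ) (λ _ _ _ → reflₜ) (λ _ _ → reflₜ) (λ _ _ _ → reflₜ) (λ _ _ _ _ → reflₜ)
    ; ε-homo = IsCoalgebraHomomorphism.ε-homo βᴴ-homomorphism
    }
  , β-graded )
  , β-εP
  , β-coaction
  , β-symmetric
  where
  open Bernstein H
  open BernsteinMap H connected
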